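{- Let $k$, $t$ and $\lambda$ be positive integers such that $k \geq t+1$ and $t\geq 2$, and let $\alpha$ be the unique positive real number satisfying \[ \frac{\lambda(2^{t+1}-1)}{t!}\,\alpha^t+2\left(\frac{e\lambda(t+1)(2^{t+1}-1)}{t!}\right)^{1/t}\alpha=1, \] where $e$ is the base of the natural logarithm. Then for every integer $n \geq k$, every partial $(n,k,t)_\lambda$-system has a cyclically $\ell$-good sequencing for each positive integer $\ell \leq \alpha n^{1/t}$.
   Context: For positive integers $n,k,t,\lambda$ with $n \geq k > t \geq 2$, a partial $(n,k,t)_\lambda$-system is a pair $(X,\mathcal{B})$ where $X$ is an $n$-set of vertices and $\mathcal{B}$ is a collection of $k$-subsets of $X$ (blocks) such that each $t$-subset of $X$ is contained in at most $\lambda$ blocks. An independent set is a subset $Y\subseteq X$ containing no block. Let $\mathbb{Z}_n=\{0,\ldots,n-1\}$ be the cyclic group of order $n$. A sequencing is a bijection $\varphi:\mathbb{Z}_n\to X$. A set $S\subseteq X$ is cyclically consecutive if $S=\{\varphi(i),\varphi(i+1),\ldots,\varphi(i+|S|-1)\}$ for some $i\in\mathbb{Z}_n$ (addition in $\mathbb{Z}_n$). For a positive integer $\ell$, a sequencing is cyclically $\ell$-good if every set of $\ell$ cyclically consecutive vertices is an independent set. -}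

module Defs where

open import Algebra.Definitions.RawSemiring using () renaming (_^_ to pow)
open import Data.Bool using (if_then_else_)
open import Data.Fin using (Fin; toℕ)
open import Data.Fin.Properties using (nonZeroIndex)
import Data.Fin.Subset as Sub
open Sub using (Subset; _∈_; _⊆_)
open import Data.Fin.Subset.Properties using (_⊆?_)
open import Data.Integer as ℤ using (+_; -[1+_])
import Data.Integer.Properties as ℤ
open import Data.List using (List; length; filter)
open import Data.List.Relation.Unary.All using (All)
import Data.List.Membership.Propositional as List
open import Data.Nat as ℕ using (ℕ; zero; suc; _!; NonZero)
open import Data.Nat.DivMod using (_mod_)
import Data.Nat.Properties as ℕ
open import Data.Product using (∃-syntax; _×_; _,_; proj₁; proj₂)
open import Data.Rational as ℚ
  using (ℚ; mkℚ; 0ℚ; 1ℚ; ½; _/_; _+_; _*_; _-_; -_; ∣_∣; _<_; _≤_; _⊔_; 1/_)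
import Data.Rational.Properties as ℚ
open import Data.Rational.Solver using (module +-*-Solver)
import Data.Rational.Unnormalised as ℚᵘ
import Data.Rational.Unnormalised.Properties as ℚᵘ
open import Data.Sum using (inj₁; inj₂)
open import Function using (_⤖_; _⇔_; Bijection)
open import Relation.Binary.PropositionalEquality
open import Relation.Nullary using (¬_; Dec; does; yes; no; contradiction)

open ℚ.≤-Reasoning

infixr 8 _^ℚ_

_^ℚ_ : ℚ → ℕ → ℚ
_^ℚ_ = pow ℚ.+-*-rawSemiring

module RationalLemmas where
  module Identities where
    open +-*-Solver
    split : ∀ p q → p ≡ q + (p - q)
    split = solve 2 (λ p q → p := q :+ (p :- q)) refl
    cancel : ∀ q r → (q + r) - q ≡ r
    cancel = solve 2 (λ q r → (q :+ r) :- q := r) refl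
    neg-sub : ∀ p q → - (p - q) ≡ q - p
    neg-sub = solve 2 (λ p q → :- (p :- q) := q :- p) refl
    +-sub : ∀ a b c d → (a + b) - (c + d) ≡ (a - c) + (b - d)
    +-sub = solve 4 (λ a b c d → (a :+ b) :- (c :+ d) := (a :- c) :+ (b :- d)) refl
    *-sub : ∀ a b c d → a * b - c * d ≡ a * (b - d) + d * (a - c)
    *-sub = solve 4 (λ a b c d → a :* b :- c :* d := a :* (b :- d) :+ d :* (a :- c)) refl

  open Identities public

  toℚᵘ-/ : ∀ i m .{{_ : NonZero m}} → ℚ.toℚᵘ (i / m) ℚᵘ.≃ (i ℚᵘ./ m)
  toℚᵘ-/ i (suc m) = ℚ.toℚᵘ-fromℚᵘ (ℚᵘ.mkℚᵘ i m)

  /-mono-≤ : ∀ i j m n .{{_ : NonZero m}} .{{_ : NonZero n}} →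
             i ℤ.* + n ℤ.≤ j ℤ.* + m → i / m ≤ j / n
  /-mono-≤ i j m@(suc _) n@(suc _) h = ℚ.toℚᵘ-cancel-≤
    (ℚᵘ.≤-trans (ℚᵘ.≤-reflexive (toℚᵘ-/ i m))
      (ℚᵘ.≤-trans (ℚᵘ.*≤* h) (ℚᵘ.≤-reflexive (ℚᵘ.≃-sym (toℚᵘ-/ j n)))))

  /-distrib-+ : ∀ i j m .{{_ : NonZero m}} → i / m + j / m ≡ (i ℤ.+ j) / m
  /-distrib-+ i j m@(suc _) = ℚ.toℚᵘ-injective
    (ℚᵘ.≃-trans (ℚ.toℚᵘ-homo-+ (i / m) (j / m))
    (ℚᵘ.≃-trans (ℚᵘ.+-cong (toℚᵘ-/ i m) (toℚᵘ-/ j m))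
    (ℚᵘ.≃-trans (ℚᵘ.*≡* lem) (ℚᵘ.≃-sym (toℚᵘ-/ (i ℤ.+ j) m)))))
    where
    lem : (i ℤ.* + m ℤ.+ j ℤ.* + m) ℤ.* + m ≡ (i ℤ.+ j) ℤ.* (+ m ℤ.* + m)
    lem = trans (cong (ℤ._* + m) (sym (ℤ.*-distribʳ-+ (+ m) i j)))
                (ℤ.*-assoc (i ℤ.+ j) (+ m) (+ m))

  /-pos : ∀ m .{{_ : NonZero m}} → 0ℚ < + 1 / m
  /-pos m = ℚ.positive⁻¹ (+ 1 / m) {{ℚ.normalize-pos 1 m}}

  /-nonNeg : ∀ i m .{{_ : NonZero m}} → 0ℚ ≤ + i / m
  /-nonNeg i m = ℚ.nonNegative⁻¹ (+ i / m) {{ℚ.normalize-nonNeg i m}}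

  archimedean : ∀ ε → 0ℚ < ε → ∃[ N ] (∀ n .{{_ : NonZero n}} → N ℕ.≤ n → + 1 / n < ε)
  archimedean (mkℚ (+ zero) d c) 0<ε = contradiction (ℚ.positive 0<ε) λ ()
  archimedean (mkℚ -[1+ _ ] d c) 0<ε = contradiction (ℚ.positive 0<ε) λ ()
  archimedean ε@(mkℚ (+ suc p) d c) _ = suc (suc d) , small
    where
    bound : ∀ n → suc (suc d) ℕ.≤ n → + 1 ℤ.* + suc d ℤ.< + suc p ℤ.* + n
    bound n h = subst₂ ℤ._<_ (sym (ℤ.*-identityˡ _)) (ℤ.pos-* (suc p) n)
      (ℤ.+<+ (ℕ.≤-trans h (ℕ.m≤n*m n (suc p))))
    small : ∀ n .{{_ : NonZero n}} → suc (suc d) ℕ.≤ n → + 1 / n < ε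
    small n@(suc _) h = ℚ.toℚᵘ-cancel-<
      (ℚᵘ.≤-<-trans (ℚᵘ.≤-reflexive (toℚᵘ-/ (+ 1) n)) (ℚᵘ.*<* (bound n h)))

  half+half : ∀ ε → ½ * ε + ½ * ε ≡ ε
  half+half ε = trans (sym (ℚ.*-distribʳ-+ ε ½ ½)) (ℚ.*-identityˡ ε)

  *-pos : ∀ {p q} → 0ℚ < p → 0ℚ < q → 0ℚ < p * q
  *-pos {p} {q} 0<p 0<q =
    ℚ.positive⁻¹ (p * q) {{ℚ.pos*pos⇒pos p {{ℚ.positive 0<p}} q {{ℚ.positive 0<q}}}}

  half-pos : ∀ {ε} → 0ℚ < ε → 0ℚ < ½ * ε
  half-pos = *-pos (ℚ.positive⁻¹ ½)

  *-monoˡ : ∀ {p q r} → 0ℚ ≤ r → p ≤ q → r * p ≤ r * q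
  *-monoˡ {r = r} 0≤r = ℚ.*-monoˡ-≤-nonNeg r {{ℚ.nonNegative 0≤r}}

  *-monoʳ : ∀ {p q r} → 0ℚ ≤ r → p ≤ q → p * r ≤ q * r
  *-monoʳ {r = r} 0≤r = ℚ.*-monoʳ-≤-nonNeg r {{ℚ.nonNegative 0≤r}}

  p≤∣p∣ : ∀ p → p ≤ ∣ p ∣
  p≤∣p∣ p with ℚ.≤-total 0ℚ p
  ... | inj₁ 0≤p = ℚ.≤-reflexive (sym (ℚ.0≤p⇒∣p∣≡p 0≤p))
  ... | inj₂ p≤0 = ℚ.≤-trans p≤0 (ℚ.0≤∣p∣ p)

  ∣p-q∣<r⇒p<q+r : ∀ {p q r} → ∣ p - q ∣ < r → p < q + r
  ∣p-q∣<r⇒p<q+r {p} {q} {r} h = begin-strict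
    p            ≡⟨ split p q ⟩
    q + (p - q)  <⟨ ℚ.+-monoʳ-< q (ℚ.≤-<-trans (p≤∣p∣ (p - q)) h) ⟩
    q + r        ∎

  within : ∀ {p q r} → p < q + r → q < p + r → ∣ p - q ∣ < r
  within {p} {q} {r} h₁ h₂ with ℚ.∣p∣≡p∨∣p∣≡-p (p - q)
  ... | inj₁ eq = begin-strict
    ∣ p - q ∣      ≡⟨ eq ⟩
    p - q          <⟨ ℚ.+-monoˡ-< (- q) h₁ ⟩
    (q + r) - q    ≡⟨ cancel q r ⟩
    r              ∎
  ... | inj₂ eq = begin-strict
    ∣ p - q ∣      ≡⟨ eq ⟩
    - (p - q)      ≡⟨ neg-sub p q ⟩
    q - p          <⟨ ℚ.+-monoˡ-< (- p) h₂ ⟩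
    (p + r) - p    ≡⟨ cancel p r ⟩
    r              ∎

open RationalLemmas

-- Reals are Cauchy sequences of rationals; their equality is _≃_, not _≡_.
Cauchy : (ℕ → ℚ) → Set
Cauchy x = ∀ ε → 0ℚ < ε → ∃[ N ] (∀ m n → N ℕ.≤ m → N ℕ.≤ n → ∣ x m - x n ∣ < ε)

record ℝ : Set where
  constructor mkℝ
  field
    seq    : ℕ → ℚ
    cauchy : Cauchy seq

open ℝ public

infix 4 _≃_ _≤ᴿ_ _<ᴿ_

_≃_ : ℝ → ℝ → Set
x ≃ y = ∀ ε → 0ℚ < ε → ∃[ N ] (∀ n → N ℕ.≤ n → ∣ seq x n - seq y n ∣ < ε)

_≤ᴿ_ : ℝ → ℝ → Set
x ≤ᴿ y = ∀ ε → 0ℚ < ε → ∃[ N ] (∀ n → N ℕ.≤ n → seq x n < seq y n + ε)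

_<ᴿ_ : ℝ → ℝ → Set
x <ᴿ y = ∃[ ε ] 0ℚ < ε × ∃[ N ] (∀ n → N ℕ.≤ n → seq x n + ε < seq y n)

fromℚ : ℚ → ℝ
fromℚ q = mkℝ (λ _ → q) λ ε 0<ε → 0 , λ _ _ _ _ → subst (_< ε) (sym ∣q-q∣≡0) 0<ε
  where
  ∣q-q∣≡0 : ∣ q - q ∣ ≡ 0ℚ
  ∣q-q∣≡0 = cong ∣_∣ (ℚ.+-inverseʳ q)

fromℕ : ℕ → ℝ
fromℕ n = fromℚ (+ n / 1)

0ᴿ 1ᴿ : ℝ
0ᴿ = fromℕ 0
1ᴿ = fromℕ 1

module CauchyLemmas where
  +-cauchy : ∀ x y → Cauchy x → Cauchy y → Cauchy (λ n → x n + y n)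
  +-cauchy x y cx cy ε 0<ε
    with Nx , hx ← cx (½ * ε) (half-pos 0<ε)
       | Ny , hy ← cy (½ * ε) (half-pos 0<ε)
    = Nx ℕ.⊔ Ny , λ m n N≤m N≤n → begin-strict
      ∣ (x m + y m) - (x n + y n) ∣      ≡⟨ cong ∣_∣ (+-sub (x m) (y m) (x n) (y n)) ⟩
      ∣ (x m - x n) + (y m - y n) ∣      ≤⟨ ℚ.∣p+q∣≤∣p∣+∣q∣ (x m - x n) (y m - y n) ⟩
      ∣ x m - x n ∣ + ∣ y m - y n ∣      <⟨ ℚ.+-mono-<
        (hx m n (ℕ.m⊔n≤o⇒m≤o Nx Ny N≤m) (ℕ.m⊔n≤o⇒m≤o Nx Ny N≤n))
        (hy m n (ℕ.m⊔n≤o⇒n≤o Nx Ny N≤m) (ℕ.m⊔n≤o⇒n≤o Nx Ny N≤n)) ⟩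
      ½ * ε + ½ * ε                      ≡⟨ half+half ε ⟩
      ε                                  ∎

  eventually-bounded : ∀ x → Cauchy x →
    ∃[ K ] 0ℚ < K × ∃[ N ] (∀ n → N ℕ.≤ n → ∣ x n ∣ < K)
  eventually-bounded x cx with N , h ← cx 1ℚ (ℚ.positive⁻¹ 1ℚ)
    = ∣ x N ∣ + 1ℚ
    , ℚ.+-mono-≤-< (ℚ.0≤∣p∣ (x N)) (ℚ.positive⁻¹ 1ℚ)
    , N , λ n N≤n → begin-strict
      ∣ x n ∣                    ≡⟨ cong ∣_∣ (split (x n) (x N)) ⟩
      ∣ x N + (x n - x N) ∣      ≤⟨ ℚ.∣p+q∣≤∣p∣+∣q∣ (x N) (x n - x N) ⟩
      ∣ x N ∣ + ∣ x n - x N ∣    <⟨ ℚ.+-monoʳ-< ∣ x N ∣ (h n N N≤n ℕ.≤-refl) ⟩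
      ∣ x N ∣ + 1ℚ               ∎

  quotient : ∀ s ε → 0ℚ < s → 0ℚ < ε → ∃[ δ ] 0ℚ < δ × s * δ ≡ ε
  quotient s ε 0<s 0<ε = ε * r , *-pos 0<ε 0<r , eq
    where
    instance
      s-pos : ℚ.Positive s
      s-pos = ℚ.positive 0<s
      s≢0 : ℚ.NonZero s
      s≢0 = ℚ.pos⇒nonZero s
    r : ℚ
    r = 1/ s
    0<r : 0ℚ < r
    0<r = ℚ.positive⁻¹ r {{ℚ.1/pos⇒pos s}}
    eq : s * (ε * r) ≡ ε
    eq = trans (ℚ.*-comm s (ε * r)) (trans (ℚ.*-assoc ε r s)
           (trans (cong (ε *_) (ℚ.*-inverseˡ s)) (ℚ.*-identityʳ ε)))

  mul-< : ∀ p q r δ → 0ℚ < r → p < r → 0ℚ ≤ q → q < δ → p * q < r * δ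
  mul-< p q r δ 0<r p<r 0≤q q<δ = ℚ.≤-<-trans (*-monoʳ 0≤q (ℚ.<⇒≤ p<r))
    (ℚ.*-monoʳ-<-pos r {{ℚ.positive 0<r}} q<δ)

  *-close : ∀ a b c d K L δ → 0ℚ < K → 0ℚ < L → ∣ a ∣ < K → ∣ d ∣ < L →
            ∣ a - c ∣ < δ → ∣ b - d ∣ < δ → ∣ a * b - c * d ∣ < (K + L) * δ
  *-close a b c d K L δ 0<K 0<L a<K d<L a-c b-d =
    subst₂ _<_ (cong ∣_∣ (sym (*-sub a b c d))) (sym (ℚ.*-distribʳ-+ δ K L))
      (ℚ.≤-<-trans (ℚ.∣p+q∣≤∣p∣+∣q∣ (a * (b - d)) (d * (a - c)))
        (ℚ.+-mono-<
          (subst (_< K * δ) (sym (ℚ.∣p*q∣≡∣p∣*∣q∣ a (b - d)))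
            (mul-< (∣ a ∣) (∣ b - d ∣) K δ 0<K a<K (ℚ.0≤∣p∣ (b - d)) b-d))
          (subst (_< L * δ) (sym (ℚ.∣p*q∣≡∣p∣*∣q∣ d (a - c)))
            (mul-< (∣ d ∣) (∣ a - c ∣) L δ 0<L d<L (ℚ.0≤∣p∣ (a - c)) a-c))))

  *-cauchy : ∀ x y → Cauchy x → Cauchy y → Cauchy (λ n → x n * y n)
  *-cauchy x y cx cy ε 0<ε =
    let K , 0<K , N₁ , bx = eventually-bounded x cx
        L , 0<L , N₂ , by = eventually-bounded y cy
        δ , 0<δ , eq = quotient (K + L) ε (ℚ.+-mono-< 0<K 0<L) 0<ε
        N₃ , hx = cx δ 0<δ
        N₄ , hy = cy δ 0<δ
        M = N₁ ℕ.⊔ N₂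
        M′ = N₃ ℕ.⊔ N₄
    in M ℕ.⊔ M′ , λ m n N≤m N≤n →
      subst (∣ x m * y m - x n * y n ∣ <_) eq
        (*-close (x m) (y m) (x n) (y n) K L δ 0<K 0<L
          (bx m (ℕ.m⊔n≤o⇒m≤o N₁ N₂ (ℕ.m⊔n≤o⇒m≤o M M′ N≤m)))
          (by n (ℕ.m⊔n≤o⇒n≤o N₁ N₂ (ℕ.m⊔n≤o⇒m≤o M M′ N≤n)))
          (hx m n (ℕ.m⊔n≤o⇒m≤o N₃ N₄ (ℕ.m⊔n≤o⇒n≤o M M′ N≤m))
                  (ℕ.m⊔n≤o⇒m≤o N₃ N₄ (ℕ.m⊔n≤o⇒n≤o M M′ N≤n)))
          (hy m n (ℕ.m⊔n≤o⇒n≤o N₃ N₄ (ℕ.m⊔n≤o⇒n≤o M M′ N≤m))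
                  (ℕ.m⊔n≤o⇒n≤o N₃ N₄ (ℕ.m⊔n≤o⇒n≤o M M′ N≤n))))

open CauchyLemmas

infixl 6 _+ᴿ_
infixl 7 _*ᴿ_
infixr 8 _^ᴿ_

_+ᴿ_ : ℝ → ℝ → ℝ
x +ᴿ y = mkℝ (λ n → seq x n + seq y n) (+-cauchy (seq x) (seq y) (cauchy x) (cauchy y))

_*ᴿ_ : ℝ → ℝ → ℝ
x *ᴿ y = mkℝ (λ n → seq x n * seq y n) (*-cauchy (seq x) (seq y) (cauchy x) (cauchy y))

_^ᴿ_ : ℝ → ℕ → ℝ
x ^ᴿ zero  = 1ᴿ
x ^ᴿ suc n = x *ᴿ x ^ᴿ n

1/! : ℕ → ℚ
1/! n = (+ 1 / n !) {{n ℕ.!≢0}}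

exp-sum : ℕ → ℚ
exp-sum zero    = 0ℚ
exp-sum (suc n) = exp-sum n + 1/! n

module ExpLemmas where
  1/!-nonNeg : ∀ n → 0ℚ ≤ 1/! n
  1/!-nonNeg n = /-nonNeg 1 (n !) {{n ℕ.!≢0}}

  1/!-halves : ∀ n → 1 ℕ.≤ n → 1/! (suc n) + 1/! (suc n) ≤ 1/! n
  1/!-halves n 1≤n = ℚ.≤-trans
    (ℚ.≤-reflexive (/-distrib-+ (+ 1) (+ 1) (suc n !) {{suc n ℕ.!≢0}}))
    (/-mono-≤ (+ 2) (+ 1) (suc n !) (n !) {{suc n ℕ.!≢0}} {{n ℕ.!≢0}} bound)
    where
    bound : + 2 ℤ.* + (n !) ℤ.≤ + 1 ℤ.* + (suc n !)
    bound = subst₂ ℤ._≤_ (ℤ.pos-* 2 (n !)) (sym (ℤ.*-identityˡ (+ (suc n !))))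
      (ℤ.+≤+ (ℕ.*-monoˡ-≤ (n !) (ℕ.s≤s 1≤n)))

  exp-sum-mono : ∀ {m n} → m ℕ.≤′ n → exp-sum m ≤ exp-sum n
  exp-sum-mono ℕ.≤′-refl = ℚ.≤-refl
  exp-sum-mono {m} (ℕ.≤′-step {n} h) = ℚ.≤-trans (exp-sum-mono h)
    (subst (_≤ exp-sum n + 1/! n) (ℚ.+-identityʳ (exp-sum n))
      (ℚ.+-monoʳ-≤ (exp-sum n) (1/!-nonNeg n)))

  exp-upper : ℕ → ℚ
  exp-upper n = exp-sum n + (1/! n + 1/! n)

  exp-upper-anti : ∀ {m n} → 1 ℕ.≤ m → m ℕ.≤′ n → exp-upper n ≤ exp-upper m
  exp-upper-anti 1≤m ℕ.≤′-refl = ℚ.≤-refl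
  exp-upper-anti {m} 1≤m (ℕ.≤′-step {n} h) = ℚ.≤-trans
    (subst (exp-upper (suc n) ≤_) (ℚ.+-assoc (exp-sum n) (1/! n) (1/! n))
      (ℚ.+-monoʳ-≤ (exp-sum (suc n)) (1/!-halves n (ℕ.≤-trans 1≤m (ℕ.≤′⇒≤ h)))))
    (exp-upper-anti 1≤m h)

  exp-sum≤exp-upper : ∀ n → exp-sum n ≤ exp-upper n
  exp-sum≤exp-upper n = subst (_≤ exp-upper n) (ℚ.+-identityʳ (exp-sum n))
    (ℚ.+-monoʳ-≤ (exp-sum n) (ℚ.+-mono-≤ (1/!-nonNeg n) (1/!-nonNeg n)))

  n≤n! : ∀ n → n ℕ.≤ n !
  n≤n! zero    = ℕ.z≤n
  n≤n! (suc n) = ℕ.m≤m*n (suc n) (n !) {{n ℕ.!≢0}}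

  exp-sum-cauchy : Cauchy exp-sum
  exp-sum-cauchy ε 0<ε = N , λ m n N≤m N≤n → within (close m n N≤m N≤n) (close n m N≤n N≤m)
    where
    small : ∃[ M ] (∀ n .{{_ : NonZero n}} → M ℕ.≤ n → + 1 / n < ½ * ε)
    small = archimedean (½ * ε) (half-pos 0<ε)
    N : ℕ
    N = suc (proj₁ small)
    1/!N< : 1/! N < ½ * ε
    1/!N< = proj₂ small (N !) {{N ℕ.!≢0}} (ℕ.≤-trans (ℕ.n≤1+n _) (n≤n! N))
    gap : 1/! N + 1/! N < ε
    gap = subst (1/! N + 1/! N <_) (half+half ε) (ℚ.+-mono-< 1/!N< 1/!N<)
    close : ∀ m n → N ℕ.≤ m → N ℕ.≤ n → exp-sum m < exp-sum n + ε
    close m n N≤m N≤n = ℚ.≤-<-trans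
      (ℚ.≤-trans (exp-sum≤exp-upper m) (exp-upper-anti (ℕ.s≤s ℕ.z≤n) (ℕ.≤⇒≤′ N≤m)))
      (ℚ.+-mono-≤-< (exp-sum-mono (ℕ.≤⇒≤′ N≤n)) gap)

open ExpLemmas

-- e = Σ_{i ≥ 0} 1 / i !
e : ℝ
e = mkℝ exp-sum exp-sum-cauchy

module PowerLemmas where
  ^-nonNeg : ∀ {p} n → 0ℚ ≤ p → 0ℚ ≤ p ^ℚ n
  ^-nonNeg zero    0≤p = ℚ.nonNegative⁻¹ 1ℚ
  ^-nonNeg {p} (suc n) 0≤p =
    subst (_≤ p * p ^ℚ n) (ℚ.*-zeroʳ p) (*-monoˡ 0≤p (^-nonNeg n 0≤p))

  ^-pos : ∀ {p} n → 0ℚ < p → 0ℚ < p ^ℚ n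
  ^-pos zero    0<p = ℚ.positive⁻¹ 1ℚ
  ^-pos (suc n) 0<p = *-pos 0<p (^-pos n 0<p)

  ^-mono : ∀ {p q} n → 0ℚ ≤ p → p ≤ q → p ^ℚ n ≤ q ^ℚ n
  ^-mono zero    0≤p p≤q = ℚ.≤-refl
  ^-mono (suc n) 0≤p p≤q = ℚ.≤-trans (*-monoʳ (^-nonNeg n 0≤p) p≤q)
    (*-monoˡ (ℚ.≤-trans 0≤p p≤q) (^-mono n 0≤p p≤q))

  p≤p+q : ∀ {p q} → 0ℚ ≤ q → p ≤ p + q
  p≤p+q {p} {q} 0≤q = subst (_≤ p + q) (ℚ.+-identityʳ p) (ℚ.+-monoʳ-≤ p 0≤q)

  q≤p+q : ∀ {p q} → 0ℚ ≤ p → q ≤ p + q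
  q≤p+q {p} {q} 0≤p = subst (_≤ p + q) (ℚ.+-identityˡ q) (ℚ.+-monoˡ-≤ q 0≤p)

  ^-superadditive : ∀ {p q} n .{{_ : NonZero n}} → 0ℚ ≤ p → 0ℚ ≤ q →
                    p ^ℚ n + q ^ℚ n ≤ (p + q) ^ℚ n
  ^-superadditive {p} {q} (suc n) 0≤p 0≤q = ℚ.≤-trans
    (ℚ.+-mono-≤ (*-monoˡ 0≤p (^-mono n 0≤p (p≤p+q 0≤q)))
                (*-monoˡ 0≤q (^-mono n 0≤q (q≤p+q 0≤p))))
    (ℚ.≤-reflexive (sym (ℚ.*-distribʳ-+ ((p + q) ^ℚ n) p q)))

  ^-increasing : ∀ {p} n .{{_ : NonZero n}} → 1ℚ ≤ p → p ≤ p ^ℚ n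
  ^-increasing {p} (suc n) 1≤p =
    subst (_≤ p * p ^ℚ n) (ℚ.*-identityʳ p) (*-monoˡ (ℚ.≤-trans 0≤1 1≤p) (1≤^ n))
    where
    0≤1 : 0ℚ ≤ 1ℚ
    0≤1 = ℚ.nonNegative⁻¹ 1ℚ
    1≤^ : ∀ m → 1ℚ ≤ p ^ℚ m
    1≤^ zero    = ℚ.≤-refl
    1≤^ (suc m) = ℚ.≤-trans 1≤p
      (subst (_≤ p * p ^ℚ m) (ℚ.*-identityʳ p) (*-monoˡ (ℚ.≤-trans 0≤1 1≤p) (1≤^ m)))

open PowerLemmas

-- The largest j ≤ b such that (j / d) ^ t ≤ q (and 0 if there is none).
search : ∀ (t : ℕ) (q : ℚ) (d : ℕ) .{{_ : NonZero d}} → ℕ → ℕ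
search t q d zero    = 0
search t q d (suc b) =
  if does ((+ suc b / d) ^ℚ t ℚ.≤? q) then suc b else search t q d b

-- The t-th root of q ⊔ 0, rounded down to a multiple of 1 / d.
root-approx : ∀ (t : ℕ) (q : ℚ) (d : ℕ) .{{_ : NonZero d}} → ℚ
root-approx t q d = + search t (q ⊔ 0ℚ) d (d ℕ.* suc ℤ.∣ ℚ.↥ (q ⊔ 0ℚ) ∣) / d

module RootLemmas where
  if-does : ∀ {P : Set} (P? : Dec P) (Q : ℕ → Set) {i j} →
            (P → Q i) → (¬ P → Q j) → Q (if does P? then i else j)
  if-does (yes p) Q f g = f p
  if-does (no ¬p) Q f g = g ¬p

  search-lower : ∀ t q d .{{_ : NonZero d}} b → (+ 0 / d) ^ℚ t ≤ q →
                 (+ search t q d b / d) ^ℚ t ≤ q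
  search-lower t q d zero    h = h
  search-lower t q d (suc b) h =
    if-does ((+ suc b / d) ^ℚ t ℚ.≤? q) (λ j → (+ j / d) ^ℚ t ≤ q)
      (λ le → le) (λ _ → search-lower t q d b h)

  search-upper : ∀ t q d .{{_ : NonZero d}} b → q < (+ suc b / d) ^ℚ t →
                 q < (+ suc (search t q d b) / d) ^ℚ t
  search-upper t q d zero    h = h
  search-upper t q d (suc b) h =
    if-does ((+ suc b / d) ^ℚ t ℚ.≤? q) (λ j → q < (+ suc j / d) ^ℚ t)
      (λ _ → h) (λ ¬le → search-upper t q d b (ℚ.≰⇒> ¬le))

  <-numerator : ∀ q → q < + suc ℤ.∣ ℚ.↥ q ∣ / 1
  <-numerator q@(mkℚ n d c) = ℚ.toℚᵘ-cancel-<
    (ℚᵘ.<-≤-trans (ℚᵘ.*<* (bound n)) (ℚᵘ.≤-reflexive (ℚᵘ.≃-sym (toℚᵘ-/ (+ suc ℤ.∣ n ∣) 1))))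
    where
    bound : ∀ i → i ℤ.* + 1 ℤ.< + suc ℤ.∣ i ∣ ℤ.* + suc d
    bound i = subst₂ ℤ._<_ (sym (ℤ.*-identityʳ i)) (ℤ.pos-* (suc ℤ.∣ i ∣) (suc d))
      (ℤ.≤-<-trans (i≤∣i∣ i) (ℤ.+<+ (ℕ.m≤m*n (suc ℤ.∣ i ∣) (suc d))))
      where
      i≤∣i∣ : ∀ i → i ℤ.≤ + ℤ.∣ i ∣
      i≤∣i∣ (+ n)    = ℤ.≤-refl
      i≤∣i∣ -[1+ n ] = ℤ.-≤+

  root-approx-nonNeg : ∀ t q d .{{_ : NonZero d}} → 0ℚ ≤ root-approx t q d
  root-approx-nonNeg t q d = /-nonNeg (search t (q ⊔ 0ℚ) d (d ℕ.* suc ℤ.∣ ℚ.↥ (q ⊔ 0ℚ) ∣)) d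

  root-approx-lower : ∀ t q d .{{_ : NonZero t}} .{{_ : NonZero d}} →
                      root-approx t q d ^ℚ t ≤ q ⊔ 0ℚ
  root-approx-lower t@(suc s) q d = search-lower t (q ⊔ 0ℚ) d (d ℕ.* suc ℤ.∣ ℚ.↥ (q ⊔ 0ℚ) ∣)
    (subst (λ z → z ^ℚ t ≤ q ⊔ 0ℚ) (sym (ℚ.0/n≡0 d))
      (subst (_≤ q ⊔ 0ℚ) (sym (ℚ.*-zeroˡ (0ℚ ^ℚ s))) (ℚ.p≤q⊔p q 0ℚ)))

  root-approx-upper : ∀ t q d .{{_ : NonZero t}} .{{_ : NonZero d}} →
                      q ⊔ 0ℚ < (root-approx t q d + + 1 / d) ^ℚ t
  root-approx-upper t q d = subst (λ z → p < z ^ℚ t) next (search-upper t p d b b-large)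
    where
    p : ℚ
    p = q ⊔ 0ℚ
    c b j : ℕ
    c = suc ℤ.∣ ℚ.↥ p ∣
    b = d ℕ.* c
    j = search t p d b
    next : + suc j / d ≡ + j / d + + 1 / d
    next = trans (cong (λ i → + i / d) (ℕ.+-comm 1 j)) (sym (/-distrib-+ (+ j) (+ 1) d))
    c/1≤ : + c / 1 ≤ + suc b / d
    c/1≤ = /-mono-≤ (+ c) (+ suc b) 1 d
      (subst₂ ℤ._≤_ (ℤ.pos-* c d) (sym (ℤ.*-identityʳ (+ suc b)))
        (ℤ.+≤+ (ℕ.≤-trans (ℕ.≤-reflexive (ℕ.*-comm c d)) (ℕ.n≤1+n b))))
    1≤c : 1ℚ ≤ + c / 1
    1≤c = /-mono-≤ (+ 1) (+ c) 1 1
      (subst₂ ℤ._≤_ refl (sym (ℤ.*-identityʳ (+ c))) (ℤ.+≤+ (ℕ.s≤s ℕ.z≤n)))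
    b-large : p < (+ suc b / d) ^ℚ t
    b-large = ℚ.<-≤-trans (<-numerator p)
      (ℚ.≤-trans (^-increasing t 1≤c) (^-mono t (/-nonNeg c 1) c/1≤))

  root-seq : (x : ℕ → ℚ) (t : ℕ) → ℕ → ℚ
  root-seq x t n = root-approx t (x n) (suc n)

  root-cauchy : ∀ x t .{{_ : NonZero t}} → Cauchy x → Cauchy (root-seq x t)
  root-cauchy x t cx ε 0<ε = N , λ m n N≤m N≤n → within (close m n N≤m N≤n) (close n m N≤n N≤m)
    where
    δ : ℚ
    δ = (½ * ε) ^ℚ t
    0<δ : 0ℚ < δ
    0<δ = ^-pos t (half-pos 0<ε)
    small : ∃[ M ] (∀ n .{{_ : NonZero n}} → M ℕ.≤ n → + 1 / n < ½ * ε)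
    small = archimedean (½ * ε) (half-pos 0<ε)
    near : ∃[ M ] (∀ m n → M ℕ.≤ m → M ℕ.≤ n → ∣ x m - x n ∣ < δ)
    near = cx δ 0<δ
    N₁ N₂ N : ℕ
    N₁ = proj₁ small
    N₂ = proj₁ near
    N  = N₁ ℕ.⊔ N₂
    r : ℕ → ℚ
    r = root-seq x t
    close : ∀ m n → N ℕ.≤ m → N ℕ.≤ n → r m < r n + ε
    close m n N≤m N≤n = ℚ.≰⇒> λ far →
      let
        reach : (r n + + 1 / suc n) + ½ * ε ≤ r m
        reach = ℚ.≤-trans
          (ℚ.≤-reflexive (ℚ.+-assoc (r n) (+ 1 / suc n) (½ * ε)))
          (ℚ.≤-trans
            (ℚ.+-monoʳ-≤ (r n) (subst (+ 1 / suc n + ½ * ε ≤_) (half+half ε)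
              (ℚ.+-monoˡ-≤ (½ * ε) (ℚ.<⇒≤ (proj₂ small (suc n)
                (ℕ.m≤n⇒m≤1+n (ℕ.m⊔n≤o⇒m≤o N₁ N₂ N≤n)))))))
            far)
        0≤r+ : 0ℚ ≤ r n + + 1 / suc n
        0≤r+ = ℚ.+-mono-≤ (root-approx-nonNeg t (x n) (suc n)) (/-nonNeg 1 (suc n))
        0≤½ε : 0ℚ ≤ ½ * ε
        0≤½ε = ℚ.<⇒≤ (half-pos 0<ε)
        above : (x n ⊔ 0ℚ) + δ < x m ⊔ 0ℚ
        above = ℚ.<-≤-trans (ℚ.+-monoˡ-< δ (root-approx-upper t (x n) (suc n)))
          (ℚ.≤-trans (^-superadditive t 0≤r+ 0≤½ε)
            (ℚ.≤-trans (^-mono t (ℚ.+-mono-≤ 0≤r+ 0≤½ε) reach)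
              (root-approx-lower t (x m) (suc m))))
        below : x m ⊔ 0ℚ ≤ (x n ⊔ 0ℚ) + δ
        below = ℚ.⊔-lub {(x n ⊔ 0ℚ) + δ} {x m} {0ℚ}
          (ℚ.<⇒≤ (ℚ.<-≤-trans {x m} {x n + δ}
            (∣p-q∣<r⇒p<q+r (proj₂ near m n (ℕ.m⊔n≤o⇒n≤o N₁ N₂ N≤m) (ℕ.m⊔n≤o⇒n≤o N₁ N₂ N≤n)))
            (ℚ.+-monoˡ-≤ δ (ℚ.p≤p⊔q (x n) 0ℚ))))
          (ℚ.+-mono-≤ (ℚ.p≤q⊔p (x n) 0ℚ) (ℚ.<⇒≤ 0<δ))
      in ℚ.<-irrefl refl (ℚ.<-≤-trans above below)

open RootLemmas

infixr 8 _^1/_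

-- Meaningful for x ≥ 0, where ^1/-^ᴿ and ^1/-nonNeg below characterise it;
-- negative terms of the sequence are truncated to 0.
_^1/_ : ℝ → (t : ℕ) → .{{_ : NonZero t}} → ℝ
x ^1/ t = mkℝ (λ n → root-approx t (seq x n) (suc n)) (root-cauchy (seq x) t (cauchy x))

module RealLemmas where
  *-cong : ∀ x x′ y y′ → x ≃ x′ → y ≃ y′ → x *ᴿ y ≃ x′ *ᴿ y′
  *-cong x x′ y y′ x≃x′ y≃y′ ε 0<ε =
    let K , 0<K , N₁ , bx = eventually-bounded (seq x) (cauchy x)
        L , 0<L , N₂ , by = eventually-bounded (seq y′) (cauchy y′)
        δ , 0<δ , eq = quotient (K + L) ε (ℚ.+-mono-< 0<K 0<L) 0<ε
        N₃ , hx = x≃x′ δ 0<δ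
        N₄ , hy = y≃y′ δ 0<δ
        M = N₁ ℕ.⊔ N₂
        M′ = N₃ ℕ.⊔ N₄
    in M ℕ.⊔ M′ , λ n N≤n →
      subst (∣ seq x n * seq y n - seq x′ n * seq y′ n ∣ <_) eq
        (*-close (seq x n) (seq y n) (seq x′ n) (seq y′ n) K L δ 0<K 0<L
          (bx n (ℕ.m⊔n≤o⇒m≤o N₁ N₂ (ℕ.m⊔n≤o⇒m≤o M M′ N≤n)))
          (by n (ℕ.m⊔n≤o⇒n≤o N₁ N₂ (ℕ.m⊔n≤o⇒m≤o M M′ N≤n)))
          (hx n (ℕ.m⊔n≤o⇒m≤o N₃ N₄ (ℕ.m⊔n≤o⇒n≤o M M′ N≤n)))
          (hy n (ℕ.m⊔n≤o⇒n≤o N₃ N₄ (ℕ.m⊔n≤o⇒n≤o M M′ N≤n))))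

  ^-cong : ∀ x y t → x ≃ y → x ^ᴿ t ≃ y ^ᴿ t
  ^-cong x y zero    x≃y ε 0<ε = 0 , λ _ _ → subst (_< ε) (sym (cong ∣_∣ (ℚ.+-inverseʳ 1ℚ))) 0<ε
  ^-cong x y (suc t) x≃y = *-cong x y (x ^ᴿ t) (y ^ᴿ t) x≃y (^-cong x y t x≃y)

  seq-^ : ∀ x t n → seq (x ^ᴿ t) n ≡ seq x n ^ℚ t
  seq-^ x zero    n = refl
  seq-^ x (suc t) n = cong (seq x n *_) (seq-^ x t n)

  infinitesimal : ∀ ε → 0ℚ < ε → ∃[ N ] (∀ n → N ℕ.≤ n → + 1 / suc n < ε)
  infinitesimal ε 0<ε =
    let N , h = archimedean ε 0<ε in N , λ n N≤n → h (suc n) (ℕ.m≤n⇒m≤1+n N≤n)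

  1/suc : ℝ
  1/suc = mkℝ (λ n → + 1 / suc n) λ ε 0<ε →
    let N , h = infinitesimal ε 0<ε
        close : ∀ m n → N ℕ.≤ m → + 1 / suc m < + 1 / suc n + ε
        close m n N≤m = ℚ.<-≤-trans (h m N≤m) (q≤p+q (/-nonNeg 1 (suc n)))
    in N , λ m n N≤m N≤n → within (close m n N≤m) (close n m N≤n)

open RealLemmas

^1/-nonNeg : ∀ x t .{{_ : NonZero t}} → 0ᴿ ≤ᴿ x ^1/ t
^1/-nonNeg x t ε 0<ε = 0 , λ n _ →
  ℚ.+-mono-≤-< (root-approx-nonNeg t (seq x n) (suc n)) 0<ε

^1/-^ᴿ : ∀ x t .{{_ : NonZero t}} → 0ᴿ ≤ᴿ x → (x ^1/ t) ^ᴿ t ≃ x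
^1/-^ᴿ x t 0≤x ε 0<ε = N₁ ℕ.⊔ N₂ , λ n N≤n →
  within (upper n (ℕ.m⊔n≤o⇒n≤o N₁ N₂ N≤n)) (lower n (ℕ.m⊔n≤o⇒m≤o N₁ N₂ N≤n))
  where
  r r′ : ℝ
  r  = x ^1/ t
  r′ = r +ᴿ 1/suc
  r′≃r : r′ ≃ r
  r′≃r δ 0<δ =
    let N , h = infinitesimal δ 0<δ
    in N , λ n N≤n → within (ℚ.+-monoʳ-< (seq r n) (h n N≤n))
         (ℚ.≤-<-trans (p≤p+q (/-nonNeg 1 (suc n)))
           (subst (_< seq r′ n + δ) (ℚ.+-identityʳ (seq r′ n)) (ℚ.+-monoʳ-< (seq r′ n) 0<δ)))
  powers : ∃[ N ] (∀ n → N ℕ.≤ n → ∣ seq (r′ ^ᴿ t) n - seq (r ^ᴿ t) n ∣ < ε)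
  powers = ^-cong r′ r t r′≃r ε 0<ε
  clamp : ∃[ N ] (∀ n → N ℕ.≤ n → 0ℚ < seq x n + ½ * ε)
  clamp = 0≤x (½ * ε) (half-pos 0<ε)
  N₁ N₂ : ℕ
  N₁ = proj₁ powers
  N₂ = proj₁ clamp
  upper : ∀ n → N₂ ℕ.≤ n → seq (r ^ᴿ t) n < seq x n + ε
  upper n N≤n = ℚ.≤-<-trans
    (subst (_≤ seq x n ⊔ 0ℚ) (sym (seq-^ r t n)) (root-approx-lower t (seq x n) (suc n)))
    (ℚ.≤-<-trans
      (ℚ.⊔-lub {seq x n + ½ * ε} {seq x n} {0ℚ}
        (p≤p+q (ℚ.<⇒≤ (half-pos 0<ε))) (ℚ.<⇒≤ (proj₂ clamp n N≤n)))
      (ℚ.+-monoʳ-< (seq x n) ½ε<ε))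
    where
    ½ε<ε : ½ * ε < ε
    ½ε<ε = subst₂ _<_ (ℚ.+-identityʳ (½ * ε)) (half+half ε)
      (ℚ.+-monoʳ-< (½ * ε) (half-pos 0<ε))
  lower : ∀ n → N₁ ℕ.≤ n → seq x n < seq (r ^ᴿ t) n + ε
  lower n N≤n = ℚ.≤-<-trans (ℚ.p≤p⊔q (seq x n) 0ℚ)
    (ℚ.<-trans
      (subst (seq x n ⊔ 0ℚ <_) (sym (seq-^ r′ t n)) (root-approx-upper t (seq x n) (suc n)))
      (∣p-q∣<r⇒p<q+r (proj₂ powers n N≤n)))

-- The n-set of vertices is Fin n. As customary in design theory, repeated
-- blocks are allowed and are counted with multiplicity.
record PartialSystem (n k t μ : ℕ) : Set where
  field
    blocks     : List (Subset n)
    block-size : All (λ B → Sub.∣ B ∣ ≡ k) blocks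
    t-covered  : ∀ (T : Subset n) → Sub.∣ T ∣ ≡ t → length (filter (T ⊆?_) blocks) ℕ.≤ μ

open PartialSystem public

Independent : ∀ {n k t μ} → PartialSystem n k t μ → Subset n → Set
Independent S Y = ∀ {B} → B List.∈ blocks S → ¬ (B ⊆ Y)

infixl 6 _⊕_

-- Addition in ℤ_n, represented by Fin n.
_⊕_ : ∀ {n} → Fin n → ℕ → Fin n
_⊕_ {n} i j = ((toℕ i ℕ.+ j) mod n) {{nonZeroIndex i}}

Sequencing : ℕ → Set
Sequencing n = Fin n ⤖ Fin n

CyclicallyConsecutive : ∀ {n} → Sequencing n → Subset n → Set
CyclicallyConsecutive φ S =
  ∃[ i ] (∀ x → x ∈ S ⇔ (∃[ j ] j ℕ.< Sub.∣ S ∣ × x ≡ Bijection.to φ (i ⊕ j)))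

CyclicallyGood : ∀ {n k t μ} → PartialSystem n k t μ → ℕ → Sequencing n → Set
CyclicallyGood S ℓ φ = ∀ Y → Sub.∣ Y ∣ ≡ ℓ → CyclicallyConsecutive φ Y → Independent S Y

{-# OPTIONS --safe #-}
module Submission where

-- Replace every block by t + 1 of its vertices, and write W = 2 ^ (t + 1) ∸ 1. Every vertex then lies
-- in at most μ n ^ (t ∸ 1) / t ! blocks. Colour the vertices with m colours arranged in a cycle, and
-- call a block bad if its colours lie in some pair of consecutive colours, which happens with
-- probability at most W / m ^ t. Rosenfeld's counting argument, a substitute for the Lovász local
-- lemma, gives a colouring without bad blocks as soon as
--   (t + 1) ^ (t + 1) μ n ^ (t ∸ 1) W ≤ t ! t ^ t m ^ t.
-- Take m minimal and list the colour classes one after the other. If each of them had at least ℓ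
-- elements, then ℓ cyclically consecutive vertices would meet at most two consecutive classes.
-- As long as some class has s < ℓ elements, move to it a vertex which is not among the first or last
-- ℓ vertices of its own class and which does not complete a block together with this class and the
-- nearest ℓ vertices of one of its neighbours. The t-subsets which are part of such a block lie in
-- one of two sets of at most ℓ + s vertices sharing s of them, so fewer than μ W ℓ ^ t / t ! ∸ s
-- vertices complete a block; and at least n ∸ 2 ℓ (m ∸ 1) ∸ s vertices are in the interior of their
-- class. Hence such a vertex exists if
--   t ! 2 ℓ (m ∸ 1) + μ W ℓ ^ t ≤ t ! n,
-- which follows from the equation for α multiplied by n, because (1 + 1 / t) ^ t ≤ e and m is minimal.

-- The constant 2 ^ (t + 1) ∸ 1 arises twice, for different reasons. In the colouring it counts the
-- patterns of two consecutive colours on t + 1 vertices, without the constant pattern that is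
-- charged to the neighbouring pair. In the repair it is the coefficient in 2 (2 ℓ) ^ t - ℓ ^ t,
-- where the deduction comes from the overlap of the two sets. Rosenfeld's argument keeps a fraction
-- r of the colourings per vertex and needs degree times bad probability to be at most r ^ t (1 -
-- r). The best choice is r = t / (t + 1), with value t ^ t / (t + 1) ^ (t + 1). Its inverse is (t +
-- 1) (1 + 1 / t) ^ t, which is how e enters. The obstacle is that a colour class may be so short
-- that a window meets three classes, while lengthening it may create blocks. Taking the new vertex
-- from the interior of its class leaves all end segments there unchanged, so only the two pairs of
-- neighbours at the short class have to be checked. The estimate needs ℓ > t; for ℓ ≤ t < k no
-- window can contain a block.

module Reals where

  open import Data.Integer as ℤ using (+_)
  import Data.Integer.Properties as ℤ
  open import Data.Nat as ℕ using (ℕ; zero; suc; _!; NonZero)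
  import Data.Nat.Properties as ℕ
  open import Data.Product using (∃-syntax; _×_; _,_; proj₁; proj₂)
  open import Data.Rational as ℚ using (ℚ; 0ℚ; 1ℚ; ½; _/_; _+_; _*_; _-_; -_; ∣_∣; _<_; _≤_)
  import Data.Rational.Properties as ℚ
  open import Data.Rational.Solver using (module +-*-Solver)
  import Data.Rational.Unnormalised as ℚᵘ
  import Data.Rational.Unnormalised.Properties as ℚᵘ
  open import Relation.Binary.PropositionalEquality
  open import Defs
  open RationalLemmas
  open CauchyLemmas
  open ExpLemmas
  open PowerLemmas
  open RootLemmas
  open RealLemmas

  -- Rational preliminaries

  ι : ℕ → ℚ
  ι n = + n / 1

  ι-cancel-≤ : ∀ {m n} → ι m ≤ ι n → m ℕ.≤ n
  ι-cancel-≤ {m} {n} le = ℤ.drop‿+≤+ (ℤ.*-cancelʳ-≤-pos (+ m) (+ n) (+ 1) (ℚᵘ.drop-*≤*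
    (ℚᵘ.≤-trans (ℚᵘ.≤-reflexive (ℚᵘ.≃-sym (toℚᵘ-/ (+ m) 1)))
      (ℚᵘ.≤-trans (ℚ.toℚᵘ-mono-≤ le) (ℚᵘ.≤-reflexive (toℚᵘ-/ (+ n) 1))))))

  ι-< : ∀ {m n} → m ℕ.< n → ι m < ι n
  ι-< lt = ℚ.≰⇒> λ le → ℕ.<⇒≱ lt (ι-cancel-≤ le)

  ι-nonNeg : ∀ n → 0ℚ ≤ ι n
  ι-nonNeg n = /-nonNeg n 1

  ι-+ : ∀ m n → ι (m ℕ.+ n) ≡ ι m + ι n
  ι-+ m n = sym (/-distrib-+ (+ m) (+ n) 1)

  /-*-/ : ∀ a b m n .{{_ : NonZero m}} .{{_ : NonZero n}} .{{_ : NonZero (m ℕ.* n)}} →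
          (+ a / m) * (+ b / n) ≡ + (a ℕ.* b) / (m ℕ.* n)
  /-*-/ a b m@(suc _) n@(suc _) = ℚ.toℚᵘ-injective
    (ℚᵘ.≃-trans (ℚ.toℚᵘ-homo-* (+ a / m) (+ b / n))
    (ℚᵘ.≃-trans (ℚᵘ.*-cong (toℚᵘ-/ (+ a) m) (toℚᵘ-/ (+ b) n))
    (ℚᵘ.≃-trans (ℚᵘ.*≡* (cong (ℤ._* + (m ℕ.* n)) (sym (ℤ.pos-* a b))))
      (ℚᵘ.≃-sym (toℚᵘ-/ (+ (a ℕ.* b)) (m ℕ.* n))))))

  ι-* : ∀ m n → ι (m ℕ.* n) ≡ ι m * ι n
  ι-* m n = sym (/-*-/ m n 1 1)

  ι-^ : ∀ m k → ι (m ℕ.^ k) ≡ ι m ^ℚ k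
  ι-^ m zero    = refl
  ι-^ m (suc k) = trans (ι-* m (m ℕ.^ k)) (cong (ι m *_) (ι-^ m k))

  /-*-ι : ∀ a d .{{_ : NonZero d}} → (+ a / d) * ι d ≡ ι a
  /-*-ι a d@(suc _) = trans (/-*-/ a d d 1 {{_}} {{_}} {{nz}}) (ℚ.toℚᵘ-injective
    (ℚᵘ.≃-trans (toℚᵘ-/ (+ (a ℕ.* d)) (d ℕ.* 1) {{nz}})
    (ℚᵘ.≃-trans (ℚᵘ-eq (d ℕ.* 1) {{nz}} (ℕ.*-identityʳ d)) (ℚᵘ.≃-sym (toℚᵘ-/ (+ a) 1)))))
    where
    nz : NonZero (d ℕ.* 1)
    nz = ℕ.m*n≢0 d 1
    ℚᵘ-eq : ∀ k .{{_ : NonZero k}} → k ≡ d → (+ (a ℕ.* d) ℚᵘ./ k) ℚᵘ.≃ (+ a ℚᵘ./ 1)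
    ℚᵘ-eq k refl = ℚᵘ.*≡* (trans (ℤ.*-identityʳ (+ (a ℕ.* d))) (ℤ.pos-* a d))

  *-nonNeg : ∀ {p q} → 0ℚ ≤ p → 0ℚ ≤ q → 0ℚ ≤ p * q
  *-nonNeg {p} {q} 0≤p 0≤q = subst (_≤ p * q) (ℚ.*-zeroʳ p) (*-monoˡ 0≤p 0≤q)

  1^ℚ : ∀ k → 1ℚ ^ℚ k ≡ 1ℚ
  1^ℚ zero    = refl
  1^ℚ (suc k) = trans (ℚ.*-identityˡ (1ℚ ^ℚ k)) (1^ℚ k)

  module _ where
    open +-*-Solver

    ^ℚ-distrib-* : ∀ x y k → (x * y) ^ℚ k ≡ x ^ℚ k * y ^ℚ k
    ^ℚ-distrib-* x y zero    = refl
    ^ℚ-distrib-* x y (suc k) = trans (cong (x * y *_) (^ℚ-distrib-* x y k))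
      (solve 4 (λ a b c d → a :* b :* (c :* d) := a :* c :* (b :* d)) refl x y (x ^ℚ k) (y ^ℚ k))

    ^ℚ-swap : ∀ x j k → (x ^ℚ j) ^ℚ k ≡ (x ^ℚ k) ^ℚ j
    ^ℚ-swap x zero    k = 1^ℚ k
    ^ℚ-swap x (suc j) k = trans (^ℚ-distrib-* x (x ^ℚ j) k) (cong (x ^ℚ k *_) (^ℚ-swap x j k))

  open ℚ.≤-Reasoning

  -- (1 + 1 / t) ^ t ≤ e

  -- These are the first two terms of the binomial expansion. The induction step discards only the
  -- term in h².
  bernoulliℚ : ∀ {x h} N → 0ℚ ≤ x → 0ℚ ≤ h → x ^ℚ suc N + ι (suc N) * (h * x ^ℚ N) ≤ (x + h) ^ℚ suc N
  bernoulliℚ {x} {h} zero 0≤x 0≤h = ℚ.≤-reflexive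
    (solve 2 (λ x h → x :* con 1ℚ :+ con 1ℚ :* (h :* con 1ℚ) := (x :+ h) :* con 1ℚ) refl x h)
    where open +-*-Solver
  bernoulliℚ {x} {h} (suc N) 0≤x 0≤h = begin
    x * (x * y) + ι (2 ℕ.+ N) * (h * (x * y))     ≡⟨ cong (λ z → x * (x * y) + z * (h * (x * y))) (ι-+ 1 (suc N)) ⟩
    x * (x * y) + (1ℚ + c) * (h * (x * y))        ≤⟨ p≤p+q (*-nonNeg 0≤h (*-nonNeg (ι-nonNeg (suc N)) (*-nonNeg 0≤h (^-nonNeg N 0≤x)))) ⟩
    x * (x * y) + (1ℚ + c) * (h * (x * y)) + h * (c * (h * y))
      ≡⟨ solve 4 (λ x h y c → x :* (x :* y) :+ (con 1ℚ :+ c) :* (h :* (x :* y)) :+ h :* (c :* (h :* y))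
           := (x :+ h) :* (x :* y :+ c :* (h :* y))) refl x h y c ⟩
    (x + h) * (x * y + c * (h * y))               ≤⟨ *-monoˡ (ℚ.+-mono-≤ 0≤x 0≤h) (bernoulliℚ N 0≤x 0≤h) ⟩
    (x + h) * (x + h) ^ℚ suc N                    ∎
    where
    open +-*-Solver
    y c : ℚ
    y = x ^ℚ N
    c = ι (suc N)

  -- The first N terms of the exponential series at x. A variable argument is needed because the
  -- induction for (1 + h) ^ j passes through all the points j h.
  exp-sum-at : ℚ → ℕ → ℚ
  exp-sum-at x zero    = 0ℚ
  exp-sum-at x (suc N) = exp-sum-at x N + x ^ℚ N * 1/! N

  exp-sum-at-1 : ∀ N → exp-sum-at 1ℚ N ≡ exp-sum N
  exp-sum-at-1 zero    = refl
  exp-sum-at-1 (suc N) = cong₂ _+_ (exp-sum-at-1 N) (trans (cong (_* 1/! N) (1^ℚ N)) (ℚ.*-identityˡ (1/! N)))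

  1/!-suc : ∀ N → 1/! N ≡ ι (suc N) * 1/! (suc N)
  1/!-suc N = sym (trans (/-*-/ (suc N) 1 1 (suc N !) {{_}} {{suc N ℕ.!≢0}} {{nz₁}})
    (ℚ.toℚᵘ-injective (ℚᵘ.≃-trans (toℚᵘ-/ (+ (suc N ℕ.* 1)) (1 ℕ.* suc N !) {{nz₁}})
      (ℚᵘ.≃-trans (eq (1 ℕ.* suc N !) (N !) {{nz₁}} {{N ℕ.!≢0}} (trans (ℕ.*-identityˡ _) (ℕ.*-comm (suc N) (N !)))) (ℚᵘ.≃-sym (toℚᵘ-/ (+ 1) (N !) {{N ℕ.!≢0}}))))))
    where
    nz₁ : NonZero (1 ℕ.* suc N !)
    nz₁ = ℕ.m*n≢0 1 (suc N !) {{_}} {{suc N ℕ.!≢0}}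
    eq : ∀ a b .{{_ : NonZero a}} .{{_ : NonZero b}} → a ≡ b ℕ.* suc N → (+ (suc N ℕ.* 1) ℚᵘ./ a) ℚᵘ.≃ (+ 1 ℚᵘ./ b)
    eq a@(suc _) b@(suc _) e = ℚᵘ.*≡* (trans (sym (ℤ.pos-* (suc N ℕ.* 1) b))
      (trans (cong +_ (trans (cong (ℕ._* b) (ℕ.*-identityʳ (suc N))) (trans (ℕ.*-comm (suc N) b) (sym e)))) (sym (ℤ.*-identityˡ (+ a)))))

  -- A tangent-line bound: the derivative of the sum of N + 1 terms is the sum of N terms. It
  -- follows term by term from `bernoulliℚ`.
  exp-sum-at-+ : ∀ {x h} N → 0ℚ ≤ x → 0ℚ ≤ h →
    exp-sum-at x (suc N) + h * exp-sum-at x N ≤ exp-sum-at (x + h) (suc N)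
  exp-sum-at-+ {x} {h} zero    0≤x 0≤h = ℚ.≤-reflexive (trans (cong (λ z → exp-sum-at x 1 + z) (ℚ.*-zeroʳ h)) (ℚ.+-identityʳ (exp-sum-at x 1)))
  exp-sum-at-+ {x} {h} (suc N) 0≤x 0≤h = begin
    (s₁ + x ^ℚ suc N * f) + h * (s₀ + x ^ℚ N * 1/! N)
      ≡⟨ cong (λ z → (s₁ + x ^ℚ suc N * f) + h * (s₀ + x ^ℚ N * z)) (1/!-suc N) ⟩
    (s₁ + x ^ℚ suc N * f) + h * (s₀ + x ^ℚ N * (ι (suc N) * f))
      ≡⟨ solve 7 (λ s₁ s₀ f h y z c → (s₁ :+ z :* f) :+ h :* (s₀ :+ y :* (c :* f))
           := (s₁ :+ h :* s₀) :+ (z :+ c :* (h :* y)) :* f) refl s₁ s₀ f h (x ^ℚ N) (x ^ℚ suc N) (ι (suc N)) ⟩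
    (s₁ + h * s₀) + (x ^ℚ suc N + ι (suc N) * (h * x ^ℚ N)) * f
      ≤⟨ ℚ.+-mono-≤ (exp-sum-at-+ N 0≤x 0≤h) (*-monoʳ (1/!-nonNeg (suc N)) (bernoulliℚ N 0≤x 0≤h)) ⟩
    exp-sum-at (x + h) (suc N) + (x + h) ^ℚ suc N * f ∎
    where
    open +-*-Solver
    s₁ s₀ f : ℚ
    s₁ = exp-sum-at x (suc N)
    s₀ = exp-sum-at x N
    f  = 1/! (suc N)

  -- Multiplication by 1 + h moves the argument from j h to (j + 1) h by the tangent-line bound.
  1+h^≤exp-sum-at : ∀ {h} j → 0ℚ ≤ h → (1ℚ + h) ^ℚ j ≤ exp-sum-at (ι j * h) (suc j)
  1+h^≤exp-sum-at {h} zero    0≤h = ℚ.≤-refl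
  1+h^≤exp-sum-at {h} (suc j) 0≤h = begin
    (1ℚ + h) * (1ℚ + h) ^ℚ j
      ≤⟨ *-monoˡ (ℚ.+-mono-≤ (ι-nonNeg 1) 0≤h) (1+h^≤exp-sum-at j 0≤h) ⟩
    (1ℚ + h) * s                       ≡⟨ solve 2 (λ h s → (con 1ℚ :+ h) :* s := s :+ h :* s) refl h s ⟩
    s + h * s
      -- Only the first copy of `s` receives the term of degree j + 1; the copy multiplied by h must
      -- stay one term shorter.
      ≤⟨ ℚ.+-monoˡ-≤ (h * s) (p≤p+q {s} (*-nonNeg (^-nonNeg (suc j) 0≤x) (1/!-nonNeg (suc j)))) ⟩
    exp-sum-at x (2 ℕ.+ j) + h * s     ≤⟨ exp-sum-at-+ (suc j) 0≤x 0≤h ⟩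
    exp-sum-at (x + h) (2 ℕ.+ j)
      ≡⟨ cong (λ z → exp-sum-at z (2 ℕ.+ j)) (trans (solve 2 (λ c h → c :* h :+ h := (con 1ℚ :+ c) :* h) refl (ι j) h) (cong (_* h) (sym (ι-+ 1 j)))) ⟩
    exp-sum-at (ι (suc j) * h) (2 ℕ.+ j) ∎
    where
    open +-*-Solver
    x s : ℚ
    x = ι j * h
    s = exp-sum-at x (suc j)
    0≤x : 0ℚ ≤ x
    0≤x = *-nonNeg (ι-nonNeg j) 0≤h

  -- Stated for a partial sum and not for `e`, so that it bounds `seq e i` for every i > t.
  compound≤exp-sum : ∀ t .{{_ : NonZero t}} → (1ℚ + + 1 / t) ^ℚ t ≤ exp-sum (suc t)
  compound≤exp-sum t = subst ((1ℚ + + 1 / t) ^ℚ t ≤_)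
    (trans (cong (λ z → exp-sum-at z (suc t)) (trans (ℚ.*-comm (ι t) (+ 1 / t)) (/-*-ι 1 t))) (exp-sum-at-1 (suc t)))
    (1+h^≤exp-sum-at t (/-nonNeg 1 t))

  -- Inequalities between Cauchy reals

  -- Stronger than `0ᴿ ≤ᴿ x`, which admits negative terms tending to 0. Inequalities are multiplied
  -- term by term below, and `0ᴿ <ᴿ α` does give this form for α.
  EventuallyNonNeg : ℝ → Set
  EventuallyNonNeg x = ∃[ N ] (∀ n → N ℕ.≤ n → 0ℚ ≤ seq x n)

  pointwise⇒≤ᴿ : ∀ x y → ∃[ N ] (∀ n → N ℕ.≤ n → seq x n ≤ seq y n) → x ≤ᴿ y
  pointwise⇒≤ᴿ x y (N , h) ε 0<ε = N , λ n N≤n → begin-strict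
    seq x n       ≤⟨ h n N≤n ⟩
    seq y n       ≡⟨ ℚ.+-identityʳ (seq y n) ⟨
    seq y n + 0ℚ  <⟨ ℚ.+-monoʳ-< (seq y n) 0<ε ⟩
    seq y n + ε   ∎

  ≤ᴿ-trans : ∀ x y z → x ≤ᴿ y → y ≤ᴿ z → x ≤ᴿ z
  ≤ᴿ-trans x y z x≤y y≤z ε 0<ε =
    let N₁ , h₁ = x≤y (½ * ε) (half-pos 0<ε)
        N₂ , h₂ = y≤z (½ * ε) (half-pos 0<ε)
    in N₁ ℕ.⊔ N₂ , λ n N≤n → begin-strict
      seq x n                      <⟨ h₁ n (ℕ.m⊔n≤o⇒m≤o N₁ N₂ N≤n) ⟩
      seq y n + ½ * ε              <⟨ ℚ.+-monoˡ-< (½ * ε) (h₂ n (ℕ.m⊔n≤o⇒n≤o N₁ N₂ N≤n)) ⟩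
      seq z n + ½ * ε + ½ * ε      ≡⟨ trans (ℚ.+-assoc (seq z n) _ _) (cong (λ δ → seq z n + δ) (half+half ε)) ⟩
      seq z n + ε                  ∎

  ≃⇒≤ᴿ : ∀ x y → x ≃ y → x ≤ᴿ y
  ≃⇒≤ᴿ x y x≃y ε 0<ε = let N , h = x≃y ε 0<ε in N , λ n N≤n → ∣p-q∣<r⇒p<q+r (h n N≤n)

  ≃-sym : ∀ x y → x ≃ y → y ≃ x
  ≃-sym x y x≃y ε 0<ε = let N , h = x≃y ε 0<ε in N , λ n N≤n →
    subst (_< ε) (trans (sym (ℚ.∣-p∣≡∣p∣ (seq x n - seq y n))) (cong ∣_∣ (neg-sub (seq x n) (seq y n)))) (h n N≤n)

  +ᴿ-mono : ∀ x x′ y y′ → x ≤ᴿ x′ → y ≤ᴿ y′ → x +ᴿ y ≤ᴿ x′ +ᴿ y′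
  +ᴿ-mono x x′ y y′ x≤ y≤ ε 0<ε =
    let N₁ , h₁ = x≤ (½ * ε) (half-pos 0<ε)
        N₂ , h₂ = y≤ (½ * ε) (half-pos 0<ε)
    in N₁ ℕ.⊔ N₂ , λ n N≤n → begin-strict
      seq x n + seq y n                          <⟨ ℚ.+-mono-< (h₁ n (ℕ.m⊔n≤o⇒m≤o N₁ N₂ N≤n)) (h₂ n (ℕ.m⊔n≤o⇒n≤o N₁ N₂ N≤n)) ⟩
      (seq x′ n + ½ * ε) + (seq y′ n + ½ * ε)
        ≡⟨ solve 3 (λ a b d → (a :+ d) :+ (b :+ d) := (a :+ b) :+ (d :+ d)) refl (seq x′ n) (seq y′ n) (½ * ε) ⟩
      (seq x′ n + seq y′ n) + (½ * ε + ½ * ε)    ≡⟨ cong (λ δ → seq x′ n + seq y′ n + δ) (half+half ε) ⟩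
      seq x′ n + seq y′ n + ε                    ∎
    where open +-*-Solver

  *ᴿ-monoʳ : ∀ x y z → EventuallyNonNeg z → x ≤ᴿ y → x *ᴿ z ≤ᴿ y *ᴿ z
  *ᴿ-monoʳ x y z (N₁ , 0≤z) x≤y ε 0<ε =
    let K , 0<K , N₂ , bz = eventually-bounded (seq z) (cauchy z)
        δ , 0<δ , Kδ≡ε = quotient K ε 0<K 0<ε
        -- Strictness is lost on multiplying by a term of z, which may be 0. Half of δ restores it
        -- at the end through ½ ε < ε.
        N₃ , h = x≤y (½ * δ) (half-pos 0<δ)
        M = N₁ ℕ.⊔ N₂
        ½Kδ≡ : K * (½ * δ) ≡ ½ * ε
        ½Kδ≡ = trans (solve 2 (λ k d → k :* (con ½ :* d) := con ½ :* (k :* d)) refl K δ) (cong (½ *_) Kδ≡ε)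
        ½ε<ε : ½ * ε < ε
        ½ε<ε = subst₂ _<_ (ℚ.+-identityʳ (½ * ε)) (half+half ε) (ℚ.+-monoʳ-< (½ * ε) (half-pos 0<ε))
    in M ℕ.⊔ N₃ , λ n N≤n →
      let 0≤zn = 0≤z n (ℕ.m⊔n≤o⇒m≤o N₁ N₂ (ℕ.m⊔n≤o⇒m≤o M N₃ N≤n))
          zn≤K = ℚ.≤-trans (p≤∣p∣ (seq z n)) (ℚ.<⇒≤ (bz n (ℕ.m⊔n≤o⇒n≤o N₁ N₂ (ℕ.m⊔n≤o⇒m≤o M N₃ N≤n))))
      in begin-strict
      seq x n * seq z n                        ≤⟨ *-monoʳ 0≤zn (ℚ.<⇒≤ (h n (ℕ.m⊔n≤o⇒n≤o M N₃ N≤n))) ⟩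
      (seq y n + ½ * δ) * seq z n              ≡⟨ solve 3 (λ y d z → (y :+ d) :* z := y :* z :+ z :* d) refl (seq y n) (½ * δ) (seq z n) ⟩
      seq y n * seq z n + seq z n * (½ * δ)    ≤⟨ ℚ.+-monoʳ-≤ (seq y n * seq z n) (*-monoʳ (ℚ.<⇒≤ (half-pos 0<δ)) zn≤K) ⟩
      seq y n * seq z n + K * (½ * δ)          ≡⟨ cong (λ z′ → seq y n * seq z n + z′) ½Kδ≡ ⟩
      seq y n * seq z n + ½ * ε                <⟨ ℚ.+-monoʳ-< (seq y n * seq z n) ½ε<ε ⟩
      seq y n * seq z n + ε                    ∎
    where open +-*-Solver

  *ᴿ-monoˡ : ∀ x y z → EventuallyNonNeg z → x ≤ᴿ y → z *ᴿ x ≤ᴿ z *ᴿ y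
  *ᴿ-monoˡ x y z 0≤z x≤y ε 0<ε = let N , h = *ᴿ-monoʳ x y z 0≤z x≤y ε 0<ε in N , λ n N≤n →
    subst₂ _<_ (ℚ.*-comm (seq x n) (seq z n)) (cong (λ p → p + ε) (ℚ.*-comm (seq y n) (seq z n))) (h n N≤n)

  *ᴿ-nonNeg : ∀ x y → EventuallyNonNeg x → EventuallyNonNeg y → EventuallyNonNeg (x *ᴿ y)
  *ᴿ-nonNeg x y (N₁ , h₁) (N₂ , h₂) = N₁ ℕ.⊔ N₂ , λ n N≤n →
    *-nonNeg (h₁ n (ℕ.m⊔n≤o⇒m≤o N₁ N₂ N≤n)) (h₂ n (ℕ.m⊔n≤o⇒n≤o N₁ N₂ N≤n))

  ^ᴿ-nonNeg : ∀ x k → EventuallyNonNeg x → EventuallyNonNeg (x ^ᴿ k)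
  ^ᴿ-nonNeg x zero    h = 0 , λ _ _ → ι-nonNeg 1
  ^ᴿ-nonNeg x (suc k) h = *ᴿ-nonNeg x (x ^ᴿ k) h (^ᴿ-nonNeg x k h)

  ^ᴿ-mono : ∀ x y k → EventuallyNonNeg x → EventuallyNonNeg y → x ≤ᴿ y → x ^ᴿ k ≤ᴿ y ^ᴿ k
  ^ᴿ-mono x y zero    0≤x 0≤y x≤y = pointwise⇒≤ᴿ 1ᴿ 1ᴿ (0 , λ _ _ → ℚ.≤-refl)
  ^ᴿ-mono x y (suc k) 0≤x 0≤y x≤y = ≤ᴿ-trans (x *ᴿ x ^ᴿ k) (y *ᴿ x ^ᴿ k) (y *ᴿ y ^ᴿ k)
    (*ᴿ-monoʳ x y (x ^ᴿ k) (^ᴿ-nonNeg x k 0≤x) x≤y)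
    (*ᴿ-monoˡ (x ^ᴿ k) (y ^ᴿ k) y 0≤y (^ᴿ-mono x y k 0≤x 0≤y x≤y))

  fromℚ-cancel-≤ : ∀ p q → fromℚ p ≤ᴿ fromℚ q → p ≤ q
  fromℚ-cancel-≤ p q h = ℚ.≮⇒≥ λ q<p →
    let N , lt = h (p - q) (subst (_< p - q) (ℚ.+-inverseʳ q) (ℚ.+-monoˡ-< (- q) q<p))
    in ℚ.<-irrefl (split p q) (lt N ℕ.≤-refl)

  -- With ρ = n ^ (1 / t) and 2 C α the linear term of the equation, M ≤ C ρ ^ (t ∸ 1) and so
  -- D ℓ ^ t + 2 ℓ M ≤ (D α ^ t + 2 C α) ρ ^ t = n.
  module Estimate {j n ℓ M : ℕ} (D B : ℚ) (α C ρ K : ℝ) (0≤D : 0ℚ ≤ D)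
    (0≤α : EventuallyNonNeg α) (0≤C : ∀ i → 0ℚ ≤ seq C i) (0≤ρ : ∀ i → 0ℚ ≤ seq ρ i)
    (C^t≃K : C ^ᴿ suc j ≃ K) (ρ^t≃n : ρ ^ᴿ suc j ≃ fromℕ n)
    (B≤K : ∃[ N ] (∀ i → N ℕ.≤ i → B ≤ seq K i)) (M^t< : ι M ^ℚ suc j < B * ι n ^ℚ j) where

    private
      t : ℕ
      t = suc j

    C^t*ρ^tj : C ^ᴿ t *ᴿ (ρ ^ᴿ t) ^ᴿ j ≃ K *ᴿ fromℕ n ^ᴿ j
    C^t*ρ^tj = *-cong (C ^ᴿ t) K ((ρ ^ᴿ t) ^ᴿ j) (fromℕ n ^ᴿ j) C^t≃K (^-cong (ρ ^ᴿ t) (fromℕ n) j ρ^t≃n)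

    -- The strict inequality M ^ t < B n ^ j leaves a rational gap δ, so the t-th powers of the
    -- terms of C ρ ^ j eventually exceed M ^ t. Roots are then compared term by term, by
    -- monotonicity of rational powers.
    M≤Cρ^j : fromℕ M ≤ᴿ C *ᴿ ρ ^ᴿ j
    M≤Cρ^j = pointwise⇒≤ᴿ (fromℕ M) (C *ᴿ ρ ^ᴿ j) (N , eventually)
      where
      δ : ℚ
      δ = B * ι n ^ℚ j - ι M ^ℚ t
      0<δ : 0ℚ < δ
      0<δ = subst (_< δ) (ℚ.+-inverseʳ (ι M ^ℚ t)) (ℚ.+-monoˡ-< (- (ι M ^ℚ t)) M^t<)
      close : ∃[ N ] (∀ i → N ℕ.≤ i → ∣ seq (K *ᴿ fromℕ n ^ᴿ j) i - seq (C ^ᴿ t *ᴿ (ρ ^ᴿ t) ^ᴿ j) i ∣ < δ)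
      close = ≃-sym (C ^ᴿ t *ᴿ (ρ ^ᴿ t) ^ᴿ j) (K *ᴿ fromℕ n ^ᴿ j) C^t*ρ^tj δ 0<δ
      N₁ N₂ N : ℕ
      N₁ = proj₁ close
      N₂ = proj₁ B≤K
      N  = N₁ ℕ.⊔ N₂
      module _ (i : ℕ) (N≤i : N ℕ.≤ i) where
        c r : ℚ
        c = seq C i
        r = seq ρ i
        product : seq (C ^ᴿ t *ᴿ (ρ ^ᴿ t) ^ᴿ j) i ≡ (c * r ^ℚ j) ^ℚ t
        product = trans (cong₂ _*_ (seq-^ C t i)
          (trans (seq-^ (ρ ^ᴿ t) j i) (trans (cong (_^ℚ j) (seq-^ ρ t i)) (^ℚ-swap r t j))))
          (sym (^ℚ-distrib-* c (r ^ℚ j) t))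
        B≤ : B * ι n ^ℚ j ≤ seq (K *ᴿ fromℕ n ^ᴿ j) i
        B≤ = subst (λ p → B * ι n ^ℚ j ≤ seq K i * p) (sym (seq-^ (fromℕ n) j i))
          (*-monoʳ (^-nonNeg j (ι-nonNeg n)) (proj₂ B≤K i (ℕ.m⊔n≤o⇒n≤o N₁ N₂ N≤i)))
        M^t<′ : ι M ^ℚ t < (c * r ^ℚ j) ^ℚ t
        M^t<′ = ℚ.≰⇒> λ ge → ℚ.<-irrefl refl (begin-strict
          B * ι n ^ℚ j                                ≤⟨ B≤ ⟩
          seq (K *ᴿ fromℕ n ^ᴿ j) i                   <⟨ ∣p-q∣<r⇒p<q+r (proj₂ close i (ℕ.m⊔n≤o⇒m≤o N₁ N₂ N≤i)) ⟩
          seq (C ^ᴿ t *ᴿ (ρ ^ᴿ t) ^ᴿ j) i + δ         ≡⟨ cong (_+ δ) product ⟩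
          (c * r ^ℚ j) ^ℚ t + δ                       ≤⟨ ℚ.+-monoˡ-≤ δ ge ⟩
          ι M ^ℚ t + δ                                ≡⟨ split (B * ι n ^ℚ j) (ι M ^ℚ t) ⟨
          B * ι n ^ℚ j                                ∎)
        eventually : ι M ≤ c * seq (ρ ^ᴿ j) i
        eventually = subst (λ p → ι M ≤ c * p) (sym (seq-^ ρ j i))
          (ℚ.≮⇒≥ λ lt → ℚ.<-irrefl refl (ℚ.<-≤-trans M^t<′
            (^-mono t (*-nonNeg (0≤C i) (^-nonNeg j (0≤ρ i))) (ℚ.<⇒≤ lt))))

    module _ (equation : fromℚ D *ᴿ α ^ᴿ t +ᴿ fromℕ 2 *ᴿ C *ᴿ α ≃ 1ᴿ) (ℓ≤αρ : fromℕ ℓ ≤ᴿ α *ᴿ ρ) where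

      β X Y Z : ℝ
      β = α *ᴿ ρ
      X = fromℚ D *ᴿ fromℕ ℓ ^ᴿ t +ᴿ (fromℕ 2 *ᴿ fromℕ ℓ) *ᴿ fromℕ M
      Y = fromℚ D *ᴿ β ^ᴿ t +ᴿ (fromℕ 2 *ᴿ β) *ᴿ (C *ᴿ ρ ^ᴿ j)
      Z = (fromℚ D *ᴿ α ^ᴿ t +ᴿ fromℕ 2 *ᴿ C *ᴿ α) *ᴿ ρ ^ᴿ t

      0≤β : EventuallyNonNeg β
      0≤β = *ᴿ-nonNeg α ρ 0≤α (0 , λ i _ → 0≤ρ i)

      0≤ι : ∀ m → EventuallyNonNeg (fromℕ m)
      0≤ι m = 0 , λ _ _ → ι-nonNeg m

      X≤Y : X ≤ᴿ Y
      X≤Y = +ᴿ-mono (fromℚ D *ᴿ fromℕ ℓ ^ᴿ t) (fromℚ D *ᴿ β ^ᴿ t) ((fromℕ 2 *ᴿ fromℕ ℓ) *ᴿ fromℕ M) ((fromℕ 2 *ᴿ β) *ᴿ (C *ᴿ ρ ^ᴿ j))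
        (*ᴿ-monoˡ (fromℕ ℓ ^ᴿ t) (β ^ᴿ t) (fromℚ D) (0 , λ _ _ → 0≤D)
          (^ᴿ-mono (fromℕ ℓ) β t (0≤ι ℓ) 0≤β ℓ≤αρ))
        (≤ᴿ-trans ((fromℕ 2 *ᴿ fromℕ ℓ) *ᴿ fromℕ M) ((fromℕ 2 *ᴿ β) *ᴿ fromℕ M) ((fromℕ 2 *ᴿ β) *ᴿ (C *ᴿ ρ ^ᴿ j))
          (*ᴿ-monoʳ (fromℕ 2 *ᴿ fromℕ ℓ) (fromℕ 2 *ᴿ β) (fromℕ M) (0≤ι M) (*ᴿ-monoˡ (fromℕ ℓ) β (fromℕ 2) (0≤ι 2) ℓ≤αρ))
          (*ᴿ-monoˡ (fromℕ M) (C *ᴿ ρ ^ᴿ j) (fromℕ 2 *ᴿ β) (*ᴿ-nonNeg (fromℕ 2) β (0≤ι 2) 0≤β) M≤Cρ^j))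

      Y≤Z : Y ≤ᴿ Z
      Y≤Z = pointwise⇒≤ᴿ Y Z (0 , λ i _ → ℚ.≤-reflexive (trans
        (cong₂ (λ p q → D * p + ι 2 * (seq α i * seq ρ i) * (seq C i * q)) (trans (seq-^ β t i) (^ℚ-distrib-* (seq α i) (seq ρ i) t)) (seq-^ ρ j i))
        (trans (regroup D (seq α i ^ℚ t) (seq ρ i) (seq ρ i ^ℚ j) (ι 2) (seq C i) (seq α i))
          (sym (cong₂ (λ p q → (D * p + ι 2 * seq C i * seq α i) * q) (seq-^ α t i) (seq-^ ρ t i))))))
        where
        open +-*-Solver
        regroup : ∀ d x r s w c y → d * (x * (r * s)) + w * (y * r) * (c * s) ≡ (d * x + w * c * y) * (r * s)
        regroup = solve 7 (λ d x r s w c y → d :* (x :* (r :* s)) :+ w :* (y :* r) :* (c :* s) := (d :* x :+ w :* c :* y) :* (r :* s)) refl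

      Z≤n : Z ≤ᴿ fromℕ n
      Z≤n = ≤ᴿ-trans Z (1ᴿ *ᴿ ρ ^ᴿ t) (fromℕ n)
        (*ᴿ-monoʳ (fromℚ D *ᴿ α ^ᴿ t +ᴿ fromℕ 2 *ᴿ C *ᴿ α) 1ᴿ (ρ ^ᴿ t) (^ᴿ-nonNeg ρ t (0 , λ i _ → 0≤ρ i))
          (≃⇒≤ᴿ (fromℚ D *ᴿ α ^ᴿ t +ᴿ fromℕ 2 *ᴿ C *ᴿ α) 1ᴿ equation))
        (≤ᴿ-trans (1ᴿ *ᴿ ρ ^ᴿ t) (ρ ^ᴿ t) (fromℕ n)
          (pointwise⇒≤ᴿ (1ᴿ *ᴿ ρ ^ᴿ t) (ρ ^ᴿ t) (0 , λ i _ → ℚ.≤-reflexive (ℚ.*-identityˡ (seq (ρ ^ᴿ t) i))))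
          (≃⇒≤ᴿ (ρ ^ᴿ t) (fromℕ n) ρ^t≃n))

      estimateℚ : D * ι ℓ ^ℚ t + ι 2 * ι ℓ * ι M ≤ ι n
      estimateℚ = fromℚ-cancel-≤ (D * ι ℓ ^ℚ t + ι 2 * ι ℓ * ι M) (ι n)
        (≤ᴿ-trans (fromℚ (D * ι ℓ ^ℚ t + ι 2 * ι ℓ * ι M)) X (fromℕ n)
          (pointwise⇒≤ᴿ (fromℚ (D * ι ℓ ^ℚ t + ι 2 * ι ℓ * ι M)) X (0 , λ i _ → ℚ.≤-reflexive
            (cong (λ p → D * p + ι 2 * ι ℓ * ι M) (sym (seq-^ (fromℕ ℓ) t i)))))
          (≤ᴿ-trans X Y (fromℕ n) X≤Y (≤ᴿ-trans Y Z (fromℕ n) Y≤Z Z≤n)))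

  compound*ι : ∀ t .{{_ : NonZero t}} → (1ℚ + + 1 / t) ^ℚ t * ι (t ℕ.^ t) ≡ ι (suc t ℕ.^ t)
  compound*ι t = begin-equality
    (1ℚ + + 1 / t) ^ℚ t * ι (t ℕ.^ t)    ≡⟨ cong ((1ℚ + + 1 / t) ^ℚ t *_) (ι-^ t t) ⟩
    (1ℚ + + 1 / t) ^ℚ t * ι t ^ℚ t       ≡⟨ ^ℚ-distrib-* (1ℚ + + 1 / t) (ι t) t ⟨
    ((1ℚ + + 1 / t) * ι t) ^ℚ t          ≡⟨ cong (_^ℚ t) (ℚ.*-distribʳ-+ (ι t) 1ℚ (+ 1 / t)) ⟩
    (1ℚ * ι t + + 1 / t * ι t) ^ℚ t      ≡⟨ cong (_^ℚ t) (cong₂ _+_ (ℚ.*-identityˡ (ι t)) (/-*-ι 1 t)) ⟩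
    (ι t + 1ℚ) ^ℚ t                      ≡⟨ cong (_^ℚ t) (trans (ℚ.+-comm (ι t) 1ℚ) (sym (ι-+ 1 t))) ⟩
    ι (suc t) ^ℚ t                       ≡⟨ ι-^ (suc t) t ⟨
    ι (suc t ℕ.^ t)                      ∎

  -- In the application f = t !, and (1 + 1 / t) ^ t (b / f) is a rational lower bound for the
  -- number under the root in the equation for α. The hypothesis is the same inequality multiplied
  -- by f t ^ t.
  clear-denominators : ∀ {j n M b f} .{{_ : NonZero f}} → let t = suc j in
    f ℕ.* (t ℕ.^ t ℕ.* M ℕ.^ t) ℕ.< suc t ℕ.^ t ℕ.* (b ℕ.* n ℕ.^ j) →
    ι M ^ℚ t < (1ℚ + + 1 / t) ^ℚ t * (+ b / f) * ι n ^ℚ j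
  clear-denominators {j} {n} {M} {b} {f} small = clear (1ℚ + + 1 / t) (+ b / f) (/-*-ι b f) (compound*ι t)
    where
    t : ℕ
    t = suc j
    open +-*-Solver
    clear : ∀ E κ → κ * ι f ≡ ι b → E ^ℚ t * ι (t ℕ.^ t) ≡ ι (suc t ℕ.^ t) → ι M ^ℚ t < E ^ℚ t * κ * ι n ^ℚ j
    clear E κ κf≡b Et≡ = ℚ.*-cancelʳ-<-nonNeg (ι (f ℕ.* t ℕ.^ t)) {{ℚ.nonNegative (ι-nonNeg (f ℕ.* t ℕ.^ t))}} (begin-strict
      ι M ^ℚ t * ι (f ℕ.* t ℕ.^ t)                   ≡⟨ cong (_* ι (f ℕ.* t ℕ.^ t)) (ι-^ M t) ⟨
      ι (M ℕ.^ t) * ι (f ℕ.* t ℕ.^ t)                ≡⟨ ι-* (M ℕ.^ t) (f ℕ.* t ℕ.^ t) ⟨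
      ι (M ℕ.^ t ℕ.* (f ℕ.* t ℕ.^ t))                ≡⟨ cong ι (trans (ℕ.*-comm (M ℕ.^ t) (f ℕ.* t ℕ.^ t)) (ℕ.*-assoc f (t ℕ.^ t) (M ℕ.^ t))) ⟩
      ι (f ℕ.* (t ℕ.^ t ℕ.* M ℕ.^ t))                <⟨ ι-< small ⟩
      ι (suc t ℕ.^ t ℕ.* (b ℕ.* n ℕ.^ j))            ≡⟨ trans (ι-* (suc t ℕ.^ t) (b ℕ.* n ℕ.^ j)) (cong (ι (suc t ℕ.^ t) *_) (ι-* b (n ℕ.^ j))) ⟩
      ι (suc t ℕ.^ t) * (ι b * ι (n ℕ.^ j))          ≡⟨ cong₂ (λ x y → x * (y * ι (n ℕ.^ j))) Et≡ κf≡b ⟨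
      E ^ℚ t * ι (t ℕ.^ t) * (κ * ι f * ι (n ℕ.^ j))
        ≡⟨ solve 5 (λ e x k g y → e :* x :* (k :* g :* y) := e :* k :* y :* (g :* x)) refl (E ^ℚ t) (ι (t ℕ.^ t)) κ (ι f) (ι (n ℕ.^ j)) ⟩
      E ^ℚ t * κ * ι (n ℕ.^ j) * (ι f * ι (t ℕ.^ t)) ≡⟨ cong₂ (λ x y → E ^ℚ t * κ * x * y) (ι-^ n j) (sym (ι-* f (t ℕ.^ t))) ⟩
      E ^ℚ t * κ * ι n ^ℚ j * ι (f ℕ.* t ℕ.^ t)      ∎)

  -- The passage from the equation for α to integers. The last hypothesis says that M colours fail
  -- the condition of the colouring argument; the conclusion is the room required by the repair with
  -- M + 1 colours.
  estimate : ∀ {j n ℓ M a b f} .{{_ : NonZero f}} (α : ℝ) → 0ᴿ <ᴿ α →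
    fromℚ (+ a / f) *ᴿ α ^ᴿ (suc j) +ᴿ fromℕ 2 *ᴿ ((e *ᴿ fromℚ (+ b / f)) ^1/ (suc j)) *ᴿ α ≃ 1ᴿ →
    fromℕ ℓ ≤ᴿ α *ᴿ (fromℕ n ^1/ (suc j)) →
    f ℕ.* (suc j ℕ.^ (suc j) ℕ.* M ℕ.^ (suc j)) ℕ.< suc (suc j) ℕ.^ (suc j) ℕ.* (b ℕ.* n ℕ.^ j) →
    f ℕ.* (2 ℕ.* ℓ ℕ.* M) ℕ.+ a ℕ.* ℓ ℕ.^ (suc j) ℕ.≤ f ℕ.* n
  estimate {j} {n} {ℓ} {M} {a} {b} {f} α (ε , 0<ε , N , α>ε) equation ℓ≤αρ small =
    multiply (+ a / f) (/-*-ι a f) (Estimate.estimateℚ {j} {n} {ℓ} {M} (+ a / f) ((1ℚ + + 1 / suc j) ^ℚ (suc j) * (+ b / f)) α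
      (K ^1/ (suc j)) (fromℕ n ^1/ (suc j)) K (/-nonNeg a f)
      (N , λ i N≤i → ℚ.≤-trans (ℚ.<⇒≤ 0<ε) (ℚ.≤-trans (q≤p+q {0ℚ} ℚ.≤-refl) (ℚ.<⇒≤ (α>ε i N≤i))))
      (λ i → root-approx-nonNeg (suc j) (seq K i) (suc i))
      (λ i → root-approx-nonNeg (suc j) (seq (fromℕ n) i) (suc i))
      (^1/-^ᴿ K (suc j) (pointwise⇒≤ᴿ 0ᴿ K (0 , λ i _ → *-nonNeg (exp-sum-mono (ℕ.z≤′n {i})) (/-nonNeg b f))))
      (^1/-^ᴿ (fromℕ n) (suc j) (pointwise⇒≤ᴿ 0ᴿ (fromℕ n) (0 , λ _ _ → ι-nonNeg n)))
      (suc (suc j) , λ i t<i → *-monoʳ (/-nonNeg b f) (ℚ.≤-trans (compound≤exp-sum (suc j)) (exp-sum-mono (ℕ.≤⇒≤′ t<i))))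
      (clear-denominators {j} {n} {M} {b} {f} small)
      equation ℓ≤αρ)
    where
    K : ℝ
    K = e *ᴿ fromℚ (+ b / f)
    open +-*-Solver
    multiply : ∀ D → D * ι f ≡ ι a → D * ι ℓ ^ℚ (suc j) + ι 2 * ι ℓ * ι M ≤ ι n →
      f ℕ.* (2 ℕ.* ℓ ℕ.* M) ℕ.+ a ℕ.* ℓ ℕ.^ (suc j) ℕ.≤ f ℕ.* n
    multiply D Df≡a le = ι-cancel-≤ (begin
      ι (f ℕ.* (2 ℕ.* ℓ ℕ.* M) ℕ.+ a ℕ.* ℓ ℕ.^ (suc j))
        ≡⟨ trans (ι-+ (f ℕ.* (2 ℕ.* ℓ ℕ.* M)) (a ℕ.* ℓ ℕ.^ (suc j))) (cong₂ _+_
             (trans (ι-* f (2 ℕ.* ℓ ℕ.* M)) (cong (ι f *_) (trans (ι-* (2 ℕ.* ℓ) M) (cong (_* ι M) (ι-* 2 ℓ)))))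
             (trans (ι-* a (ℓ ℕ.^ (suc j))) (cong₂ _*_ (sym Df≡a) (ι-^ ℓ (suc j))))) ⟩
      ι f * (ι 2 * ι ℓ * ι M) + D * ι f * ι ℓ ^ℚ (suc j)
        ≡⟨ solve 4 (λ g x d y → g :* x :+ d :* g :* y := g :* (d :* y :+ x)) refl (ι f) (ι 2 * ι ℓ * ι M) D (ι ℓ ^ℚ (suc j)) ⟩
      ι f * (D * ι ℓ ^ℚ (suc j) + ι 2 * ι ℓ * ι M)     ≤⟨ *-monoˡ (ι-nonNeg f) le ⟩
      ι f * ι n                                  ≡⟨ ι-* f n ⟨
      ι (f ℕ.* n)                                ∎)

open import Data.Bool using (if_then_else_)
open import Data.Empty using (⊥-elim)
open import Data.Fin as Fin using (Fin; zero; suc; inject₁; toℕ; cast)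
open import Data.Fin.Permutation using (cast-id; _∘ₚ_)
open import Data.Fin.Properties as Fin using (any?; all?)
open import Data.Fin.Relation.Unary.Top using (view; ‵fromℕ; ‵inject₁; view-fromℕ; view-inject₁)
open import Data.Fin.Subset
  using (Subset; inside; outside; _∈_; _∉_; _⊆_; ∣_∣; ⊥; ⊤; _∩_; _─_; ⁅_⁆)
open import Data.Fin.Subset.Properties
open import Data.List as List
  using (List; []; _∷_; _++_; map; concat; concatMap; length; filter; take; drop; tabulate; foldr; allFin)
open import Data.List.Membership.Propositional using (find; lose) renaming (_∈_ to _∈ˡ_)
open import Data.List.Membership.Propositional.Properties
  using (∈-allFin; ∈-++⁺ˡ; ∈-++⁺ʳ; ∈-++⁻; ∈-∃++; ∈-filter⁻; ∈-map⁺; ∈-concatMap⁺)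
import Data.List.Properties as List
open import Data.List.Relation.Binary.Permutation.Homogeneous using (onIndices)
open import Data.List.Relation.Binary.Permutation.Propositional
  using (_↭_; ↭-sym; ↭-trans; ↭-reflexive; ↭⇒↭ₛ; prep)
open import Data.List.Relation.Binary.Permutation.Propositional.Properties
  using (++⁺ˡ; ++⁺ʳ; map⁺; shift; ↭-length)
open import Data.List.Relation.Binary.Permutation.Setoid.Properties using (onIndices-lookup)
open import Data.List.Relation.Unary.All as All using (All)
import Data.List.Relation.Unary.All.Properties as All
open import Data.List.Relation.Unary.Any as Any using (Any; here; there)
open import Data.Nat hiding (_/_)
open import Data.Nat.Combinatorics using (_C_; nCk+nC[k+1]≡[n+1]C[k+1])
open import Data.Nat.DivMod using (m%n<n; m<n⇒m%n≡m; m≤n⇒[n∸m]%m≡n%m)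
open import Data.Nat.ListAction using (sum)
open import Data.Nat.ListAction.Properties using (sum-++; sum-↭)
open import Data.Nat.Properties
open import Data.Nat.Tactic.RingSolver using (solve-∀)
open import Data.Product using (∃-syntax; _×_; _,_; proj₁; proj₂)
open import Data.Sum using (_⊎_; inj₁; inj₂; [_,_]′) renaming (map to ⊎-map)
open import Data.Vec using (Vec; []; _∷_; lookup; _[_]≔_; here; there; replicate)
open import Function using (Bijection; Equivalence; _∘_; id)
open import Function.Construct.Identity using (⤖-id)
open import Function.Properties.Inverse using (↔⇒⤖)
open import Relation.Binary.PropositionalEquality
open import Relation.Nullary
  using (¬_; ¬?; Dec; yes; no; does; contradiction; _×-dec_; _⊎-dec_; _→-dec_; decidable-stable)
open import Relation.Unary using (Pred; Decidable)
open import Defs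

-- Finite sums

∑ : {A : Set} → List A → (A → ℕ) → ℕ
∑ xs f = sum (map f xs)

module _ {A : Set} where

  ∑-mono-∈ : ∀ (xs : List A) {f g} → (∀ x → x ∈ˡ xs → f x ≤ g x) → ∑ xs f ≤ ∑ xs g
  ∑-mono-∈ []       h = z≤n
  ∑-mono-∈ (x ∷ xs) h = +-mono-≤ (h x (here refl)) (∑-mono-∈ xs (λ y → h y ∘ there))

  ∑-mono : ∀ (xs : List A) {f g} → (∀ x → f x ≤ g x) → ∑ xs f ≤ ∑ xs g
  ∑-mono xs h = ∑-mono-∈ xs (λ x _ → h x)

  ∑-mono-< : ∀ (xs : List A) {f g} → (∀ x → f x ≤ g x) → ∀ {y} → y ∈ˡ xs → f y < g y →
             ∑ xs f < ∑ xs g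
  ∑-mono-< (x ∷ xs) h (here refl) lt = +-mono-<-≤ lt (∑-mono xs h)
  ∑-mono-< (x ∷ xs) h (there y∈)  lt = +-mono-≤-< (h x) (∑-mono-< xs h y∈ lt)

  ∑-cong : ∀ (xs : List A) {f g} → (∀ x → f x ≡ g x) → ∑ xs f ≡ ∑ xs g
  ∑-cong xs h = cong sum (List.map-cong h xs)

  ∑-+ : ∀ (xs : List A) f g → ∑ xs (λ x → f x + g x) ≡ ∑ xs f + ∑ xs g
  ∑-+ []       f g = refl
  ∑-+ (x ∷ xs) f g = trans (cong (f x + g x +_) (∑-+ xs f g))
    (interchange (f x) (g x) (∑ xs f) (∑ xs g))
    where
    interchange : ∀ a b c d → a + b + (c + d) ≡ a + c + (b + d)
    interchange = solve-∀

  ∑-*ˡ : ∀ c (xs : List A) f → ∑ xs (λ x → c * f x) ≡ c * ∑ xs f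
  ∑-*ˡ c []       f = sym (*-zeroʳ c)
  ∑-*ˡ c (x ∷ xs) f = trans (cong (c * f x +_) (∑-*ˡ c xs f)) (sym (*-distribˡ-+ c (f x) (∑ xs f)))

  ∑-*ʳ : ∀ c (xs : List A) f → ∑ xs (λ x → f x * c) ≡ ∑ xs f * c
  ∑-*ʳ c []       f = refl
  ∑-*ʳ c (x ∷ xs) f = trans (cong (f x * c +_) (∑-*ʳ c xs f)) (sym (*-distribʳ-+ c (f x) (∑ xs f)))

  ∑-const : ∀ c (xs : List A) → ∑ xs (λ _ → c) ≡ length xs * c
  ∑-const c []       = refl
  ∑-const c (x ∷ xs) = cong (c +_) (∑-const c xs)

  ∑-0 : ∀ (xs : List A) → ∑ xs (λ _ → 0) ≡ 0
  ∑-0 xs = trans (∑-const 0 xs) (*-zeroʳ (length xs))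

  ∑-++ : ∀ (xs ys : List A) f → ∑ (xs ++ ys) f ≡ ∑ xs f + ∑ ys f
  ∑-++ xs ys f = trans (cong sum (List.map-++ f xs ys)) (sum-++ (map f xs) (map f ys))

  ∑-map : ∀ {B : Set} (h : B → A) (xs : List B) f → ∑ (map h xs) f ≡ ∑ xs (f ∘ h)
  ∑-map h xs f = cong sum (sym (List.map-∘ xs))

  ∑-concatMap : ∀ {B : Set} (h : B → List A) (xs : List B) f →
                ∑ (concatMap h xs) f ≡ ∑ xs (λ x → ∑ (h x) f)
  ∑-concatMap h []       f = refl
  ∑-concatMap h (x ∷ xs) f = trans (∑-++ (h x) (concatMap h xs) f) (cong (∑ (h x) f +_) (∑-concatMap h xs f))

  ∑-↭ : ∀ {xs ys : List A} f → xs ↭ ys → ∑ xs f ≡ ∑ ys f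
  ∑-↭ f p = sum-↭ (map⁺ f p)

  ∑-∈ : ∀ {xs : List A} {x} f → x ∈ˡ xs → f x ≤ ∑ xs f
  ∑-∈ {y ∷ xs} f (here refl) = m≤m+n (f y) (∑ xs f)
  ∑-∈ {y ∷ xs} f (there x∈)  = ≤-trans (∑-∈ f x∈) (m≤n+m (∑ xs f) (f y))

  ∑-positive : ∀ (xs : List A) {f} → 0 < ∑ xs f → ∃[ x ] x ∈ˡ xs × 0 < f x
  ∑-positive (x ∷ xs) {f} h with f x in eq
  ... | suc _ = x , here refl , subst (0 <_) (sym eq) z<s
  ... | zero  with y , y∈ , lt ← ∑-positive xs h = y , there y∈ , lt

∑-swap : ∀ {A B : Set} (xs : List A) (ys : List B) (f : A → B → ℕ) →
         ∑ xs (λ x → ∑ ys (f x)) ≡ ∑ ys (λ y → ∑ xs (λ x → f x y))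
∑-swap []       ys f = sym (∑-0 ys)
∑-swap (x ∷ xs) ys f = trans (cong (∑ ys (f x) +_) (∑-swap xs ys f))
  (sym (∑-+ ys (f x) (λ y → ∑ xs (λ z → f z y))))

∑-allFin-suc : ∀ n f → ∑ (allFin (suc n)) f ≡ f zero + ∑ (allFin n) (f ∘ suc)
∑-allFin-suc n f = cong (λ xs → f zero + sum xs)
  (trans (List.map-tabulate suc f) (sym (List.map-tabulate (λ x → x) (f ∘ suc))))

𝟙 : {P : Set} → Dec P → ℕ
𝟙 P? = if does P? then 1 else 0

module _ {P : Set} where
  𝟙-yes : (P? : Dec P) → P → 𝟙 P? ≡ 1
  𝟙-yes (yes _) p = refl
  𝟙-yes (no ¬p) p = contradiction p ¬p

  𝟙-no : (P? : Dec P) → ¬ P → 𝟙 P? ≡ 0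
  𝟙-no (yes p) ¬p = contradiction p ¬p
  𝟙-no (no _)  ¬p = refl

  𝟙≤1 : (P? : Dec P) → 𝟙 P? ≤ 1
  𝟙≤1 (yes _) = ≤-refl
  𝟙≤1 (no _)  = z≤n

  𝟙-*-mono : (P? : Dec P) → ∀ {m k} → (P → m ≤ k) → 𝟙 P? * m ≤ 𝟙 P? * k
  𝟙-*-mono (yes p) h = *-monoʳ-≤ 1 (h p)
  𝟙-*-mono (no _)  h = z≤n

  𝟙-positive : (P? : Dec P) → 0 < 𝟙 P? → P
  𝟙-positive (yes p) _ = p

  𝟙≤ : (P? : Dec P) → ∀ {m} → (P → 1 ≤ m) → 𝟙 P? ≤ m
  𝟙≤ (yes p) h = h p
  𝟙≤ (no _)  h = z≤n

𝟙-mono : {P Q : Set} (P? : Dec P) (Q? : Dec Q) → (P → Q) → 𝟙 P? ≤ 𝟙 Q?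
𝟙-mono P? Q? h = 𝟙≤ P? (λ p → ≤-reflexive (sym (𝟙-yes Q? (h p))))

length-filter : ∀ {A : Set} {P : Pred A _} (P? : Decidable P) xs →
                length (filter P? xs) ≡ ∑ xs (λ x → 𝟙 (P? x))
length-filter P? []       = refl
length-filter P? (x ∷ xs) with P? x
... | yes _ = cong suc (length-filter P? xs)
... | no _  = length-filter P? xs

-- Probabilities are expressed as counts over these lists, which serve both for subsets and for
-- colourings.
vectors : {A : Set} → List A → ∀ n → List (Vec A n)
vectors xs zero    = [] ∷ []
vectors xs (suc n) = concatMap (λ x → map (x ∷_) (vectors xs n)) xs

∑-vectors-suc : ∀ {A : Set} (xs : List A) n f →
  ∑ (vectors xs (suc n)) f ≡ ∑ xs (λ x → ∑ (vectors xs n) (λ v → f (x ∷ v)))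
∑-vectors-suc xs n f = trans (∑-concatMap (λ x → map (x ∷_) (vectors xs n)) xs f)
  (∑-cong xs (λ x → ∑-map (x ∷_) (vectors xs n) f))

∈-vectors : ∀ {A : Set} {xs : List A} → (∀ a → a ∈ˡ xs) → ∀ {n} (v : Vec A n) → v ∈ˡ vectors xs n
∈-vectors h []      = here refl
∈-vectors {xs = xs} h (a ∷ v) =
  ∈-concatMap⁺ (λ x → map (x ∷_) (vectors xs _))
    (Any.map (λ { refl → ∈-map⁺ (a ∷_) (∈-vectors h v) }) (h a))

-- Subsets

subsets : ∀ n → List (Subset n)
subsets = vectors (outside ∷ inside ∷ [])

∑-subsets-suc : ∀ n f →
  ∑ (subsets (suc n)) f ≡ ∑ (subsets n) (λ T → f (outside ∷ T)) + ∑ (subsets n) (λ T → f (inside ∷ T))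
∑-subsets-suc n f = trans (∑-vectors-suc (outside ∷ inside ∷ []) n f)
  (cong (∑ (subsets n) (λ T → f (outside ∷ T)) +_) (+-identityʳ _))

-- Splitting by whether the first point of Q is used is Pascal's rule.
count-subsets : ∀ {n} (Q : Subset n) j →
  ∑ (subsets n) (λ T → 𝟙 (T ⊆? Q) * 𝟙 (∣ T ∣ ≟ j)) ≡ ∣ Q ∣ C j
count-subsets []            zero    = refl
count-subsets []            (suc j) = refl
count-subsets {suc n} (outside ∷ Q) j       = trans (∑-subsets-suc n _)
  (trans (cong₂ _+_ (count-subsets Q j) (∑-0 (subsets n))) (+-identityʳ _))
count-subsets {suc n} (inside ∷ Q)  zero    = trans (∑-subsets-suc n _)
  (trans (cong₂ _+_ (count-subsets Q 0)
    (trans (∑-cong (subsets n) (λ T → *-zeroʳ (𝟙 (T ⊆? Q)))) (∑-0 (subsets n)))) refl)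
count-subsets {suc n} (inside ∷ Q)  (suc j) = trans (∑-subsets-suc n _)
  (trans (cong₂ _+_ (count-subsets Q (suc j)) (count-subsets Q j))
    (trans (+-comm (∣ Q ∣ C suc j) (∣ Q ∣ C j)) (nCk+nC[k+1]≡[n+1]C[k+1] ∣ Q ∣ j)))

∈-subsets : ∀ {n} (T : Subset n) → T ∈ˡ subsets n
∈-subsets = ∈-vectors λ { outside → here refl ; inside → there (here refl) }

∑-difference : ∀ {n} {U b : Subset n} → U ⊆ b →
  ∣ U ∣ + ∑ (allFin n) (λ x → 𝟙 (x ∈? b) * (1 ∸ 𝟙 (x ∈? U))) ≡ ∣ b ∣
∑-difference {zero} {[]} {[]} U⊆b = refl
∑-difference {suc n} {u ∷ U} {v ∷ b} U⊆b =
  trans (cong (∣ u ∷ U ∣ +_) (∑-allFin-suc n _)) (go u v U⊆b)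
  where
  d : ℕ
  d = ∑ (allFin n) (λ x → 𝟙 (x ∈? b) * (1 ∸ 𝟙 (x ∈? U)))
  ih : ∣ U ∣ + d ≡ ∣ b ∣
  ih = ∑-difference (drop-∷-⊆ U⊆b)
  go : ∀ u v → u ∷ U ⊆ v ∷ b →
    ∣ u ∷ U ∣ + (𝟙 (zero ∈? (v ∷ b)) * (1 ∸ 𝟙 (zero ∈? (u ∷ U))) + d) ≡ ∣ v ∷ b ∣
  go outside outside _ = ih
  go outside inside  _ = trans (+-suc ∣ U ∣ d) (cong suc ih)
  go inside  outside h = contradiction (h here) λ ()
  go inside  inside  _ = cong suc ih

∣insert∣ : ∀ {n} (U : Subset n) x → x ∉ U → ∣ U [ x ]≔ inside ∣ ≡ suc ∣ U ∣
∣insert∣ (inside ∷ U)  zero    x∉U = contradiction here x∉U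
∣insert∣ (outside ∷ U) zero    x∉U = refl
∣insert∣ (inside ∷ U)  (suc x) x∉U = cong suc (∣insert∣ U x (x∉U ∘ there))
∣insert∣ (outside ∷ U) (suc x) x∉U = ∣insert∣ U x (x∉U ∘ there)

insert-⊆ : ∀ {n} {U b : Subset n} {x} → U ⊆ b → x ∈ b → U [ x ]≔ inside ⊆ b
insert-⊆ {U = u ∷ U} {v ∷ b} {zero}  U⊆b here      here       = here
insert-⊆ {U = u ∷ U} {v ∷ b} {zero}  U⊆b here      (there y∈) = U⊆b (there y∈)
insert-⊆ {U = u ∷ U} {v ∷ b} {suc x} U⊆b (there x∈) here       = U⊆b here
insert-⊆ {U = u ∷ U} {v ∷ b} {suc x} U⊆b (there x∈) (there y∈) =
  there (insert-⊆ (drop-∷-⊆ U⊆b) x∈ y∈)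

∈-insert : ∀ {n} (U : Subset n) x → x ∈ U [ x ]≔ inside
∈-insert (_ ∷ U) zero    = here
∈-insert (_ ∷ U) (suc x) = there (∈-insert U x)

∈-insert⁻ : ∀ {n} {U : Subset n} {v x} → x ∈ U [ v ]≔ inside → x ≢ v → x ∈ U
∈-insert⁻ {U = _ ∷ U} {zero}  here       x≢v = contradiction refl x≢v
∈-insert⁻ {U = _ ∷ U} {zero}  (there x∈) x≢v = there x∈
∈-insert⁻ {U = _ ∷ U} {suc v} here       x≢v = here
∈-insert⁻ {U = _ ∷ U} {suc v} (there x∈) x≢v = there (∈-insert⁻ x∈ (x≢v ∘ cong suc))

truncate : ∀ {n} → ℕ → Subset n → Subset n
truncate j       []            = []
truncate zero    (_ ∷ p)       = outside ∷ truncate zero p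
truncate (suc j) (inside ∷ p)  = inside ∷ truncate j p
truncate (suc j) (outside ∷ p) = outside ∷ truncate (suc j) p

truncate-⊆ : ∀ {n} j (p : Subset n) → truncate j p ⊆ p
truncate-⊆ zero    (_ ∷ p)       (there x∈) = there (truncate-⊆ zero p x∈)
truncate-⊆ (suc j) (inside ∷ p)  here       = here
truncate-⊆ (suc j) (inside ∷ p)  (there x∈) = there (truncate-⊆ j p x∈)
truncate-⊆ (suc j) (outside ∷ p) (there x∈) = there (truncate-⊆ (suc j) p x∈)

∣truncate∣ : ∀ {n} j (p : Subset n) → j ≤ ∣ p ∣ → ∣ truncate j p ∣ ≡ j
∣truncate∣ zero    []            h = refl
∣truncate∣ zero    (_ ∷ p)       h = ∣truncate∣ zero p z≤n
∣truncate∣ (suc j) (inside ∷ p)  h = cong suc (∣truncate∣ j p (s≤s⁻¹ h))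
∣truncate∣ (suc j) (outside ∷ p) h = ∣truncate∣ (suc j) p h

-- Degrees

codegree : ∀ {n} → List (Subset n) → Subset n → ℕ
codegree bs U = ∑ bs (λ b → 𝟙 (U ⊆? b))

-- Double counting of the pairs (b, x) with U ⊆ b and x ∈ b ∖ U.
codegree-bound : ∀ {n t μ} (bs : List (Subset n)) → All (λ b → ∣ b ∣ ≡ suc t) bs →
  (∀ T → ∣ T ∣ ≡ t → codegree bs T ≤ μ) →
  ∀ j U → ∣ U ∣ + j ≡ t → codegree bs U * (suc j) ! ≤ μ * n ^ j
codegree-bound {μ = μ} bs size cov zero U eq = ≤-trans (≤-reflexive (*-identityʳ _))
  (≤-trans (cov U (trans (sym (+-identityʳ _)) eq)) (≤-reflexive (sym (*-identityʳ μ))))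
codegree-bound {n} {t} {μ} bs size cov (suc j) U eq = begin
  codegree bs U * (suc (suc j) * (suc j) !)                 ≡⟨ *-assoc (codegree bs U) (2 + j) _ ⟨
  codegree bs U * suc (suc j) * (suc j) !                   ≤⟨ *-monoˡ-≤ ((suc j) !) pairs ⟩
  ∑ (allFin n) (λ x → (1 ∸ 𝟙 (x ∈? U)) * codegree bs (U [ x ]≔ inside)) * (suc j) !
    ≡⟨ ∑-*ʳ ((suc j) !) (allFin n) _ ⟨
  ∑ (allFin n) (λ x → (1 ∸ 𝟙 (x ∈? U)) * codegree bs (U [ x ]≔ inside) * (suc j) !)
    ≤⟨ ∑-mono (allFin n) extend ⟩
  ∑ (allFin n) (λ _ → μ * n ^ j)                            ≡⟨ ∑-const (μ * n ^ j) (allFin n) ⟩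
  length (allFin n) * (μ * n ^ j)                           ≡⟨ cong (_* (μ * n ^ j)) (List.length-tabulate {n = n} (λ x → x)) ⟩
  n * (μ * n ^ j)                                           ≡⟨ comm₃ n μ (n ^ j) ⟩
  μ * (n * n ^ j)                                           ∎
  where
  open ≤-Reasoning
  comm₃ : ∀ a b c → a * (b * c) ≡ b * (a * c)
  comm₃ = solve-∀
  extend : ∀ x → (1 ∸ 𝟙 (x ∈? U)) * codegree bs (U [ x ]≔ inside) * (suc j) ! ≤ μ * n ^ j
  extend x with x ∈? U
  ... | yes _  = z≤n
  ... | no x∉U = ≤-trans (≤-reflexive (cong (_* (suc j) !) (*-identityˡ (codegree bs (U [ x ]≔ inside)))))
    (codegree-bound bs size cov j (U [ x ]≔ inside)
      (trans (cong (_+ j) (∣insert∣ U x x∉U)) (trans (sym (+-suc ∣ U ∣ j)) eq)))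
  local : ∀ b → b ∈ˡ bs → 𝟙 (U ⊆? b) * suc (suc j) ≤
          ∑ (allFin n) (λ x → (1 ∸ 𝟙 (x ∈? U)) * 𝟙 (U [ x ]≔ inside ⊆? b))
  local b b∈ with U ⊆? b
  ... | no _    = z≤n
  ... | yes U⊆b = begin
    1 * suc (suc j)                                             ≡⟨ *-identityˡ _ ⟩
    suc (suc j)                                                 ≡⟨ +-cancelˡ-≡ ∣ U ∣ _ _ (trans (+-suc ∣ U ∣ (suc j))
      (trans (cong suc eq) (trans (sym (All.lookup size b∈)) (sym (∑-difference U⊆b))))) ⟩
    ∑ (allFin n) (λ x → 𝟙 (x ∈? b) * (1 ∸ 𝟙 (x ∈? U)))        ≡⟨ ∑-cong (allFin n) (λ x → *-comm (𝟙 (x ∈? b)) _) ⟩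
    ∑ (allFin n) (λ x → (1 ∸ 𝟙 (x ∈? U)) * 𝟙 (x ∈? b))
      ≤⟨ ∑-mono (allFin n) (λ x → *-monoʳ-≤ (1 ∸ 𝟙 (x ∈? U))
           (𝟙-mono (x ∈? b) (U [ x ]≔ inside ⊆? b) (λ x∈ → insert-⊆ U⊆b x∈))) ⟩
    ∑ (allFin n) (λ x → (1 ∸ 𝟙 (x ∈? U)) * 𝟙 (U [ x ]≔ inside ⊆? b)) ∎
  pairs : codegree bs U * suc (suc j) ≤
          ∑ (allFin n) (λ x → (1 ∸ 𝟙 (x ∈? U)) * codegree bs (U [ x ]≔ inside))
  pairs = begin
    codegree bs U * suc (suc j)                          ≡⟨ ∑-*ʳ (2 + j) bs _ ⟨
    ∑ bs (λ b → 𝟙 (U ⊆? b) * suc (suc j))               ≤⟨ ∑-mono-∈ bs local ⟩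
    ∑ bs (λ b → ∑ (allFin n) (λ x → (1 ∸ 𝟙 (x ∈? U)) * 𝟙 (U [ x ]≔ inside ⊆? b)))
      ≡⟨ ∑-swap bs (allFin n) _ ⟩
    ∑ (allFin n) (λ x → ∑ bs (λ b → (1 ∸ 𝟙 (x ∈? U)) * 𝟙 (U [ x ]≔ inside ⊆? b)))
      ≡⟨ ∑-cong (allFin n) (λ x → ∑-*ˡ (1 ∸ 𝟙 (x ∈? U)) bs _) ⟩
    ∑ (allFin n) (λ x → (1 ∸ 𝟙 (x ∈? U)) * codegree bs (U [ x ]≔ inside)) ∎

-- Falling factorials and the numerical bound for the repair

module _ where
  open ≤-Reasoning

  C-mono : ∀ {p q} k → p ≤ q → p C k ≤ q C k
  C-mono k p≤q = go k (≤⇒≤′ p≤q)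
    where
    step : ∀ q k → q C k ≤ suc q C k
    step q zero    = ≤-refl
    step q (suc k) = ≤-trans (m≤n+m (q C suc k) (q C k)) (≤-reflexive (nCk+nC[k+1]≡[n+1]C[k+1] q k))
    go : ∀ {p q} k → p ≤′ q → p C k ≤ q C k
    go k ≤′-refl              = ≤-refl
    go k (≤′-step {n = q} h) = ≤-trans (go k h) (step q k)

  ^-distribʳ-* : ∀ x y k → (x * y) ^ k ≡ x ^ k * y ^ k
  ^-distribʳ-* x y zero    = refl
  ^-distribʳ-* x y (suc k) = trans (cong (x * y *_) (^-distribʳ-* x y k)) (lem x y (x ^ k) (y ^ k))
    where
    lem : ∀ a b c d → a * b * (c * d) ≡ a * c * (b * d)
    lem = solve-∀

  bernoulli : ∀ x j → x ^ suc j + suc j * x ^ j ≤ suc x ^ suc j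
  bernoulli x zero    = ≤-reflexive (lem x)
    where
    lem : ∀ x → x * 1 + 1 * 1 ≡ (1 + x) * 1
    lem = solve-∀
  bernoulli x (suc j) = begin
    x * (x * y) + suc (suc j) * (x * y)              ≤⟨ m≤m+n _ (suc j * y) ⟩
    x * (x * y) + suc (suc j) * (x * y) + suc j * y  ≡⟨ lem x j y ⟩
    suc x * (x * y + suc j * y)                      ≤⟨ *-monoʳ-≤ (suc x) (bernoulli x j) ⟩
    suc x * suc x ^ suc j                            ∎
    where
    y : ℕ
    y = x ^ j
    lem : ∀ x j y → x * (x * y) + (2 + j) * (x * y) + (1 + j) * y ≡ (1 + x) * (x * y + (1 + j) * y)
    lem = solve-∀

  -- The falling factorial q (q - 1) ... (q - k + 1), written so that Pascal's rule yields its
  -- increments in q.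
  falling : ℕ → ℕ → ℕ
  falling q k = k ! * (q C k)

  falling-suc : ∀ q k → falling (suc q) (suc k) ≡ falling q (suc k) + suc k * falling q k
  falling-suc q k = trans (cong (suc k ! *_) (sym (nCk+nC[k+1]≡[n+1]C[k+1] q k)))
    (lem (suc k) (k !) (q C k) (q C suc k))
    where
    lem : ∀ a f c d → a * f * (c + d) ≡ a * f * d + a * (f * c)
    lem = solve-∀

  -- Both sides are compared through their increments in q, given by `falling-suc` and bounded below
  -- by `bernoulli`.
  falling≤^ : ∀ q k → falling q k ≤ q ^ k
  falling≤^ q       zero    = ≤-refl
  falling≤^ zero    (suc k) = ≤-reflexive (*-zeroʳ (suc k !))
  falling≤^ (suc q) (suc k) = begin
    falling (suc q) (suc k)                 ≡⟨ falling-suc q k ⟩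
    falling q (suc k) + suc k * falling q k ≤⟨ +-mono-≤ (falling≤^ q (suc k)) (*-monoʳ-≤ (suc k) (falling≤^ q k)) ⟩
    q ^ suc k + suc k * q ^ k               ≤⟨ bernoulli q k ⟩
    suc q ^ suc k                           ∎

  -- (d + ℓ) ^ k ∸ falling (d + s) k is increasing in d.
  falling-gap : ∀ d {s ℓ} k → s ≤ ℓ → falling (d + s) (suc k) + ℓ ^ suc k ≤ (d + ℓ) ^ suc k + falling s (suc k)
  falling-gap zero    {s} {ℓ} k s≤ℓ = ≤-reflexive (+-comm (falling s (suc k)) (ℓ ^ suc k))
  falling-gap (suc d) {s} {ℓ} k s≤ℓ = begin
    falling (suc d + s) (suc k) + ℓ ^ suc k
      ≡⟨ cong (_+ ℓ ^ suc k) (falling-suc (d + s) k) ⟩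
    falling (d + s) (suc k) + suc k * falling (d + s) k + ℓ ^ suc k
      ≡⟨ lem (falling (d + s) (suc k)) _ _ ⟩
    suc k * falling (d + s) k + (falling (d + s) (suc k) + ℓ ^ suc k)
      ≤⟨ +-mono-≤ (*-monoʳ-≤ (suc k) (≤-trans (falling≤^ (d + s) k) (^-monoˡ-≤ k (+-monoʳ-≤ d s≤ℓ))))
                  (falling-gap d k s≤ℓ) ⟩
    suc k * (d + ℓ) ^ k + ((d + ℓ) ^ suc k + falling s (suc k))
      ≡⟨ lem₂ (suc k * (d + ℓ) ^ k) ((d + ℓ) ^ suc k) (falling s (suc k)) ⟩
    (d + ℓ) ^ suc k + suc k * (d + ℓ) ^ k + falling s (suc k)
      ≤⟨ +-monoˡ-≤ (falling s (suc k)) (bernoulli (d + ℓ) k) ⟩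
    (suc d + ℓ) ^ suc k + falling s (suc k) ∎
    where
    lem : ∀ a b c → a + b + c ≡ b + (a + c)
    lem = solve-∀
    lem₂ : ∀ a b c → a + (b + c) ≡ b + a + c
    lem₂ = solve-∀

  !≤^ : ∀ j {y} → suc j ≤ y → (suc j) ! ≤ y ^ j
  !≤^ zero    _  = ≤-refl
  !≤^ (suc j) le = *-mono-≤ le (!≤^ j (≤-trans (n≤1+n _) le))

  -- Put ℓ = u + 1, t = j + 2 and y = 2 ℓ - 1. Since ℓ + s′ ≤ y, Bernoulli's inequality for (y + 1)
  -- ^ t leaves room t y ^ (t - 1). This absorbs t ! s because (t - 1) ! ≤ y ^ (t - 2) and s < y.
  falling-room : ∀ {s s′ u} j → s′ ≤ u → s ≤ u → suc (suc j) ≤ u →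
    falling (suc u + s′) (2 + j) + (2 + j) ! * s < (2 * suc u) ^ (2 + j)
  falling-room {s} {s′} {u} j s′≤u s≤u t≤u = begin-strict
    falling (suc u + s′) (2 + j) + (2 + j) ! * s
      ≤⟨ +-monoˡ-≤ _ (≤-trans (falling≤^ (suc u + s′) (2 + j)) (^-monoˡ-≤ (2 + j) (+-monoʳ-≤ (suc u) s′≤u))) ⟩
    y ^ (2 + j) + (2 + j) ! * s            ≤⟨ +-monoʳ-≤ (y ^ (2 + j)) (*-monoˡ-≤ s (*-monoʳ-≤ (2 + j) (!≤^ j j<y))) ⟩
    y ^ (2 + j) + (2 + j) * y ^ j * s      <⟨ +-monoʳ-< (y ^ (2 + j)) (*-monoʳ-< ((2 + j) * y ^ j) {{m*n≢0 (2 + j) (y ^ j) {{_}} {{m^n≢0 y j}}}} (s≤s (≤-trans s≤u (m≤m+n u u)))) ⟩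
    y ^ (2 + j) + (2 + j) * y ^ j * y      ≡⟨ cong (y ^ (2 + j) +_) (lem (2 + j) (y ^ j) y) ⟩
    y ^ (2 + j) + (2 + j) * y ^ (1 + j)    ≤⟨ bernoulli y (1 + j) ⟩
    suc y ^ (2 + j)                        ≡⟨ cong (_^ (2 + j)) (double u) ⟩
    (2 * suc u) ^ (2 + j)                  ∎
    where
    y : ℕ
    y = suc u + u
    j<y : suc j ≤ y
    j<y = ≤-trans (n≤1+n _) (≤-trans t≤u (m≤n+m u (suc u)))
    lem : ∀ a b c → a * b * c ≡ a * (c * b)
    lem = solve-∀
    double : ∀ u → 1 + (1 + u + u) ≡ 2 * (1 + u)
    double = solve-∀

  -- It suffices that t ! (X + s) < W ℓ ^ t, where W ℓ ^ t = 2 (2 ℓ) ^ t - ℓ ^ t. The two copies of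
  -- `falling (ℓ + s′) t` from the bound on X are spent differently: one pays for ℓ ^ t with the
  -- help of the overlap (`falling-gap`), the other for t ! s (`falling-room`).
  blocked-bound : ∀ {t μ n ℓ M X s s′} .{{_ : NonZero μ}} → 2 ≤ t → t < ℓ → s′ ≤ s → s < ℓ →
    X + s′ C t ≤ 2 * ((ℓ + s′) C t) →
    t ! * (2 * ℓ * M) + (2 ^ suc t ∸ 1) * μ * ℓ ^ t ≤ t ! * n →
    μ * X + 2 * ℓ * M + s < n
  blocked-bound {t@(suc (suc j))} {μ} {n} {ℓ@(suc u)} {M} {X} {s} {s′} (s≤s (s≤s _)) t<ℓ s′≤s s<ℓ hX hn =
    *-cancelˡ-< (t !) _ _ (begin-strict
      t ! * (μ * X + 2 * ℓ * M + s)                    ≡⟨ lem₁ (t !) (μ * X) (2 * ℓ * M) s ⟩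
      t ! * (2 * ℓ * M) + (t ! * (μ * X) + t ! * s)    ≤⟨ +-monoʳ-≤ (t ! * (2 * ℓ * M)) (+-monoʳ-≤ (t ! * (μ * X)) (m≤n*m (t ! * s) μ)) ⟩
      t ! * (2 * ℓ * M) + (t ! * (μ * X) + μ * (t ! * s)) ≡⟨ cong (t ! * (2 * ℓ * M) +_) (lem₂ (t !) μ X s) ⟩
      t ! * (2 * ℓ * M) + μ * (t ! * X + t ! * s)      <⟨ +-monoʳ-< (t ! * (2 * ℓ * M)) (*-monoʳ-< μ core) ⟩
      t ! * (2 * ℓ * M) + μ * (W * ℓ ^ t)              ≡⟨ cong (t ! * (2 * ℓ * M) +_) (lem₃ μ W (ℓ ^ t)) ⟩
      t ! * (2 * ℓ * M) + W * μ * ℓ ^ t                ≤⟨ hn ⟩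
      t ! * n                                          ∎)
    where
    W : ℕ
    W = 2 ^ suc t ∸ 1
    lem₁ : ∀ f a b s → f * (a + b + s) ≡ f * b + (f * a + f * s)
    lem₁ = solve-∀
    lem₂ : ∀ f m x s → f * (m * x) + m * (f * s) ≡ m * (f * x + f * s)
    lem₂ = solve-∀
    lem₃ : ∀ m w l → m * (w * l) ≡ w * m * l
    lem₃ = solve-∀
    lem₄ : ∀ f x s a b → f * x + f * s + (a + f * b) ≡ f * (x + b) + f * s + a
    lem₄ = solve-∀
    lem₅ : ∀ f q a s → f * (2 * q) + f * s + a ≡ f * q + a + (f * q + f * s)
    lem₅ = solve-∀
    lem₆ : ∀ p q → p + q + p ≡ 2 * p + q
    lem₆ = solve-∀
    s≤u : s ≤ u
    s≤u = s≤s⁻¹ s<ℓ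
    s′≤u : s′ ≤ u
    s′≤u = ≤-trans s′≤s s≤u
    2ℓ^ : 2 * (2 * ℓ) ^ t ≡ W * ℓ ^ t + ℓ ^ t
    2ℓ^ = begin-equality
      2 * (2 * ℓ) ^ t             ≡⟨ cong (2 *_) (^-distribʳ-* 2 ℓ t) ⟩
      2 * (2 ^ t * ℓ ^ t)         ≡⟨ *-assoc 2 (2 ^ t) (ℓ ^ t) ⟨
      2 ^ suc t * ℓ ^ t           ≡⟨ cong (_* ℓ ^ t) (trans (+-comm W 1) (m+[n∸m]≡n (m^n>0 2 (suc t)))) ⟨
      (W + 1) * ℓ ^ t             ≡⟨ lem₇ W (ℓ ^ t) ⟩
      W * ℓ ^ t + ℓ ^ t           ∎
      where
      lem₇ : ∀ w l → (w + 1) * l ≡ w * l + l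
      lem₇ = solve-∀
    core : t ! * X + t ! * s < W * ℓ ^ t
    core = +-cancelʳ-< (ℓ ^ t + falling s′ t) _ _ (begin-strict
      t ! * X + t ! * s + (ℓ ^ t + falling s′ t)       ≡⟨ lem₄ (t !) X s (ℓ ^ t) (s′ C t) ⟩
      t ! * (X + s′ C t) + t ! * s + ℓ ^ t             ≤⟨ +-monoˡ-≤ (ℓ ^ t) (+-monoˡ-≤ (t ! * s) (*-monoʳ-≤ (t !) hX)) ⟩
      t ! * (2 * ((ℓ + s′) C t)) + t ! * s + ℓ ^ t     ≡⟨ lem₅ (t !) ((ℓ + s′) C t) (ℓ ^ t) s ⟩
      falling (ℓ + s′) t + ℓ ^ t + (falling (ℓ + s′) t + t ! * s)
        <⟨ +-mono-≤-< (falling-gap ℓ (suc j) (≤-trans s′≤u (n≤1+n u))) (falling-room j s′≤u s≤u (s≤s⁻¹ t<ℓ)) ⟩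
      (ℓ + ℓ) ^ t + falling s′ t + (2 * ℓ) ^ t         ≡⟨ cong (λ z → z ^ t + falling s′ t + (2 * ℓ) ^ t) (cong (ℓ +_) (sym (+-identityʳ ℓ))) ⟩
      (2 * ℓ) ^ t + falling s′ t + (2 * ℓ) ^ t         ≡⟨ lem₆ ((2 * ℓ) ^ t) (falling s′ t) ⟩
      2 * (2 * ℓ) ^ t + falling s′ t                   ≡⟨ cong (_+ falling s′ t) 2ℓ^ ⟩
      W * ℓ ^ t + ℓ ^ t + falling s′ t                 ≡⟨ +-assoc (W * ℓ ^ t) (ℓ ^ t) _ ⟩
      W * ℓ ^ t + (ℓ ^ t + falling s′ t)               ∎)

-- Counting colourings that use two given colours on a block

prev : ∀ {m} → Fin m → Fin m
prev {suc m} zero    = Fin.fromℕ m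
prev {suc m} (suc c) = inject₁ c

∑-𝟙≟ : ∀ {m} (c : Fin m) → ∑ (allFin m) (λ a → 𝟙 (a Fin.≟ c)) ≡ 1
∑-𝟙≟ {suc m} zero    = trans (∑-allFin-suc m (λ a → 𝟙 (a Fin.≟ zero))) (cong suc (∑-0 (allFin m)))
∑-𝟙≟ {suc m} (suc c) = trans (∑-allFin-suc m (λ a → 𝟙 (a Fin.≟ suc c))) (∑-𝟙≟ c)

∣p∣≡∣p∩q∣+∣p─q∣ : ∀ {n} (p q : Subset n) → ∣ p ∣ ≡ ∣ p ∩ q ∣ + ∣ p ─ q ∣
∣p∣≡∣p∩q∣+∣p─q∣ []            []            = refl
∣p∣≡∣p∩q∣+∣p─q∣ (outside ∷ p) (inside ∷ q)  = ∣p∣≡∣p∩q∣+∣p─q∣ p q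
∣p∣≡∣p∩q∣+∣p─q∣ (outside ∷ p) (outside ∷ q) = ∣p∣≡∣p∩q∣+∣p─q∣ p q
∣p∣≡∣p∩q∣+∣p─q∣ (inside ∷ p)  (inside ∷ q)  = cong suc (∣p∣≡∣p∩q∣+∣p─q∣ p q)
∣p∣≡∣p∩q∣+∣p─q∣ (inside ∷ p)  (outside ∷ q) =
  trans (cong suc (∣p∣≡∣p∩q∣+∣p─q∣ p q)) (sym (+-suc ∣ p ∩ q ∣ ∣ p ─ q ∣))

module _ {m : ℕ} (p c : Fin m) where

  Within : ∀ {n} → Vec (Fin m) n → Subset n → Set
  Within f b = ∀ x → x ∈ b → lookup f x ≡ p ⊎ lookup f x ≡ c

  within? : ∀ {n} (f : Vec (Fin m) n) b → Dec (Within f b)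
  within? f b = all? (λ x → (x ∈? b) →-dec ((lookup f x Fin.≟ p) ⊎-dec (lookup f x Fin.≟ c)))

  -- Requiring the colour c excludes the pattern constantly p. In a sum over all consecutive pairs
  -- each monochromatic pattern is then counted for one pair only.
  Touching : ∀ {n} → Vec (Fin m) n → Subset n → Set
  Touching f b = Within f b × ∃[ x ] x ∈ b × lookup f x ≡ c

  touching? : ∀ {n} (f : Vec (Fin m) n) b → Dec (Touching f b)
  touching? f b = within? f b ×-dec any? (λ x → (x ∈? b) ×-dec (lookup f x Fin.≟ c))

  -- Independence in counting form: G depends only on the colours outside b.
  IgnoredBy : ∀ {n} → Subset n → (Vec (Fin m) n → ℕ) → Set
  IgnoredBy b G = ∀ f g → (∀ x → x ∉ b → lookup f x ≡ lookup g x) → G f ≡ G g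

  colourings : ∀ n → List (Vec (Fin m) n)
  colourings = vectors (allFin m)

  private
    tail-within : ∀ {n a s} {f : Vec (Fin m) n} {b} → Within (a ∷ f) (s ∷ b) → Within f b
    tail-within w x x∈ = w (suc x) (there x∈)

    tail-ignored : ∀ {n s} {b : Subset n} {G} a → IgnoredBy (s ∷ b) G → IgnoredBy b (G ∘ (a ∷_))
    tail-ignored a ig f g h = ig (a ∷ f) (a ∷ g)
      λ { zero _ → refl ; (suc x) x∉ → h x (x∉ ∘ there) }

    head-ignored : ∀ {n} {b : Subset n} {G} → IgnoredBy (inside ∷ b) G → ∀ a f → G (a ∷ f) ≡ G (p ∷ f)
    head-ignored ig a f = ig (a ∷ f) (p ∷ f)
      λ { zero 0∉ → contradiction here 0∉ ; (suc x) _ → refl }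

    ∑-ignored : ∀ {n} {b : Subset n} {G} → IgnoredBy (inside ∷ b) G →
                ∑ (colourings (suc n)) G ≡ m * ∑ (colourings n) (G ∘ (p ∷_))
    ∑-ignored {n} {G = G} ig = trans (∑-vectors-suc (allFin m) n G)
      (trans (∑-cong (allFin m) (λ a → ∑-cong (colourings n) (head-ignored ig a)))
        (trans (∑-const _ (allFin m)) (cong (_* ∑ (colourings n) (G ∘ (p ∷_))) (List.length-tabulate {n = m} id))))

    ∑-two : ∀ A B → ∑ (allFin m) (λ a → 𝟙 (a Fin.≟ p) * A + 𝟙 (a Fin.≟ c) * B) ≡ A + B
    ∑-two A B = trans (∑-+ (allFin m) _ _) (cong₂ _+_ (one p A) (one c B))
      where
      one : ∀ d X → ∑ (allFin m) (λ a → 𝟙 (a Fin.≟ d) * X) ≡ X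
      one d X = trans (∑-*ʳ X (allFin m) _) (trans (cong (_* X) (∑-𝟙≟ d)) (*-identityˡ X))

  open ≤-Reasoning

  -- Each vertex of b has one of the two colours with probability at most 2 / m, independently of G.
  -- Only an inequality holds, since p and c may coincide.
  ∑-within : ∀ {n} (b : Subset n) G → IgnoredBy b G →
    ∑ (colourings n) (λ f → 𝟙 (within? f b) * G f) * m ^ ∣ b ∣ ≤ 2 ^ ∣ b ∣ * ∑ (colourings n) G
  ∑-within [] G ig = ≤-trans (≤-reflexive (*-identityʳ _))
    (≤-trans (+-monoˡ-≤ 0 (*-monoˡ-≤ (G []) (𝟙≤1 (within? [] [])))) (≤-reflexive refl′))
    where
    refl′ : 1 * G [] + 0 ≡ 1 * (G [] + 0)
    refl′ = trans (cong (_+ 0) (*-identityˡ (G []))) (sym (*-identityˡ (G [] + 0)))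
  ∑-within {suc n} (outside ∷ b) G ig = begin
    ∑ (colourings (suc n)) (λ f → 𝟙 (within? f (outside ∷ b)) * G f) * m ^ ∣ b ∣
      ≡⟨ cong (_* m ^ ∣ b ∣) (∑-vectors-suc (allFin m) n _) ⟩
    ∑ (allFin m) (λ a → ∑ (colourings n) (λ f → 𝟙 (within? (a ∷ f) (outside ∷ b)) * G (a ∷ f))) * m ^ ∣ b ∣
      ≤⟨ *-monoˡ-≤ (m ^ ∣ b ∣) (∑-mono (allFin m) (λ a → ∑-mono (colourings n) (λ f →
           *-monoˡ-≤ (G (a ∷ f)) (𝟙-mono (within? (a ∷ f) (outside ∷ b)) (within? f b) tail-within)))) ⟩
    ∑ (allFin m) (λ a → ∑ (colourings n) (λ f → 𝟙 (within? f b) * G (a ∷ f))) * m ^ ∣ b ∣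
      ≡⟨ ∑-*ʳ (m ^ ∣ b ∣) (allFin m) _ ⟨
    ∑ (allFin m) (λ a → ∑ (colourings n) (λ f → 𝟙 (within? f b) * G (a ∷ f)) * m ^ ∣ b ∣)
      ≤⟨ ∑-mono (allFin m) (λ a → ∑-within b (G ∘ (a ∷_)) (tail-ignored a ig)) ⟩
    ∑ (allFin m) (λ a → 2 ^ ∣ b ∣ * ∑ (colourings n) (G ∘ (a ∷_)))
      ≡⟨ ∑-*ˡ (2 ^ ∣ b ∣) (allFin m) _ ⟩
    2 ^ ∣ b ∣ * ∑ (allFin m) (λ a → ∑ (colourings n) (G ∘ (a ∷_)))
      ≡⟨ cong (2 ^ ∣ b ∣ *_) (∑-vectors-suc (allFin m) n G) ⟨
    2 ^ ∣ b ∣ * ∑ (colourings (suc n)) G ∎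
  ∑-within {suc n} (inside ∷ b) G ig = begin
    ∑ (colourings (suc n)) (λ f → 𝟙 (within? f (inside ∷ b)) * G f) * (m * m ^ ∣ b ∣)
      ≡⟨ cong (_* (m * m ^ ∣ b ∣)) (∑-vectors-suc (allFin m) n _) ⟩
    ∑ (allFin m) (λ a → ∑ (colourings n) (λ f → 𝟙 (within? (a ∷ f) (inside ∷ b)) * G (a ∷ f))) * (m * m ^ ∣ b ∣)
      ≤⟨ *-monoˡ-≤ (m * m ^ ∣ b ∣) (∑-mono (allFin m) first) ⟩
    ∑ (allFin m) (λ a → 𝟙 (a Fin.≟ p) * X + 𝟙 (a Fin.≟ c) * X) * (m * m ^ ∣ b ∣)
      ≡⟨ cong (_* (m * m ^ ∣ b ∣)) (∑-two X X) ⟩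
    (X + X) * (m * m ^ ∣ b ∣)             ≡⟨ lem₁ X m (m ^ ∣ b ∣) ⟩
    2 * m * (X * m ^ ∣ b ∣)               ≤⟨ *-monoʳ-≤ (2 * m) (∑-within b G′ (tail-ignored p ig)) ⟩
    2 * m * (2 ^ ∣ b ∣ * ∑ (colourings n) G′)  ≡⟨ lem₂ m (2 ^ ∣ b ∣) _ ⟩
    2 * 2 ^ ∣ b ∣ * (m * ∑ (colourings n) G′)  ≡⟨ cong (2 * 2 ^ ∣ b ∣ *_) (∑-ignored ig) ⟨
    2 * 2 ^ ∣ b ∣ * ∑ (colourings (suc n)) G   ∎
    where
    G′ : Vec (Fin m) n → ℕ
    G′ = G ∘ (p ∷_)
    X : ℕ
    X = ∑ (colourings n) (λ f → 𝟙 (within? f b) * G′ f)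
    lem₁ : ∀ x y z → (x + x) * (y * z) ≡ 2 * y * (x * z)
    lem₁ = solve-∀
    lem₂ : ∀ x y z → 2 * x * (y * z) ≡ 2 * y * (x * z)
    lem₂ = solve-∀
    weight : ∀ a f → 𝟙 (within? (a ∷ f) (inside ∷ b)) ≤ (𝟙 (a Fin.≟ p) + 𝟙 (a Fin.≟ c)) * 𝟙 (within? f b)
    weight a f = 𝟙≤ (within? (a ∷ f) (inside ∷ b)) λ w → ≤-trans
      ([ (λ e → ≤-trans (≤-reflexive (sym (𝟙-yes (a Fin.≟ p) e))) (m≤m+n _ _))
       , (λ e → ≤-trans (≤-reflexive (sym (𝟙-yes (a Fin.≟ c) e))) (m≤n+m _ (𝟙 (a Fin.≟ p)))) ]′ (w zero here))
      (≤-reflexive (trans (sym (*-identityʳ _)) (cong ((𝟙 (a Fin.≟ p) + 𝟙 (a Fin.≟ c)) *_)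
        (sym (𝟙-yes (within? f b) (tail-within w))))))
    first : ∀ a → ∑ (colourings n) (λ f → 𝟙 (within? (a ∷ f) (inside ∷ b)) * G (a ∷ f))
                  ≤ 𝟙 (a Fin.≟ p) * X + 𝟙 (a Fin.≟ c) * X
    first a = begin
      ∑ (colourings n) (λ f → 𝟙 (within? (a ∷ f) (inside ∷ b)) * G (a ∷ f))
        ≤⟨ ∑-mono (colourings n) (λ f → *-mono-≤ (weight a f) (≤-reflexive (head-ignored ig a f))) ⟩
      ∑ (colourings n) (λ f → (𝟙 (a Fin.≟ p) + 𝟙 (a Fin.≟ c)) * 𝟙 (within? f b) * G′ f)
        ≡⟨ ∑-cong (colourings n) (λ f → *-assoc (𝟙 (a Fin.≟ p) + 𝟙 (a Fin.≟ c)) _ _) ⟩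
      ∑ (colourings n) (λ f → (𝟙 (a Fin.≟ p) + 𝟙 (a Fin.≟ c)) * (𝟙 (within? f b) * G′ f))
        ≡⟨ ∑-*ˡ (𝟙 (a Fin.≟ p) + 𝟙 (a Fin.≟ c)) (colourings n) _ ⟩
      (𝟙 (a Fin.≟ p) + 𝟙 (a Fin.≟ c)) * X ≡⟨ *-distribʳ-+ X (𝟙 (a Fin.≟ p)) _ ⟩
      𝟙 (a Fin.≟ p) * X + 𝟙 (a Fin.≟ c) * X ∎

  -- The summand without an indicator stands for the excluded pattern constantly p and avoids
  -- subtraction. At a vertex of b the induction splits by its colour: after p the rest must still
  -- touch c, after c it need only lie within the two colours.
  ∑-touching : ∀ {n} (b : Subset n) G → IgnoredBy b G →
    ∑ (colourings n) (λ f → 𝟙 (touching? f b) * G f) * m ^ ∣ b ∣ + ∑ (colourings n) G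
      ≤ 2 ^ ∣ b ∣ * ∑ (colourings n) G
  ∑-touching [] G ig = ≤-reflexive (trans
    (cong (λ z → (z * G [] + 0) * 1 + (G [] + 0)) (𝟙-no (touching? [] []) λ { (_ , () , _) }))
    (sym (*-identityˡ (G [] + 0))))
  ∑-touching {suc n} (outside ∷ b) G ig = begin
    ∑ (colourings (suc n)) (λ f → 𝟙 (touching? f (outside ∷ b)) * G f) * m ^ ∣ b ∣ + ∑ (colourings (suc n)) G
      ≡⟨ cong₂ _+_ (cong (_* m ^ ∣ b ∣) (∑-vectors-suc (allFin m) n _)) (∑-vectors-suc (allFin m) n G) ⟩
    ∑ (allFin m) (λ a → ∑ (colourings n) (λ f → 𝟙 (touching? (a ∷ f) (outside ∷ b)) * G (a ∷ f))) * m ^ ∣ b ∣ + total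
      ≤⟨ +-monoˡ-≤ total (*-monoˡ-≤ (m ^ ∣ b ∣) (∑-mono (allFin m) (λ a → ∑-mono (colourings n) (λ f →
           *-monoˡ-≤ (G (a ∷ f)) (𝟙-mono (touching? (a ∷ f) (outside ∷ b)) (touching? f b) tail-touching))))) ⟩
    ∑ (allFin m) (λ a → ∑ (colourings n) (λ f → 𝟙 (touching? f b) * G (a ∷ f))) * m ^ ∣ b ∣ + total
      ≡⟨ cong (_+ total) (∑-*ʳ (m ^ ∣ b ∣) (allFin m) _) ⟨
    ∑ (allFin m) (λ a → ∑ (colourings n) (λ f → 𝟙 (touching? f b) * G (a ∷ f)) * m ^ ∣ b ∣) + total
      ≡⟨ ∑-+ (allFin m) _ _ ⟨
    ∑ (allFin m) (λ a → ∑ (colourings n) (λ f → 𝟙 (touching? f b) * G (a ∷ f)) * m ^ ∣ b ∣ + ∑ (colourings n) (G ∘ (a ∷_)))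
      ≤⟨ ∑-mono (allFin m) (λ a → ∑-touching b (G ∘ (a ∷_)) (tail-ignored a ig)) ⟩
    ∑ (allFin m) (λ a → 2 ^ ∣ b ∣ * ∑ (colourings n) (G ∘ (a ∷_)))
      ≡⟨ ∑-*ˡ (2 ^ ∣ b ∣) (allFin m) _ ⟩
    2 ^ ∣ b ∣ * ∑ (allFin m) (λ a → ∑ (colourings n) (G ∘ (a ∷_)))
      ≡⟨ cong (2 ^ ∣ b ∣ *_) (∑-vectors-suc (allFin m) n G) ⟨
    2 ^ ∣ b ∣ * ∑ (colourings (suc n)) G ∎
    where
    total : ℕ
    total = ∑ (allFin m) (λ a → ∑ (colourings n) (G ∘ (a ∷_)))
    tail-touching : ∀ {a} {f : Vec (Fin m) n} → Touching (a ∷ f) (outside ∷ b) → Touching f b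
    tail-touching (w , suc x , there x∈ , eq) = tail-within w , x , x∈ , eq
  ∑-touching {suc n} (inside ∷ b) G ig = begin
    ∑ (colourings (suc n)) (λ f → 𝟙 (touching? f (inside ∷ b)) * G f) * (m * m ^ ∣ b ∣) + ∑ (colourings (suc n)) G
      ≡⟨ cong₂ _+_ (cong (_* (m * m ^ ∣ b ∣)) (∑-vectors-suc (allFin m) n _)) (∑-ignored ig) ⟩
    ∑ (allFin m) (λ a → ∑ (colourings n) (λ f → 𝟙 (touching? (a ∷ f) (inside ∷ b)) * G (a ∷ f))) * (m * m ^ ∣ b ∣) + m * Z
      ≤⟨ +-monoˡ-≤ (m * Z) (*-monoˡ-≤ (m * m ^ ∣ b ∣) (∑-mono (allFin m) first)) ⟩
    ∑ (allFin m) (λ a → 𝟙 (a Fin.≟ p) * Y + 𝟙 (a Fin.≟ c) * X) * (m * m ^ ∣ b ∣) + m * Z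
      ≡⟨ cong (λ z → z * (m * m ^ ∣ b ∣) + m * Z) (∑-two Y X) ⟩
    (Y + X) * (m * m ^ ∣ b ∣) + m * Z      ≡⟨ lem₁ X Y m (m ^ ∣ b ∣) Z ⟩
    m * (X * m ^ ∣ b ∣ + (Y * m ^ ∣ b ∣ + Z))
      ≤⟨ *-monoʳ-≤ m (+-mono-≤ (∑-within b G′ (tail-ignored p ig)) (∑-touching b G′ (tail-ignored p ig))) ⟩
    m * (2 ^ ∣ b ∣ * Z + 2 ^ ∣ b ∣ * Z)    ≡⟨ lem₂ m (2 ^ ∣ b ∣) Z ⟩
    2 * 2 ^ ∣ b ∣ * (m * Z)                ≡⟨ cong (2 * 2 ^ ∣ b ∣ *_) (∑-ignored ig) ⟨
    2 * 2 ^ ∣ b ∣ * ∑ (colourings (suc n)) G ∎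
    where
    G′ : Vec (Fin m) n → ℕ
    G′ = G ∘ (p ∷_)
    X Y Z : ℕ
    X = ∑ (colourings n) (λ f → 𝟙 (within? f b) * G′ f)
    Y = ∑ (colourings n) (λ f → 𝟙 (touching? f b) * G′ f)
    Z = ∑ (colourings n) G′
    lem₁ : ∀ x y k z w → (y + x) * (k * z) + k * w ≡ k * (x * z + (y * z + w))
    lem₁ = solve-∀
    lem₂ : ∀ k x z → k * (x * z + x * z) ≡ 2 * x * (k * z)
    lem₂ = solve-∀
    one-of : ∀ a f → Touching (a ∷ f) (inside ∷ b) →
             1 ≤ 𝟙 (a Fin.≟ p) * 𝟙 (touching? f b) + 𝟙 (a Fin.≟ c) * 𝟙 (within? f b)
    one-of a f (w , z) with a Fin.≟ c
    ... | yes a≡c = ≤-trans (≤-reflexive (sym (trans (*-identityˡ _) (𝟙-yes (within? f b) (tail-within w)))))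
                      (m≤n+m _ (𝟙 (a Fin.≟ p) * 𝟙 (touching? f b)))
    one-of a f (w , zero , _ , eq)          | no a≢c = contradiction eq a≢c
    one-of a f (w , suc x , there x∈ , eq)  | no a≢c = ≤-trans
      (≤-reflexive (sym (cong₂ _*_ (𝟙-yes (a Fin.≟ p) ([ id , (λ e → contradiction e a≢c) ]′ (w zero here)))
        (𝟙-yes (touching? f b) (tail-within w , x , x∈ , eq)))))
      (m≤m+n _ 0)
    lem₃ : ∀ x y z w g → (x * y + z * w) * g ≡ x * (y * g) + z * (w * g)
    lem₃ = solve-∀
    first : ∀ a → ∑ (colourings n) (λ f → 𝟙 (touching? (a ∷ f) (inside ∷ b)) * G (a ∷ f))
                  ≤ 𝟙 (a Fin.≟ p) * Y + 𝟙 (a Fin.≟ c) * X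
    first a = begin
      ∑ (colourings n) (λ f → 𝟙 (touching? (a ∷ f) (inside ∷ b)) * G (a ∷ f))
        ≤⟨ ∑-mono (colourings n) (λ f → *-mono-≤ (𝟙≤ (touching? (a ∷ f) (inside ∷ b)) (one-of a f))
             (≤-reflexive (head-ignored ig a f))) ⟩
      ∑ (colourings n) (λ f → (𝟙 (a Fin.≟ p) * 𝟙 (touching? f b) + 𝟙 (a Fin.≟ c) * 𝟙 (within? f b)) * G′ f)
        ≡⟨ ∑-cong (colourings n) (λ f → lem₃ (𝟙 (a Fin.≟ p)) (𝟙 (touching? f b)) (𝟙 (a Fin.≟ c)) _ (G′ f)) ⟩
      ∑ (colourings n) (λ f → 𝟙 (a Fin.≟ p) * (𝟙 (touching? f b) * G′ f) + 𝟙 (a Fin.≟ c) * (𝟙 (within? f b) * G′ f))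
        ≡⟨ ∑-+ (colourings n) _ _ ⟩
      ∑ (colourings n) (λ f → 𝟙 (a Fin.≟ p) * (𝟙 (touching? f b) * G′ f))
        + ∑ (colourings n) (λ f → 𝟙 (a Fin.≟ c) * (𝟙 (within? f b) * G′ f))
        ≡⟨ cong₂ _+_ (∑-*ˡ (𝟙 (a Fin.≟ p)) (colourings n) _) (∑-*ˡ (𝟙 (a Fin.≟ c)) (colourings n) _) ⟩
      𝟙 (a Fin.≟ p) * Y + 𝟙 (a Fin.≟ c) * X ∎

-- Rosenfeld's argument for a colouring without bad blocks

∃-difference : ∀ {n} {p q : Subset n} → ∣ p ∣ < ∣ q ∣ → ∃[ x ] x ∈ q × x ∉ p
∃-difference {p = p} {q} lt with any? (λ x → (x ∈? q) ×-dec ¬? (x ∈? p))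
... | yes found = found
... | no ¬found = contradiction (p⊆q⇒∣p∣≤∣q∣ q⊆p) (<⇒≱ lt)
  where
  q⊆p : q ⊆ p
  q⊆p {x} x∈q with x ∈? p
  ... | yes x∈p = x∈p
  ... | no x∉p  = contradiction (x , x∈q , x∉p) ¬found

module Colouring {n M t : ℕ} (bs : List (Subset n)) (size : All (λ b → ∣ b ∣ ≡ suc t) bs) where

  private
    m = suc M
    𝓕 : List (Vec (Fin m) n)
    𝓕 = vectors (allFin m) n

  Bad : Vec (Fin m) n → Subset n → Set
  Bad f b = ∃[ c ] Within (prev c) c f b

  bad? : ∀ f b → Dec (Bad f b)
  bad? f b = any? (λ c → within? (prev c) c f b)

  -- Colourings are always total and S restricts only the blocks considered, so the counts for
  -- different S are taken over one list.
  Good : Subset n → Vec (Fin m) n → Set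
  Good S f = All (λ b → ¬ (b ⊆ S × Bad f b)) bs

  good? : ∀ S f → Dec (Good S f)
  good? S f = All.all? (λ b → ¬? ((b ⊆? S) ×-dec bad? f b)) bs

  #good : Subset n → ℕ
  #good S = ∑ 𝓕 (λ f → 𝟙 (good? S f))

  good-anti : ∀ {P S f} → P ⊆ S → Good S f → Good P f
  good-anti P⊆S = All.map (λ h (b⊆P , bad) → h ((λ x∈ → P⊆S (b⊆P x∈)) , bad))

  block-nonempty : ∀ {b : Subset n} → ∣ b ∣ ≡ suc t → ∃[ x ] x ∈ b
  block-nonempty {b} eq with nonempty? b
  ... | yes ne = ne
  ... | no ¬ne = contradiction (trans (sym eq) (trans (cong ∣_∣ (Empty-unique ¬ne)) (∣⊥∣≡0 n))) λ ()

  -- If c does not occur on b, then b is monochromatic in `prev c` and touches that colour instead.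
  bad⇒touching : ∀ f b → ∣ b ∣ ≡ suc t → Bad f b → ∃[ c ] Touching (prev c) c f b
  bad⇒touching f b eq (c , w) with any? (λ x → (x ∈? b) ×-dec (lookup f x Fin.≟ c))
  ... | yes t = c , w , t
  ... | no ¬t = let x , x∈ = block-nonempty {b} eq in
    prev c , (λ y y∈ → inj₂ (all-prev y y∈)) , x , x∈ , all-prev x x∈
    where
    all-prev : ∀ y → y ∈ b → lookup f y ≡ prev c
    all-prev y y∈ = [ id , (λ e → contradiction (y , y∈ , e) ¬t) ]′ (w y y∈)

  -- Blocks inside `S ─ b` are disjoint from b.
  good-ignores : ∀ c S b → IgnoredBy (prev c) c b (λ f → 𝟙 (good? (S ─ b) f))
  good-ignores c S b f g h = ≤-antisym
    (𝟙-mono (good? (S ─ b) f) (good? (S ─ b) g) (transfer f g h))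
    (𝟙-mono (good? (S ─ b) g) (good? (S ─ b) f) (transfer g f (λ x x∉ → sym (h x x∉))))
    where
    ∉b : ∀ {n x} (S b : Subset n) → x ∈ S ─ b → x ∉ b
    ∉b (s ∷ S) (outside ∷ b) here       ()
    ∉b (s ∷ S) (outside ∷ b) (there x∈) (there x∈b) = ∉b S b x∈ x∈b
    ∉b (s ∷ S) (inside ∷ b)  (there x∈) (there x∈b) = ∉b S b x∈ x∈b
    transfer : ∀ f g → (∀ x → x ∉ b → lookup f x ≡ lookup g x) → Good (S ─ b) f → Good (S ─ b) g
    transfer f g h = All.map λ ¬bad (b′⊆ , d , w) → ¬bad (b′⊆ , d , λ x x∈ →
      ⊎-map (trans (h x (∉b S b (b′⊆ x∈)))) (trans (h x (∉b S b (b′⊆ x∈)))) (w x x∈))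

  open ≤-Reasoning

  -- Being bad on b and being good away from b are independent events, and the former has
  -- probability at most (2 ^ suc t ∸ 1) / m ^ t.
  ∑-bad : ∀ S b → ∣ b ∣ ≡ suc t →
    ∑ 𝓕 (λ f → 𝟙 (bad? f b) * 𝟙 (good? (S ─ b) f)) * m ^ t ≤ (2 ^ suc t ∸ 1) * #good (S ─ b)
  -- The union bound over the m pairs of colours costs a factor m, which cancels one of the t + 1
  -- powers of m.
  ∑-bad S b eq = *-cancelˡ-≤ m (begin
    m * (∑ 𝓕 (λ f → 𝟙 (bad? f b) * G f) * m ^ t)     ≡⟨ lem₁ m (∑ 𝓕 (λ f → 𝟙 (bad? f b) * G f)) (m ^ t) ⟩
    ∑ 𝓕 (λ f → 𝟙 (bad? f b) * G f) * m ^ suc t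
      ≤⟨ *-monoˡ-≤ (m ^ suc t) (∑-mono 𝓕 (λ f → *-monoˡ-≤ (G f) (𝟙≤ (bad? f b) (λ bad →
           let c , τ = bad⇒touching f b eq bad in
           ≤-trans (≤-reflexive (sym (𝟙-yes (touching? (prev c) c f b) τ)))
                   (∑-∈ (λ c → 𝟙 (touching? (prev c) c f b)) (∈-allFin c)))))) ⟩
    ∑ 𝓕 (λ f → ∑ (allFin m) (λ c → 𝟙 (touching? (prev c) c f b)) * G f) * m ^ suc t
      ≡⟨ cong (_* m ^ suc t) (trans (∑-cong 𝓕 (λ f → sym (∑-*ʳ (G f) (allFin m) (λ c → 𝟙 (touching? (prev c) c f b)))))
           (∑-swap 𝓕 (allFin m) (λ f c → 𝟙 (touching? (prev c) c f b) * G f))) ⟩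
    ∑ (allFin m) (λ c → ∑ 𝓕 (λ f → 𝟙 (touching? (prev c) c f b) * G f)) * m ^ suc t
      ≡⟨ ∑-*ʳ (m ^ suc t) (allFin m) (λ c → ∑ 𝓕 (λ f → 𝟙 (touching? (prev c) c f b) * G f)) ⟨
    ∑ (allFin m) (λ c → ∑ 𝓕 (λ f → 𝟙 (touching? (prev c) c f b) * G f) * m ^ suc t)
      ≤⟨ ∑-mono (allFin m) each ⟩
    ∑ (allFin m) (λ _ → (2 ^ suc t ∸ 1) * #good (S ─ b))  ≡⟨ ∑-const ((2 ^ suc t ∸ 1) * #good (S ─ b)) (allFin m) ⟩
    length (allFin m) * ((2 ^ suc t ∸ 1) * #good (S ─ b))
      ≡⟨ cong (_* ((2 ^ suc t ∸ 1) * #good (S ─ b))) (List.length-tabulate {n = m} id) ⟩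
    m * ((2 ^ suc t ∸ 1) * #good (S ─ b)) ∎)
    where
    G : Vec (Fin m) n → ℕ
    G f = 𝟙 (good? (S ─ b) f)
    lem₁ : ∀ x y z → x * (y * z) ≡ y * (x * z)
    lem₁ = solve-∀
    each : ∀ c → ∑ 𝓕 (λ f → 𝟙 (touching? (prev c) c f b) * G f) * m ^ suc t ≤ (2 ^ suc t ∸ 1) * #good (S ─ b)
    each c = ≤-trans (m+n≤o⇒m≤o∸n _ (subst (λ k →
        ∑ 𝓕 (λ f → 𝟙 (touching? (prev c) c f b) * G f) * m ^ k + #good (S ─ b) ≤ 2 ^ k * #good (S ─ b)) eq
        (∑-touching (prev c) c b G (good-ignores c S b))))
      (≤-reflexive (trans (cong (2 ^ suc t * #good (S ─ b) ∸_) (sym (*-identityˡ (#good (S ─ b)))))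
        (sym (*-distribʳ-∸ (#good (S ─ b)) (2 ^ suc t) 1))))

  degree : Fin n → ℕ
  degree v = ∑ bs (λ b → 𝟙 (v ∈? b))

  module _ .{{_ : NonZero t}}
    (sparse : ∀ v → suc t ^ suc t * degree v * (2 ^ suc t ∸ 1) ≤ t ^ t * m ^ t) where

    module Step {R : Subset n} {v} (v∉R : v ∉ R)
      (ih : ∀ P j → P ⊆ R → ∣ R ∣ ≡ j + ∣ P ∣ → t ^ j * #good P ≤ suc t ^ j * #good R) where

      R′ : Subset n
      R′ = R [ v ]≔ inside

      #hit : Subset n → ℕ
      #hit b = ∑ 𝓕 (λ f → 𝟙 (bad? f b) * 𝟙 (good? (R ─ b) f))

      #lost : ℕ
      #lost = ∑ bs (λ b → 𝟙 (v ∈? b) * #hit b)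

      -- A colouring that is good on R but not on R′ has a bad block b through v. Goodness is
      -- weakened from R to `R ─ b` to make it independent of the colours on b.
      lost : ∀ f → 𝟙 (good? R f) ≤ 𝟙 (good? R′ f) + ∑ bs (λ b → 𝟙 (v ∈? b) * (𝟙 (bad? f b) * 𝟙 (good? (R ─ b) f)))
      lost f = 𝟙≤ (good? R f) gain
        where
        gain : Good R f → 1 ≤ 𝟙 (good? R′ f) + ∑ bs (λ b → 𝟙 (v ∈? b) * (𝟙 (bad? f b) * 𝟙 (good? (R ─ b) f)))
        gain good with good? R′ f
        ... | yes _ = s≤s z≤n
        ... | no ¬good with find (All.¬All⇒Any¬ (λ b → ¬? ((b ⊆? R′) ×-dec bad? f b)) bs ¬good)
        ...   | b , b∈ , ¬¬bad with decidable-stable ((b ⊆? R′) ×-dec bad? f b) ¬¬bad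
        ...     | b⊆R′ , bad = ≤-trans (≤-reflexive (sym (cong₂ _*_ (𝟙-yes (v ∈? b) v∈b)
            (cong₂ _*_ (𝟙-yes (bad? f b) bad) (𝟙-yes (good? (R ─ b) f) (good-anti {f = f} (p─q⊆p R b) good))))))
            (∑-∈ (λ b → 𝟙 (v ∈? b) * (𝟙 (bad? f b) * 𝟙 (good? (R ─ b) f))) b∈)
          where
          v∈b : v ∈ b
          v∈b with v ∈? b
          ... | yes v∈ = v∈
          ... | no v∉b = ⊥-elim (All.lookup good b∈ (b⊆R , bad))
            where
            b⊆R : b ⊆ R
            b⊆R x∈ = ∈-insert⁻ (b⊆R′ x∈) (λ { refl → v∉b x∈ })

      #good≤ : #good R ≤ #good R′ + #lost
      #good≤ = begin
        #good R   ≤⟨ ∑-mono 𝓕 lost ⟩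
        ∑ 𝓕 (λ f → 𝟙 (good? R′ f) + ∑ bs (λ b → 𝟙 (v ∈? b) * (𝟙 (bad? f b) * 𝟙 (good? (R ─ b) f))))
          ≡⟨ ∑-+ 𝓕 _ _ ⟩
        #good R′ + ∑ 𝓕 (λ f → ∑ bs (λ b → 𝟙 (v ∈? b) * (𝟙 (bad? f b) * 𝟙 (good? (R ─ b) f))))
          ≡⟨ cong (#good R′ +_) (trans (∑-swap 𝓕 bs _) (∑-cong bs (λ b → ∑-*ˡ (𝟙 (v ∈? b)) 𝓕 _))) ⟩
        #good R′ + #lost ∎

      -- As b contains v, which is not in R, at most t vertices of R are deleted in `R ─ b`. By `ih`
      -- each deletion increases the number of good colourings by a factor of at most (t + 1) / t.
      #hit≤ : ∀ b → b ∈ˡ bs → v ∈ b → #hit b * (m ^ t * t ^ t) ≤ (2 ^ suc t ∸ 1) * (suc t ^ t * #good R)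
      #hit≤ b b∈ v∈b = begin
        #hit b * (m ^ t * t ^ t)                   ≡⟨ *-assoc (#hit b) (m ^ t) (t ^ t) ⟨
        #hit b * m ^ t * t ^ t                     ≤⟨ *-monoˡ-≤ (t ^ t) (∑-bad R b (All.lookup size b∈)) ⟩
        (2 ^ suc t ∸ 1) * #good (R ─ b) * t ^ t    ≡⟨ lem (2 ^ suc t ∸ 1) (#good (R ─ b)) (t ^ t) ⟩
        (2 ^ suc t ∸ 1) * (t ^ t * #good (R ─ b))  ≤⟨ *-monoʳ-≤ (2 ^ suc t ∸ 1) power ⟩
        (2 ^ suc t ∸ 1) * (suc t ^ t * #good R)    ∎
        where
        lem : ∀ x y z → x * y * z ≡ x * (z * y)
        lem = solve-∀
        j r : ℕ
        j = ∣ R ∩ b ∣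
        j≤t : j ≤ t
        j≤t = s≤s⁻¹ (subst (j <_) (All.lookup size b∈)
          (p⊂q⇒∣p∣<∣q∣ (p∩q⊆q R b , v , v∈b , (λ v∈ → v∉R (proj₁ (x∈p∩q⁻ R b v∈))))))
        r = t ∸ j
        split : ∀ x → x ^ t ≡ x ^ r * x ^ j
        split x = trans (cong (x ^_) (sym (m∸n+n≡m j≤t))) (^-distribˡ-+-* x r j)
        power : t ^ t * #good (R ─ b) ≤ suc t ^ t * #good R
        power = begin
          t ^ t * #good (R ─ b)                 ≡⟨ trans (cong (_* #good (R ─ b)) (split t)) (*-assoc (t ^ r) (t ^ j) _) ⟩
          -- When b meets R in only j < t vertices, the bound is padded to the exponent t with t ≤ t
          -- + 1.
          t ^ r * (t ^ j * #good (R ─ b))       ≤⟨ *-mono-≤ (^-monoˡ-≤ r (n≤1+n t)) (ih (R ─ b) j (p─q⊆p R b) (∣p∣≡∣p∩q∣+∣p─q∣ R b)) ⟩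
          suc t ^ r * (suc t ^ j * #good R)     ≡⟨ trans (cong (_* #good R) (split (suc t))) (*-assoc (suc t ^ r) (suc t ^ j) _) ⟨
          suc t ^ t * #good R ∎

      -- `sparse` is exactly the condition under which the losses of all blocks through v add up to
      -- at most the fraction 1 / (t + 1).
      #lost≤ : suc t * #lost ≤ #good R
      #lost≤ = *-cancelʳ-≤ _ _ (m ^ t * t ^ t) {{m*n≢0 _ _ {{m^n≢0 m t}} {{m^n≢0 t t}}}} (begin
        suc t * #lost * (m ^ t * t ^ t)              ≡⟨ *-assoc (suc t) #lost _ ⟩
        suc t * (#lost * (m ^ t * t ^ t))            ≡⟨ cong (suc t *_) (∑-*ʳ (m ^ t * t ^ t) bs _) ⟨
        suc t * ∑ bs (λ b → 𝟙 (v ∈? b) * #hit b * (m ^ t * t ^ t))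
          ≤⟨ *-monoʳ-≤ (suc t) (∑-mono-∈ bs each) ⟩
        suc t * ∑ bs (λ b → 𝟙 (v ∈? b) * ((2 ^ suc t ∸ 1) * (suc t ^ t * #good R)))
          ≡⟨ cong (suc t *_) (∑-*ʳ ((2 ^ suc t ∸ 1) * (suc t ^ t * #good R)) bs _) ⟩
        suc t * (degree v * ((2 ^ suc t ∸ 1) * (suc t ^ t * #good R)))
          ≡⟨ lem (suc t) (degree v) (2 ^ suc t ∸ 1) (suc t ^ t) (#good R) ⟩
        suc t ^ suc t * degree v * (2 ^ suc t ∸ 1) * #good R
          ≤⟨ *-monoˡ-≤ (#good R) (sparse v) ⟩
        t ^ t * m ^ t * #good R                      ≡⟨ lem₂ (t ^ t) (m ^ t) (#good R) ⟩
        #good R * (m ^ t * t ^ t)                    ∎)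
        where
        lem : ∀ a d w x g → a * (d * (w * (x * g))) ≡ a * x * d * w * g
        lem = solve-∀
        lem₂ : ∀ a b c → a * b * c ≡ c * (b * a)
        lem₂ = solve-∀
        each : ∀ b → b ∈ˡ bs → 𝟙 (v ∈? b) * #hit b * (m ^ t * t ^ t) ≤ 𝟙 (v ∈? b) * ((2 ^ suc t ∸ 1) * (suc t ^ t * #good R))
        each b b∈ with v ∈? b
        ... | no _    = z≤n
        ... | yes v∈b = ≤-trans (≤-reflexive (cong (_* (m ^ t * t ^ t)) (*-identityˡ (#hit b))))
          (≤-trans (#hit≤ b b∈ v∈b) (≤-reflexive (sym (*-identityˡ _))))

      step : t * #good R ≤ suc t * #good R′
      step = +-cancelˡ-≤ (#good R) _ _ (begin
        suc t * #good R                     ≤⟨ *-monoʳ-≤ (suc t) #good≤ ⟩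
        suc t * (#good R′ + #lost)          ≡⟨ *-distribˡ-+ (suc t) (#good R′) #lost ⟩
        suc t * #good R′ + suc t * #lost    ≤⟨ +-monoʳ-≤ (suc t * #good R′) #lost≤ ⟩
        suc t * #good R′ + #good R          ≡⟨ +-comm (suc t * #good R′) (#good R) ⟩
        #good R + suc t * #good R′          ∎)

    -- Rosenfeld's counting argument: each new vertex keeps at least the fraction t / suc t of
    -- the good colourings.
    #good-ratio : ∀ s R j S → R ⊆ S → ∣ S ∣ ≤ s → ∣ S ∣ ≡ j + ∣ R ∣ → t ^ j * #good R ≤ suc t ^ j * #good S
    #good-ratio s R zero S R⊆S ≤s eq = *-monoʳ-≤ 1 (∑-mono 𝓕 (λ f → 𝟙-mono (good? R f) (good? S f) (good-anti {f = f} S⊆R)))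
      where
      S⊆R : S ⊆ R
      S⊆R {x} x∈S with x ∈? R
      ... | yes x∈R = x∈R
      ... | no x∉R = contradiction eq (>⇒≢ (p⊂q⇒∣p∣<∣q∣ (R⊆S , x , x∈S , x∉R)))
    #good-ratio zero R (suc j) S R⊆S ≤s eq = contradiction (subst (_≤ 0) eq ≤s) λ ()
    #good-ratio (suc s) R (suc j) S R⊆S ≤s eq = begin
      t * t ^ j * #good R                        ≡⟨ lem t (t ^ j) (#good R) ⟩
      -- `s` bounds the size of S. As R is a proper subset of S, induction on `s` gives the ratio
      -- between R and every P ⊆ R, while induction on `j` adds the remaining vertices of S.
      t ^ j * (t * #good R)                      ≤⟨ *-monoʳ-≤ (t ^ j) (Step.step v∉R (λ P i P⊆R →
                                                      #good-ratio s P i R P⊆R (s≤s⁻¹ (≤-trans ∣R∣<∣S∣ ≤s)))) ⟩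
      t ^ j * (suc t * #good (R [ v ]≔ inside))  ≡⟨ lem₂ (t ^ j) (suc t) (#good (R [ v ]≔ inside)) ⟩
      suc t * (t ^ j * #good (R [ v ]≔ inside))  ≤⟨ *-monoʳ-≤ (suc t) (#good-ratio (suc s) (R [ v ]≔ inside) j S (insert-⊆ R⊆S v∈S) ≤s
                                                      (trans eq (trans (sym (+-suc j ∣ R ∣)) (cong (j +_) (sym (∣insert∣ R v v∉R)))))) ⟩
      suc t * (suc t ^ j * #good S)              ≡⟨ *-assoc (suc t) (suc t ^ j) (#good S) ⟨
      suc t * suc t ^ j * #good S                ∎
      where
      new : ∃[ x ] x ∈ S × x ∉ R
      new = ∃-difference (subst (∣ R ∣ <_) (sym eq) (s≤s (m≤n+m ∣ R ∣ j)))
      v : Fin n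
      v = proj₁ new
      v∈S : v ∈ S
      v∈S = proj₁ (proj₂ new)
      v∉R : v ∉ R
      v∉R = proj₂ (proj₂ new)
      ∣R∣<∣S∣ : ∣ R ∣ < ∣ S ∣
      ∣R∣<∣S∣ = p⊂q⇒∣p∣<∣q∣ (R⊆S , v , v∈S , v∉R)
      lem : ∀ a b c → a * b * c ≡ b * (a * c)
      lem = solve-∀
      lem₂ : ∀ a b c → a * (b * c) ≡ b * (a * c)
      lem₂ = solve-∀

    good-colouring : ∃[ f ] (∀ b → b ∈ˡ bs → ¬ Bad f b)
    good-colouring with ∑-positive 𝓕 {λ f → 𝟙 (good? ⊤ f)} (*-cancelˡ-< (suc t ^ n) 0 (#good ⊤) (begin-strict
      suc t ^ n * 0         ≡⟨ *-zeroʳ (suc t ^ n) ⟩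
      0                     <⟨ n≢0⇒n>0 (λ e → ≢-nonZero⁻¹ _ {{m*n≢0 (t ^ n) (#good ⊥) {{m^n≢0 t n}} {{>-nonZero some}}}} e) ⟩
      t ^ n * #good ⊥       ≤⟨ #good-ratio n ⊥ n ⊤ (⊆-max ⊥) (∣p∣≤n ⊤)
                                 (trans (∣⊤∣≡n n) (sym (trans (cong (n +_) (∣⊥∣≡0 n)) (+-identityʳ n)))) ⟩
      suc t ^ n * #good ⊤   ∎))
      where
      some : 0 < #good ⊥
      -- Blocks are nonempty, so none lies inside `⊥` and any colouring is good there, for instance
      -- the constant one.
      some = ≤-trans (≤-reflexive (sym (𝟙-yes (good? ⊥ (replicate n zero)) (All.map
               (λ {b} eq (b⊆⊥ , _) → ∉⊥ (b⊆⊥ (proj₂ (block-nonempty {b} eq)))) size))))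
             (∑-∈ (λ f → 𝟙 (good? ⊥ f)) (∈-vectors ∈-allFin (replicate n zero)))
    ... | f , _ , pos = f , λ b b∈ bad → All.lookup (𝟙-positive (good? ⊤ f) pos) b∈ (⊆-max b , bad)

-- Classes as lists: concatenation, end segments and interiors

next : ∀ {m} → Fin m → Fin m
next {suc m} i with view i
... | ‵fromℕ     = zero
... | ‵inject₁ j = suc j

next-prev : ∀ {m} (c : Fin m) → next (prev c) ≡ c
next-prev {suc m} zero    rewrite view-fromℕ m   = refl
next-prev {suc m} (suc c) rewrite view-inject₁ c = refl

prev-next : ∀ {m} (c : Fin m) → prev (next c) ≡ c
prev-next {suc m} c with view c
... | ‵fromℕ     = refl
... | ‵inject₁ j = refl

module _ {A : Set} where

  ∑-take : ∀ k (xs : List A) f → ∑ (take k xs) f ≤ ∑ xs f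
  ∑-take zero    xs       f = z≤n
  ∑-take (suc k) []       f = z≤n
  ∑-take (suc k) (x ∷ xs) f = +-monoʳ-≤ (f x) (∑-take k xs f)

  ∑-drop : ∀ k (xs : List A) f → ∑ (drop k xs) f ≤ ∑ xs f
  ∑-drop zero    xs       f = ≤-refl
  ∑-drop (suc k) []       f = z≤n
  ∑-drop (suc k) (x ∷ xs) f = ≤-trans (∑-drop k xs f) (m≤n+m (∑ xs f) (f x))

  ∑-mono-gap : ∀ (xs : List A) {f g} → (∀ x → f x ≤ g x) → ∀ {y a} → y ∈ˡ xs → f y + a ≤ g y →
               ∑ xs f + a ≤ ∑ xs g
  ∑-mono-gap (x ∷ xs) {f} {g} h {a = a} (here refl) gap = ≤-trans
    (≤-reflexive (lem (f x) (∑ xs f) a)) (+-mono-≤ gap (∑-mono xs h))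
    where
    lem : ∀ p q r → p + q + r ≡ p + r + q
    lem = solve-∀
  ∑-mono-gap (x ∷ xs) {f} {g} h {a = a} (there y∈) gap = ≤-trans
    (≤-reflexive (+-assoc (f x) (∑ xs f) a)) (+-mono-≤ (h x) (∑-mono-gap xs h y∈ gap))

  flatten : ∀ {m} → (Fin m → List A) → List A
  flatten L = concat (tabulate L)

  ∑-flatten : ∀ {m} (L : Fin m → List A) f → ∑ (flatten L) f ≡ ∑ (allFin m) (λ c → ∑ (L c) f)
  ∑-flatten {zero}  L f = refl
  ∑-flatten {suc m} L f = trans (∑-++ (L zero) (flatten (L ∘ suc)) f)
    (trans (cong (∑ (L zero) f +_) (∑-flatten (L ∘ suc) f)) (sym (∑-allFin-suc m (λ c → ∑ (L c) f))))

  flatten-cong : ∀ {m} {L L′ : Fin m → List A} → (∀ c → L c ≡ L′ c) → flatten L ≡ flatten L′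
  flatten-cong h = cong concat (List.tabulate-cong h)

  flatten-insert : ∀ {m} {L L′ : Fin m → List A} {x} c → L′ c ↭ x ∷ L c → (∀ d → d ≢ c → L′ d ≡ L d) →
                   flatten L′ ↭ x ∷ flatten L
  flatten-insert {suc m} {L} {L′} {x} zero here↭ same = ↭-trans (++⁺ʳ (flatten (L′ ∘ suc)) here↭)
    (prep x (↭-reflexive (cong (L zero ++_) (flatten-cong (λ d → same (suc d) λ ())))))
  flatten-insert {suc m} {L} {L′} {x} (suc c) there↭ same = ↭-trans
    (↭-reflexive (cong (_++ flatten (L′ ∘ suc)) (same zero λ ())))
    (↭-trans (++⁺ˡ (L zero) (flatten-insert c there↭ (λ d d≢c → same (suc d) (d≢c ∘ Fin.suc-injective))))
             (shift x (L zero) (flatten (L ∘ suc))))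

module _ {A : Set} (ℓ : ℕ) where

  -- Truncated subtraction covers short lists: up to ℓ entries both ends are the whole list, and up
  -- to 2 ℓ entries the middle is empty.
  first last middle : List A → List A
  first  xs = take ℓ xs
  last   xs = drop (length xs ∸ ℓ) xs
  middle xs = take (length xs ∸ ℓ ∸ ℓ) (drop ℓ xs)

  ∈-take : ∀ {x} k (xs : List A) → x ∈ˡ take k xs → x ∈ˡ xs
  ∈-take k xs x∈ = subst (_ ∈ˡ_) (List.take++drop≡id k xs) (∈-++⁺ˡ x∈)

  ∈-drop : ∀ {x} k (xs : List A) → x ∈ˡ drop k xs → x ∈ˡ xs
  ∈-drop k xs x∈ = subst (_ ∈ˡ_) (List.take++drop≡id k xs) (∈-++⁺ʳ (take k xs) x∈)

  length-first : ∀ xs → length (first xs) ≤ ℓ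
  length-first xs = ≤-trans (≤-reflexive (List.length-take ℓ xs)) (m⊓n≤m ℓ (length xs))

  length-last : ∀ xs → length (last xs) ≤ ℓ
  length-last xs = ≤-trans (≤-reflexive (List.length-drop (length xs ∸ ℓ) xs))
    (m≤n+o⇒m∸n≤o (length xs) (length xs ∸ ℓ) (≤-trans (m≤n+m∸n (length xs) ℓ) (≤-reflexive (+-comm ℓ _))))

  first-short : ∀ {xs} → length xs ≤ ℓ → first xs ≡ xs
  first-short {xs} le = List.take-all ℓ xs le

  last-short : ∀ {xs} → length xs ≤ ℓ → last xs ≡ xs
  last-short {xs} le = cong (λ k → drop k xs) (m≤n⇒m∸n≡0 le)

  length-middle : ∀ xs → length (middle xs) ≡ length xs ∸ ℓ ∸ ℓ
  length-middle xs = trans (List.length-take (length xs ∸ ℓ ∸ ℓ) (drop ℓ xs))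
    (m≤n⇒m⊓n≡m (≤-trans (m∸n≤m (length xs ∸ ℓ) ℓ) (≤-reflexive (sym (List.length-drop ℓ xs)))))

  ∑-middle : ∀ xs f → ∑ (middle xs) f ≤ ∑ xs f
  ∑-middle xs f = ≤-trans (∑-take (length xs ∸ ℓ ∸ ℓ) (drop ℓ xs) f) (∑-drop ℓ xs f)

  -- This makes the removal of x harmless: neither end segment changes and at least 2 ℓ entries
  -- remain.
  middle-split : ∀ {x} xs → x ∈ˡ middle xs →
    ∃[ ys ] ∃[ zs ] xs ≡ ys ++ x ∷ zs × ℓ ≤ length ys × ℓ ≤ length zs
  middle-split {x} xs x∈ with ∈-∃++ x∈
  ... | us , vs , eq = take ℓ xs ++ us , vs ++ rest , split , long , long′
    where
    k : ℕ
    k = length xs ∸ ℓ ∸ ℓ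
    rest : List A
    rest = drop k (drop ℓ xs)
    split : xs ≡ (take ℓ xs ++ us) ++ x ∷ vs ++ rest
    split = begin
      xs                                      ≡⟨ List.take++drop≡id ℓ xs ⟨
      take ℓ xs ++ drop ℓ xs                  ≡⟨ cong (take ℓ xs ++_) (List.take++drop≡id k (drop ℓ xs)) ⟨
      take ℓ xs ++ middle xs ++ rest          ≡⟨ cong (λ z → take ℓ xs ++ z ++ rest) eq ⟩
      take ℓ xs ++ (us ++ x ∷ vs) ++ rest     ≡⟨ cong (take ℓ xs ++_) (List.++-assoc us (x ∷ vs) rest) ⟩
      take ℓ xs ++ us ++ x ∷ vs ++ rest       ≡⟨ List.++-assoc (take ℓ xs) us _ ⟨
      (take ℓ xs ++ us) ++ x ∷ vs ++ rest     ∎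
      where open ≡-Reasoning
    -- The middle contains x, so `k` is positive and neither subtraction in it was cut off at 0.
    nonempty : 0 < k
    nonempty = subst (0 <_) (length-middle xs) (subst (λ z → 0 < length z) (sym eq)
      (subst (0 <_) (sym (List.length-++ us)) (<-≤-trans z<s (m≤n+m (suc (length vs)) (length us)))))
    ℓ<∸ : ℓ < length xs ∸ ℓ
    ℓ<∸ = m∸n≢0⇒n<m (λ e → <-irrefl (sym e) nonempty)
    ℓ≤ : ℓ ≤ length xs
    ℓ≤ = ≤-trans (<⇒≤ ℓ<∸) (m∸n≤m (length xs) ℓ)
    long : ℓ ≤ length (take ℓ xs ++ us)
    long = ≤-trans (≤-reflexive (sym (trans (List.length-take ℓ xs) (m≤n⇒m⊓n≡m ℓ≤))))
      (≤-trans (m≤m+n _ (length us)) (≤-reflexive (sym (List.length-++ (take ℓ xs)))))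
    long′ : ℓ ≤ length (vs ++ rest)
    long′ = ≤-trans (≤-reflexive (sym (trans (List.length-drop k (drop ℓ xs))
      (trans (cong (_∸ k) (List.length-drop ℓ xs)) (m∸[m∸n]≡n (<⇒≤ ℓ<∸))))))
      (≤-trans (m≤n+m _ (length vs)) (≤-reflexive (sym (List.length-++ vs))))

  ∈-first-delete : ∀ {x y} ys zs → ℓ ≤ length ys → y ∈ˡ first (ys ++ zs) → y ∈ˡ first (ys ++ x ∷ zs)
  ∈-first-delete {x} {y} ys zs le y∈ = subst (y ∈ˡ_) (trans (take-++ ys zs le) (sym (take-++ ys (x ∷ zs) le))) y∈
    where
    take-++ : ∀ {k} (ys zs : List A) → k ≤ length ys → take k (ys ++ zs) ≡ take k ys
    take-++ {zero}  ys       zs le       = refl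
    take-++ {suc k} (y ∷ ys) zs (s≤s le) = cong (y ∷_) (take-++ ys zs le)

  ∈-last-delete : ∀ {x y} ys zs → ℓ ≤ length zs → y ∈ˡ last (ys ++ zs) → y ∈ˡ last (ys ++ x ∷ zs)
  ∈-last-delete {x} {y} ys zs le y∈ = subst (y ∈ˡ_) (trans (last-++ ys zs le)
    (trans (sym (last-∷ zs le)) (sym (last-++ ys (x ∷ zs) (≤-trans le (n≤1+n _)))))) y∈
    where
    last-∷ : ∀ {x} zs → ℓ ≤ length zs → last (x ∷ zs) ≡ last zs
    last-∷ {x} zs le = cong (λ k → drop k (x ∷ zs)) (+-∸-assoc 1 le)
    last-++ : ∀ ys zs → ℓ ≤ length zs → last (ys ++ zs) ≡ last zs
    last-++ []       zs le = refl
    last-++ (y ∷ ys) zs le = trans (last-∷ (ys ++ zs) (≤-trans le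
      (≤-trans (m≤n+m _ (length ys)) (≤-reflexive (sym (List.length-++ ys)))))) (last-++ ys zs le)

∣insert∣≤ : ∀ {n} (p : Subset n) x → ∣ p [ x ]≔ inside ∣ ≤ suc ∣ p ∣
∣insert∣≤ p x with x ∈? p
... | no x∉p = ≤-reflexive (∣insert∣ p x x∉p)
... | yes x∈p = ≤-trans (p⊆q⇒∣p∣≤∣q∣ (insert-⊆ (⊆-refl {x = p}) x∈p)) (n≤1+n ∣ p ∣)

insert-⊇ : ∀ {n} (p : Subset n) x → p ⊆ p [ x ]≔ inside
insert-⊇ (_ ∷ p) zero    here       = here
insert-⊇ (_ ∷ p) zero    (there y∈) = there y∈
insert-⊇ (_ ∷ p) (suc x) here       = here
insert-⊇ (_ ∷ p) (suc x) (there y∈) = there (insert-⊇ p x y∈)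

toSubset : ∀ {n} → List (Fin n) → Subset n
toSubset = foldr (λ x p → p [ x ]≔ inside) ⊥

∈-toSubset⁺ : ∀ {n} {x : Fin n} {xs} → x ∈ˡ xs → x ∈ toSubset xs
∈-toSubset⁺ {x = x} {_ ∷ xs} (here refl) = ∈-insert (toSubset xs) x
∈-toSubset⁺ {xs = y ∷ xs} (there x∈)  = insert-⊇ (toSubset xs) y (∈-toSubset⁺ x∈)

∈-toSubset⁻ : ∀ {n} {x : Fin n} xs → x ∈ toSubset xs → x ∈ˡ xs
∈-toSubset⁻ [] x∈ = contradiction x∈ ∉⊥
∈-toSubset⁻ {x = x} (y ∷ xs) x∈ with x Fin.≟ y
... | yes x≡y = here x≡y
... | no x≢y  = there (∈-toSubset⁻ xs (∈-insert⁻ x∈ x≢y))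

∣toSubset-++∣ : ∀ {n} (xs ys : List (Fin n)) → ∣ toSubset (xs ++ ys) ∣ ≤ length xs + ∣ toSubset ys ∣
∣toSubset-++∣ []       ys = ≤-refl
∣toSubset-++∣ (x ∷ xs) ys = ≤-trans (∣insert∣≤ (toSubset (xs ++ ys)) x) (s≤s (∣toSubset-++∣ xs ys))

∣toSubset∣ : ∀ {n} (xs : List (Fin n)) → ∣ toSubset xs ∣ ≤ length xs
∣toSubset∣ {n} []       = ≤-reflexive (∣⊥∣≡0 n)
∣toSubset∣ (x ∷ xs) = ≤-trans (∣insert∣≤ (toSubset xs) x) (s≤s (∣toSubset∣ xs))

-- Counting vertices that complete a block

module Blocking {n t μ : ℕ} (bs : List (Subset n)) (size : All (λ b → ∣ b ∣ ≡ suc t) bs)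
  (covered : ∀ T → ∣ T ∣ ≡ t → codegree bs T ≤ μ) where

  open ≤-Reasoning

  Completes : Subset n → Subset n → Fin n → Set
  Completes Q Q′ x = Any (λ b → b ⊆ Q [ x ]≔ inside ⊎ b ⊆ Q′ [ x ]≔ inside) bs

  completes? : ∀ Q Q′ x → Dec (Completes Q Q′ x)
  completes? Q Q′ x = Any.any? (λ b → (b ⊆? (Q [ x ]≔ inside)) ⊎-dec (b ⊆? (Q′ [ x ]≔ inside))) bs

  in-either : Subset n → Subset n → Subset n → ℕ
  in-either Q Q′ T = 𝟙 (∣ T ∣ ≟ t) * 𝟙 ((T ⊆? Q) ⊎-dec (T ⊆? Q′))

  #in-either : Subset n → Subset n → ℕ
  #in-either Q Q′ = ∑ (subsets n) (in-either Q Q′)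

  -- Inclusion-exclusion: the t-subsets of B are counted twice on the right. Keeping this overlap is
  -- what later saves the term ℓ ^ t.
  #in-either-bound : ∀ {Q Q′ B q} → B ⊆ Q → B ⊆ Q′ → ∣ Q ∣ ≤ q → ∣ Q′ ∣ ≤ q →
    #in-either Q Q′ + ∣ B ∣ C t ≤ 2 * (q C t)
  #in-either-bound {Q} {Q′} {B} {q} B⊆Q B⊆Q′ ∣Q∣≤ ∣Q′∣≤ = begin
    #in-either Q Q′ + ∣ B ∣ C t
      ≡⟨ cong (#in-either Q Q′ +_) (count-subsets B t) ⟨
    #in-either Q Q′ + ∑ (subsets n) (λ T → 𝟙 (T ⊆? B) * 𝟙 (∣ T ∣ ≟ t))
      ≡⟨ ∑-+ (subsets n) (in-either Q Q′) (λ T → 𝟙 (T ⊆? B) * 𝟙 (∣ T ∣ ≟ t)) ⟨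
    ∑ (subsets n) (λ T → in-either Q Q′ T + 𝟙 (T ⊆? B) * 𝟙 (∣ T ∣ ≟ t))
      ≤⟨ ∑-mono (subsets n) pointwise ⟩
    ∑ (subsets n) (λ T → 𝟙 (T ⊆? Q) * 𝟙 (∣ T ∣ ≟ t) + 𝟙 (T ⊆? Q′) * 𝟙 (∣ T ∣ ≟ t))
      ≡⟨ ∑-+ (subsets n) (λ T → 𝟙 (T ⊆? Q) * 𝟙 (∣ T ∣ ≟ t)) (λ T → 𝟙 (T ⊆? Q′) * 𝟙 (∣ T ∣ ≟ t)) ⟩
    ∑ (subsets n) (λ T → 𝟙 (T ⊆? Q) * 𝟙 (∣ T ∣ ≟ t)) + ∑ (subsets n) (λ T → 𝟙 (T ⊆? Q′) * 𝟙 (∣ T ∣ ≟ t))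
      ≡⟨ cong₂ _+_ (count-subsets Q t) (count-subsets Q′ t) ⟩
    ∣ Q ∣ C t + ∣ Q′ ∣ C t   ≤⟨ +-mono-≤ (C-mono t ∣Q∣≤) (C-mono t ∣Q′∣≤) ⟩
    q C t + q C t            ≡⟨ cong (q C t +_) (+-identityʳ (q C t)) ⟨
    2 * (q C t)              ∎
    where
    lem : ∀ d e a b → d * e + b * d ≡ (e + b) * d
    lem = solve-∀
    pointwise : ∀ T → in-either Q Q′ T + 𝟙 (T ⊆? B) * 𝟙 (∣ T ∣ ≟ t)
                ≤ 𝟙 (T ⊆? Q) * 𝟙 (∣ T ∣ ≟ t) + 𝟙 (T ⊆? Q′) * 𝟙 (∣ T ∣ ≟ t)
    pointwise T = ≤-trans
      (≤-reflexive (lem (𝟙 (∣ T ∣ ≟ t)) (𝟙 ((T ⊆? Q) ⊎-dec (T ⊆? Q′))) 0 (𝟙 (T ⊆? B))))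
      (≤-trans (*-monoˡ-≤ (𝟙 (∣ T ∣ ≟ t)) indicators)
        (≤-reflexive (*-distribʳ-+ (𝟙 (∣ T ∣ ≟ t)) (𝟙 (T ⊆? Q)) (𝟙 (T ⊆? Q′)))))
      where
      indicators : 𝟙 ((T ⊆? Q) ⊎-dec (T ⊆? Q′)) + 𝟙 (T ⊆? B) ≤ 𝟙 (T ⊆? Q) + 𝟙 (T ⊆? Q′)
      indicators with T ⊆? Q | T ⊆? Q′
      ... | yes _ | yes _ = s≤s (𝟙≤1 (T ⊆? B))
      ... | yes _ | no ¬q = s≤s (≤-reflexive (𝟙-no (T ⊆? B) (λ T⊆B → ¬q (⊆-trans T⊆B B⊆Q′))))
      ... | no ¬q | yes _ = s≤s (≤-reflexive (𝟙-no (T ⊆? B) (λ T⊆B → ¬q (⊆-trans T⊆B B⊆Q))))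
      ... | no ¬q | no _  = ≤-reflexive (𝟙-no (T ⊆? B) (λ T⊆B → ¬q (⊆-trans T⊆B B⊆Q)))

  private
    extends : Subset n → Subset n → Fin n → ℕ
    extends T b x = 𝟙 (T ⊆? b) * (𝟙 (x ∈? b) * (1 ∸ 𝟙 (x ∈? T)))

    ∣delete∣ : ∀ {n} (p : Subset n) x → x ∈ p → suc ∣ p [ x ]≔ outside ∣ ≡ ∣ p ∣
    ∣delete∣ (inside ∷ p)  zero    here       = refl
    ∣delete∣ (inside ∷ p)  (suc x) (there x∈) = cong suc (∣delete∣ p x x∈)
    ∣delete∣ (outside ∷ p) (suc x) (there x∈) = ∣delete∣ p x x∈

    ∈-delete⁻ : ∀ {n} (p : Subset n) {x y} → y ∈ p [ x ]≔ outside → y ∈ p × y ≢ x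
    ∈-delete⁻ (_ ∷ p) {zero}  (there y∈) = there y∈ , λ ()
    ∈-delete⁻ (_ ∷ p) {suc x} here       = here , λ ()
    ∈-delete⁻ (_ ∷ p) {suc x} (there y∈) = let y∈p , y≢x = ∈-delete⁻ p y∈ in there y∈p , y≢x ∘ Fin.suc-injective

  -- Deleting the completing vertex from a completed block leaves a t-subset of Q or Q′.
  #completing : ∀ Q Q′ → (∀ b → b ∈ˡ bs → ¬ b ⊆ Q) → (∀ b → b ∈ˡ bs → ¬ b ⊆ Q′) →
    ∑ (allFin n) (λ x → 𝟙 (completes? Q Q′ x)) ≤ μ * #in-either Q Q′
  #completing Q Q′ free free′ = begin
    ∑ (allFin n) (λ x → 𝟙 (completes? Q Q′ x))
      ≤⟨ ∑-mono (allFin n) (λ x → 𝟙≤ (completes? Q Q′ x) (charge x)) ⟩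
    ∑ (allFin n) (λ x → ∑ (subsets n) (λ T → in-either Q Q′ T * ∑ bs (λ b → extends T b x)))
      ≡⟨ ∑-swap (allFin n) (subsets n) (λ x T → in-either Q Q′ T * ∑ bs (λ b → extends T b x)) ⟩
    ∑ (subsets n) (λ T → ∑ (allFin n) (λ x → in-either Q Q′ T * ∑ bs (λ b → extends T b x)))
      ≡⟨ ∑-cong (subsets n) (λ T → ∑-*ˡ (in-either Q Q′ T) (allFin n) (λ x → ∑ bs (λ b → extends T b x))) ⟩
    ∑ (subsets n) (λ T → in-either Q Q′ T * ∑ (allFin n) (λ x → ∑ bs (λ b → extends T b x)))
      ≤⟨ ∑-mono (subsets n) extensions ⟩
    ∑ (subsets n) (λ T → in-either Q Q′ T * μ)
      ≡⟨ ∑-*ʳ μ (subsets n) (in-either Q Q′) ⟩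
    #in-either Q Q′ * μ                        ≡⟨ *-comm (#in-either Q Q′) μ ⟩
    μ * #in-either Q Q′                        ∎
    where
    charge-via : ∀ x {b} R → b ∈ˡ bs → ¬ b ⊆ R → b ⊆ R [ x ]≔ inside →
      (∀ {T} → T ⊆ R → T ⊆ Q ⊎ T ⊆ Q′) →
      1 ≤ ∑ (subsets n) (λ T → in-either Q Q′ T * ∑ bs (λ b → extends T b x))
    charge-via x {b} R b∈ b⊈R b⊆Rx side = ≤-trans
      (*-mono-≤ {1} {_} {1} (≤-reflexive (sym (cong₂ _*_ (𝟙-yes (∣ T ∣ ≟ t) ∣T∣≡t) (𝟙-yes ((T ⊆? Q) ⊎-dec (T ⊆? Q′)) (side T⊆R)))))
        (≤-trans (≤-reflexive (sym (cong₂ _*_ (𝟙-yes (T ⊆? b) (λ y∈ → proj₁ (∈-delete⁻ b y∈)))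
          (cong₂ _*_ (𝟙-yes (x ∈? b) x∈b) (cong (1 ∸_) (𝟙-no (x ∈? T) (λ x∈ → proj₂ (∈-delete⁻ b x∈) refl)))))))
          (∑-∈ (λ b → extends T b x) b∈)))
      (∑-∈ (λ T → in-either Q Q′ T * ∑ bs (λ b → extends T b x)) (∈-subsets T))
      where
      T : Subset n
      T = b [ x ]≔ outside
      x∈b : x ∈ b
      x∈b with x ∈? b
      ... | yes x∈b = x∈b
      ... | no x∉b  = ⊥-elim (b⊈R λ y∈ → ∈-insert⁻ (b⊆Rx y∈) (λ { refl → x∉b y∈ }))
      ∣T∣≡t : ∣ T ∣ ≡ t
      ∣T∣≡t = suc-injective (trans (∣delete∣ b x x∈b) (All.lookup size b∈))
      T⊆R : T ⊆ R
      T⊆R y∈ = let y∈b , y≢x = ∈-delete⁻ b y∈ in ∈-insert⁻ (b⊆Rx y∈b) y≢x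
    charge : ∀ x → Completes Q Q′ x →
      1 ≤ ∑ (subsets n) (λ T → in-either Q Q′ T * ∑ bs (λ b → extends T b x))
    charge x c with find c
    ... | b , b∈ , inj₁ b⊆ = charge-via x Q  b∈ (free b b∈)  b⊆ inj₁
    ... | b , b∈ , inj₂ b⊆ = charge-via x Q′ b∈ (free′ b b∈) b⊆ inj₂
    extensions : ∀ T → in-either Q Q′ T * ∑ (allFin n) (λ x → ∑ bs (λ b → extends T b x)) ≤ in-either Q Q′ T * μ
    extensions T = subst₂ _≤_ (sym (*-assoc (𝟙 (∣ T ∣ ≟ t)) side _)) (sym (*-assoc (𝟙 (∣ T ∣ ≟ t)) side μ))
      (𝟙-*-mono (∣ T ∣ ≟ t) (λ ∣T∣≡t → *-monoʳ-≤ side (begin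
      ∑ (allFin n) (λ x → ∑ bs (λ b → extends T b x))    ≡⟨ ∑-swap (allFin n) bs (λ x b → extends T b x) ⟩
      ∑ bs (λ b → ∑ (allFin n) (extends T b))            ≡⟨ ∑-cong bs (λ b → ∑-*ˡ (𝟙 (T ⊆? b)) (allFin n) (λ x → 𝟙 (x ∈? b) * (1 ∸ 𝟙 (x ∈? T)))) ⟩
      ∑ bs (λ b → 𝟙 (T ⊆? b) * ∑ (allFin n) (λ x → 𝟙 (x ∈? b) * (1 ∸ 𝟙 (x ∈? T))))
        ≤⟨ ∑-mono-∈ bs (single ∣T∣≡t) ⟩
      codegree bs T                                      ≤⟨ covered T ∣T∣≡t ⟩
      μ                                                  ∎)))
      where
      side : ℕ
      side = 𝟙 ((T ⊆? Q) ⊎-dec (T ⊆? Q′))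
      -- A block containing T has t + 1 vertices, hence exactly one outside T.
      single : ∣ T ∣ ≡ t → ∀ b → b ∈ˡ bs → 𝟙 (T ⊆? b) * ∑ (allFin n) (λ x → 𝟙 (x ∈? b) * (1 ∸ 𝟙 (x ∈? T))) ≤ 𝟙 (T ⊆? b)
      single ∣T∣≡t b b∈ with T ⊆? b
      ... | no _    = z≤n
      ... | yes T⊆b = ≤-reflexive (trans (*-identityˡ _) (+-cancelˡ-≡ ∣ T ∣ _ _
        (trans (∑-difference T⊆b) (trans (All.lookup size b∈) (trans (cong suc (sym ∣T∣≡t)) (+-comm 1 ∣ T ∣))))))

_⊑_ : ∀ {n} → Subset n → List (Fin n) → Set
b ⊑ xs = ∀ x → x ∈ b → x ∈ˡ xs

-- Moving vertices between classes

module Repair {n M t μ ℓ : ℕ} .{{_ : NonZero μ}} (bs : List (Subset n)) (size : All (λ b → ∣ b ∣ ≡ suc t) bs)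
  (covered : ∀ T → ∣ T ∣ ≡ t → codegree bs T ≤ μ) (2≤t : 2 ≤ t) (t<ℓ : t < ℓ)
  (room : t ! * (2 * ℓ * M) + (2 ^ suc t ∸ 1) * μ * ℓ ^ t ≤ t ! * n) where

  open Blocking bs size covered

  private
    m = suc M

  Classes : Set
  Classes = Fin m → List (Fin n)

  -- The invariant of the repair, which no longer mentions colours. Since `outer` sees only the ends
  -- of the classes, `inner` is required separately for windows inside one long class.
  record Valid (L : Classes) : Set where
    field
      partition : flatten L ↭ allFin n
      inner     : ∀ c b → b ∈ˡ bs → ¬ b ⊑ L c
      outer     : ∀ c b → b ∈ˡ bs → ¬ b ⊑ (last ℓ (L (prev c)) ++ first ℓ (L c))

  deficit : Classes → ℕ
  deficit L = ∑ (allFin m) (λ c → ℓ ∸ length (L c))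

  module Improve (L : Classes) (valid : Valid L) (i : Fin m) (short : length (L i) < ℓ) where

    open Valid valid
    open ≤-Reasoning

    -- Being short, `L i` is equal to both of its end segments, so these are, up to order, the lists
    -- of `outer` at i and at `next i`. `L i` stands last in both so that `∣toSubset-++∣` bounds
    -- their sizes by ℓ + ∣ B ∣.
    before after : List (Fin n)
    before = last ℓ (L (prev i)) ++ L i
    after  = first ℓ (L (next i)) ++ L i

    Q Q′ B : Subset n
    Q  = toSubset before
    Q′ = toSubset after
    B  = toSubset (L i)

    free : ∀ b → b ∈ˡ bs → ¬ b ⊆ Q
    free b b∈ b⊆Q = outer i b b∈ λ x x∈ →
      subst (λ z → x ∈ˡ last ℓ (L (prev i)) ++ z) (sym (first-short ℓ (<⇒≤ short))) (∈-toSubset⁻ before (b⊆Q x∈))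

    free′ : ∀ b → b ∈ˡ bs → ¬ b ⊆ Q′
    free′ b b∈ b⊆Q′ = outer (next i) b b∈ λ x x∈ →
      [ (λ x∈f → ∈-++⁺ʳ (last ℓ (L (prev (next i)))) x∈f)
      , (λ x∈i → ∈-++⁺ˡ (subst (λ c → x ∈ˡ last ℓ (L c)) (sym (prev-next i))
          (subst (x ∈ˡ_) (sym (last-short ℓ (<⇒≤ short))) x∈i))) ]′
      (∈-++⁻ (first ℓ (L (next i))) (∈-toSubset⁻ after (b⊆Q′ x∈)))

    blocked? : ∀ x → Dec (Completes Q Q′ x)
    blocked? = completes? Q Q′

    #blocked : ∑ (allFin n) (λ x → 𝟙 (blocked? x)) + 2 * ℓ * M + length (L i) < n
    #blocked = ≤-<-trans
      (+-monoˡ-≤ (length (L i)) (+-monoˡ-≤ (2 * ℓ * M) (#completing Q Q′ free free′)))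
      (blocked-bound {M = M} {s′ = ∣ B ∣} 2≤t t<ℓ (∣toSubset∣ (L i)) short
        (#in-either-bound (B⊆ (last ℓ (L (prev i)))) (B⊆ (first ℓ (L (next i))))
          (≤-trans (∣toSubset-++∣ (last ℓ (L (prev i))) (L i)) (+-monoˡ-≤ ∣ B ∣ (length-last ℓ (L (prev i)))))
          (≤-trans (∣toSubset-++∣ (first ℓ (L (next i))) (L i)) (+-monoˡ-≤ ∣ B ∣ (length-first ℓ (L (next i))))))
        room)
      where
      B⊆ : ∀ xs → B ⊆ toSubset (xs ++ L i)
      B⊆ xs x∈ = ∈-toSubset⁺ (∈-++⁺ʳ xs (∈-toSubset⁻ (L i) x∈))

    #middle : ℕ
    #middle = ∑ (allFin m) (λ c → length (middle ℓ (L c)))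

    ∑-length : ∑ (allFin m) (λ c → length (L c)) ≡ n
    ∑-length = begin-equality
      ∑ (allFin m) (λ c → length (L c))            ≡⟨ ∑-cong (allFin m) (λ c → trans (sym (*-identityʳ _)) (sym (∑-const 1 (L c)))) ⟩
      ∑ (allFin m) (λ c → ∑ (L c) (λ _ → 1))       ≡⟨ ∑-flatten L (λ _ → 1) ⟨
      ∑ (flatten L) (λ _ → 1)                      ≡⟨ ∑-↭ (λ _ → 1) partition ⟩
      ∑ (allFin n) (λ _ → 1)                       ≡⟨ trans (∑-const 1 (allFin n)) (*-identityʳ _) ⟩
      length (allFin n)                            ≡⟨ List.length-tabulate {n = n} id ⟩
      n                                            ∎

    -- Every class has at most 2 ℓ vertices outside its middle, but class i has fewer than ℓ in all;
    -- hence the factor M instead of m. Adding 2 ℓ ∸ `length (L i)` on both sides avoids splitting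
    -- the sum at i.
    n≤#middle : n ≤ #middle + 2 * ℓ * M + length (L i)
    n≤#middle = +-cancelʳ-≤ (2 * ℓ ∸ length (L i)) n _ (begin
      n + (2 * ℓ ∸ length (L i))
        ≡⟨ cong (_+ (2 * ℓ ∸ length (L i))) ∑-length ⟨
      ∑ (allFin m) (λ c → length (L c)) + (2 * ℓ ∸ length (L i))
        ≤⟨ ∑-mono-gap (allFin m) bound (∈-allFin i) gap ⟩
      ∑ (allFin m) (λ c → length (middle ℓ (L c)) + 2 * ℓ)
        ≡⟨ trans (∑-+ (allFin m) (λ c → length (middle ℓ (L c))) (λ _ → 2 * ℓ)) (cong (#middle +_)
             (trans (∑-const (2 * ℓ) (allFin m)) (cong (_* (2 * ℓ)) (List.length-tabulate {n = m} id)))) ⟩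
      #middle + m * (2 * ℓ)
        ≡⟨ lem #middle M (2 * ℓ) ⟩
      #middle + 2 * ℓ * M + 2 * ℓ
        ≡⟨ cong (#middle + 2 * ℓ * M +_) (m+[n∸m]≡n s≤2ℓ) ⟨
      #middle + 2 * ℓ * M + (length (L i) + (2 * ℓ ∸ length (L i)))
        ≡⟨ +-assoc (#middle + 2 * ℓ * M) (length (L i)) _ ⟨
      #middle + 2 * ℓ * M + length (L i) + (2 * ℓ ∸ length (L i)) ∎)
      where
      s≤2ℓ : length (L i) ≤ 2 * ℓ
      s≤2ℓ = ≤-trans (<⇒≤ short) (m≤n*m ℓ 2)
      lem : ∀ a b c → a + (1 + b) * c ≡ a + c * b + c
      lem = solve-∀
      bound : ∀ c → length (L c) ≤ length (middle ℓ (L c)) + 2 * ℓ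
      bound c = begin
        length (L c)                       ≤⟨ m≤n+m∸n (length (L c)) (2 * ℓ) ⟩
        2 * ℓ + (length (L c) ∸ 2 * ℓ)     ≡⟨ +-comm (2 * ℓ) _ ⟩
        length (L c) ∸ 2 * ℓ + 2 * ℓ       ≡⟨ cong (_+ 2 * ℓ) (trans (cong (λ z → length (L c) ∸ (ℓ + z)) (+-identityʳ ℓ))
                                                (sym (∸-+-assoc (length (L c)) ℓ ℓ))) ⟩
        length (L c) ∸ ℓ ∸ ℓ + 2 * ℓ       ≡⟨ cong (_+ 2 * ℓ) (length-middle ℓ (L c)) ⟨
        length (middle ℓ (L c)) + 2 * ℓ    ∎
      gap : length (L i) + (2 * ℓ ∸ length (L i)) ≤ length (middle ℓ (L i)) + 2 * ℓ
      gap = ≤-trans (≤-reflexive (m+[n∸m]≡n s≤2ℓ)) (m≤n+m (2 * ℓ) (length (middle ℓ (L i))))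

    movable : ∃[ j ] Any (λ x → ¬ Completes Q Q′ x) (middle ℓ (L j))
    movable with any? (λ j → Any.any? (λ x → ¬? (blocked? x)) (middle ℓ (L j)))
    ... | yes found = found
    ... | no none = contradiction #blocked (≤⇒≯ (≤-trans n≤#middle
        (+-monoˡ-≤ (length (L i)) (+-monoˡ-≤ (2 * ℓ * M) (begin
      #middle
        ≡⟨ ∑-cong (allFin m) (λ c → trans (sym (*-identityʳ _)) (sym (∑-const 1 (middle ℓ (L c))))) ⟩
      ∑ (allFin m) (λ c → ∑ (middle ℓ (L c)) (λ _ → 1))
        ≤⟨ ∑-mono (allFin m) (λ c → ∑-mono-∈ (middle ℓ (L c)) (λ x x∈ → ≤-reflexive (sym (𝟙-yes (blocked? x)
             (decidable-stable (blocked? x) (λ ¬b → none (c , lose x∈ ¬b))))))) ⟩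
      ∑ (allFin m) (λ c → ∑ (middle ℓ (L c)) (λ x → 𝟙 (blocked? x)))
        ≤⟨ ∑-mono (allFin m) (λ c → ∑-middle ℓ (L c) (λ x → 𝟙 (blocked? x))) ⟩
      ∑ (allFin m) (λ c → ∑ (L c) (λ x → 𝟙 (blocked? x)))
        ≡⟨ ∑-flatten L (λ x → 𝟙 (blocked? x)) ⟨
      ∑ (flatten L) (λ x → 𝟙 (blocked? x))
        ≡⟨ ∑-↭ (λ x → 𝟙 (blocked? x)) partition ⟩
      ∑ (allFin n) (λ x → 𝟙 (blocked? x)) ∎)))))

    module Move (j : Fin m) (x : Fin n) (¬blocked : ¬ Completes Q Q′ x) (ys zs : List (Fin n))
      (Lj≡ : L j ≡ ys ++ x ∷ zs) (ℓ≤ys : ℓ ≤ length ys) (ℓ≤zs : ℓ ≤ length zs) where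

      i≢j : i ≢ j
      i≢j refl = <⇒≱ short (≤-trans ℓ≤ys (≤-trans (m≤m+n (length ys) _)
        (≤-reflexive (trans (sym (List.length-++ ys)) (cong length (sym Lj≡))))))

      L⁻ L⁺ : Classes
      L⁻ c with c Fin.≟ j
      ... | yes _ = ys ++ zs
      ... | no _  = L c
      L⁺ c with c Fin.≟ i
      ... | yes _ = x ∷ L i
      ... | no _  = L⁻ c

      L⁻-j : L⁻ j ≡ ys ++ zs
      L⁻-j with j Fin.≟ j
      ... | yes _  = refl
      ... | no j≢j = contradiction refl j≢j

      L⁻-other : ∀ {c} → c ≢ j → L⁻ c ≡ L c
      L⁻-other {c} c≢j with c Fin.≟ j
      ... | yes c≡j = contradiction c≡j c≢j
      ... | no _    = refl

      L⁺-i : L⁺ i ≡ x ∷ L i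
      L⁺-i with i Fin.≟ i
      ... | yes _  = refl
      ... | no i≢i = contradiction refl i≢i

      L⁺-other : ∀ {c} → c ≢ i → L⁺ c ≡ L⁻ c
      L⁺-other {c} c≢i with c Fin.≟ i
      ... | yes c≡i = contradiction c≡i c≢i
      ... | no _    = refl

      ∈-class : ∀ {c y} → c ≢ i → y ∈ˡ L⁺ c → y ∈ˡ L c
      ∈-class {c} {y} c≢i y∈ with c Fin.≟ j
      ... | no c≢j = subst (y ∈ˡ_) (trans (L⁺-other c≢i) (L⁻-other c≢j)) y∈
      ... | yes refl = subst (y ∈ˡ_) (sym Lj≡)
        ([ ∈-++⁺ˡ , ∈-++⁺ʳ ys ∘ there ]′ (∈-++⁻ ys (subst (y ∈ˡ_) (trans (L⁺-other c≢i) L⁻-j) y∈)))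

      ∈-first : ∀ {c y} → c ≢ i → y ∈ˡ first ℓ (L⁺ c) → y ∈ˡ first ℓ (L c)
      ∈-first {c} {y} c≢i y∈ with c Fin.≟ j
      ... | no c≢j = subst (λ z → y ∈ˡ first ℓ z) (trans (L⁺-other c≢i) (L⁻-other c≢j)) y∈
      ... | yes refl = subst (λ z → y ∈ˡ first ℓ z) (sym Lj≡) (∈-first-delete ℓ ys zs ℓ≤ys
        (subst (λ z → y ∈ˡ first ℓ z) (trans (L⁺-other c≢i) L⁻-j) y∈))

      ∈-last : ∀ {c y} → c ≢ i → y ∈ˡ last ℓ (L⁺ c) → y ∈ˡ last ℓ (L c)
      ∈-last {c} {y} c≢i y∈ with c Fin.≟ j
      ... | no c≢j = subst (λ z → y ∈ˡ last ℓ z) (trans (L⁺-other c≢i) (L⁻-other c≢j)) y∈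
      ... | yes refl = subst (λ z → y ∈ˡ last ℓ z) (sym Lj≡) (∈-last-delete ℓ ys zs ℓ≤zs
        (subst (λ z → y ∈ˡ last ℓ z) (trans (L⁺-other c≢i) L⁻-j) y∈))

      ∈-i : ∀ {y} → y ∈ˡ L⁺ i → y ∈ˡ x ∷ L i
      ∈-i {y} = subst (y ∈ˡ_) L⁺-i

      completes : ∀ {b} us → b ∈ˡ bs → b ⊑ (x ∷ us) → b ⊆ toSubset us [ x ]≔ inside
      completes us b∈ b⊑ y∈ = ∈-toSubset⁺ (b⊑ _ y∈)

      unblocked : ∀ {b} → b ∈ˡ bs → ¬ b ⊑ (x ∷ before)
      unblocked b∈ b⊑ = ¬blocked (lose b∈ (inj₁ (completes before b∈ b⊑)))

      unblocked′ : ∀ {b} → b ∈ˡ bs → ¬ b ⊑ (x ∷ after)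
      unblocked′ b∈ b⊑ = ¬blocked (lose b∈ (inj₂ (completes after b∈ b⊑)))

      add : ∀ {y} us → y ∈ˡ x ∷ L i → y ∈ˡ x ∷ us ++ L i
      add us (here eq)  = here eq
      add us (there y∈) = there (∈-++⁺ʳ us y∈)

      inner⁺ : ∀ c b → b ∈ˡ bs → ¬ b ⊑ L⁺ c
      inner⁺ c b b∈ b⊑ with c Fin.≟ i
      ... | yes refl = unblocked b∈ (λ y y∈ → add (last ℓ (L (prev i))) (b⊑ y y∈))
      ... | no c≢i   = inner c b b∈ (λ y y∈ → ∈-class c≢i (subst (y ∈ˡ_) (sym (L⁺-other c≢i)) (b⊑ y y∈)))

      -- The vertex x can appear only where class i is one of the two neighbours, and there any
      -- block would be completed by x in Q or in Q′. Elsewhere end segments gain no vertices.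
      outer⁺ : ∀ c b → b ∈ˡ bs → ¬ b ⊑ (last ℓ (L⁺ (prev c)) ++ first ℓ (L⁺ c))
      outer⁺ c b b∈ b⊑ = by-cases (c Fin.≟ i) (prev c Fin.≟ i)
        where
        split : ∀ y → y ∈ b → y ∈ˡ last ℓ (L⁺ (prev c)) ⊎ y ∈ˡ first ℓ (L⁺ c)
        split y y∈ = ∈-++⁻ (last ℓ (L⁺ (prev c))) (b⊑ y y∈)
        from-first : ∀ {c y} → c ≡ i → y ∈ˡ first ℓ (L⁺ c) → y ∈ˡ x ∷ L i
        from-first refl y∈ = ∈-i (∈-take ℓ ℓ (L⁺ i) y∈)
        from-last : ∀ {c y} → c ≡ i → y ∈ˡ last ℓ (L⁺ c) → y ∈ˡ x ∷ L i
        from-last refl y∈ = ∈-i (∈-drop ℓ (length (L⁺ i) ∸ ℓ) (L⁺ i) y∈)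
        by-cases : Dec (c ≡ i) → Dec (prev c ≡ i) → _
        -- This occurs only with a single class, which is its own neighbour.
        by-cases (yes c≡i) (yes p≡i) = unblocked b∈ λ y y∈ →
          add (last ℓ (L (prev i))) ([ from-last p≡i , from-first c≡i ]′ (split y y∈))
        by-cases (yes c≡i) (no p≢i) = unblocked b∈ λ y y∈ →
          [ (λ y∈l → there (∈-++⁺ˡ (subst (λ d → y ∈ˡ last ℓ (L (prev d))) c≡i (∈-last p≢i y∈l))))
          , (λ y∈f → add (last ℓ (L (prev i))) (from-first c≡i y∈f)) ]′ (split y y∈)
        by-cases (no c≢i) (yes p≡i) = unblocked′ b∈ λ y y∈ →
          [ (λ y∈l → add (first ℓ (L (next i))) (from-last p≡i y∈l))
          , (λ y∈f → there (∈-++⁺ˡ (subst (λ d → y ∈ˡ first ℓ (L d)) (trans (sym (next-prev c)) (cong next p≡i)) (∈-first c≢i y∈f)))) ]′ (split y y∈)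
        by-cases (no c≢i) (no p≢i) = outer c b b∈ λ y y∈ →
          [ (λ y∈l → ∈-++⁺ˡ (∈-last p≢i y∈l))
          , (λ y∈f → ∈-++⁺ʳ (last ℓ (L (prev c))) (∈-first c≢i y∈f)) ]′ (split y y∈)

      partition⁺ : flatten L⁺ ↭ allFin n
      partition⁺ = ↭-trans
        (flatten-insert i (↭-reflexive (trans L⁺-i (cong (x ∷_) (sym (L⁻-other i≢j))))) (λ d → L⁺-other))
        (↭-trans (↭-sym (flatten-insert j
          (↭-trans (↭-reflexive Lj≡) (↭-trans (shift x ys zs) (↭-reflexive (cong (x ∷_) (sym L⁻-j)))))
          (λ d d≢j → sym (L⁻-other d≢j))))
          partition)

      deficit⁺ : deficit L⁺ < deficit L
      deficit⁺ = ∑-mono-< (allFin m) shrinks (∈-allFin i)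
        (subst (λ z → ℓ ∸ length z < ℓ ∸ length (L i)) (sym L⁺-i) (∸-monoʳ-< (n<1+n _) short))
        where
        shrinks : ∀ c → ℓ ∸ length (L⁺ c) ≤ ℓ ∸ length (L c)
        shrinks c = by-cases (c Fin.≟ i) (c Fin.≟ j)
          where
          by-cases : Dec (c ≡ i) → Dec (c ≡ j) → ℓ ∸ length (L⁺ c) ≤ ℓ ∸ length (L c)
          by-cases (yes refl) _ = subst (λ z → ℓ ∸ length z ≤ ℓ ∸ length (L i)) (sym L⁺-i) (∸-monoʳ-≤ ℓ (n≤1+n _))
          -- The class that loses x keeps `ys` and `zs`, so it contributes nothing to the deficit.
          by-cases (no c≢i) (yes refl) = ≤-trans (≤-reflexive (m≤n⇒m∸n≡0 (≤-trans ℓ≤ys (≤-trans (m≤m+n (length ys) (length zs))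
            (≤-reflexive (trans (sym (List.length-++ ys)) (cong length (sym (trans (L⁺-other c≢i) L⁻-j))))))))) z≤n
          by-cases (no c≢i) (no c≢j) = ≤-reflexive (cong (λ z → ℓ ∸ length z) (trans (L⁺-other c≢i) (L⁻-other c≢j)))

      valid⁺ : Valid L⁺
      valid⁺ = record { partition = partition⁺ ; inner = inner⁺ ; outer = outer⁺ }

    improvement : ∃[ L′ ] Valid L′ × deficit L′ < deficit L
    improvement with movable
    ... | j , found with find found
    ...   | x , x∈ , ¬blocked with middle-split ℓ (L j) x∈
    ...     | ys , zs , eq , ℓ≤ys , ℓ≤zs = L⁺ , valid⁺ , deficit⁺
      where open Move j x ¬blocked ys zs eq ℓ≤ys ℓ≤zs

  repair : ∀ k L → deficit L ≤ k → Valid L → ∃[ L′ ] Valid L′ × (∀ c → ℓ ≤ length (L′ c))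
  repair k L le valid with any? (λ c → length (L c) <? ℓ)
  ... | no none = L , valid , λ c → ≮⇒≥ (λ lt → none (c , lt))
  repair zero L le valid | yes (i , short) =
    contradiction (≤-trans (proj₂ (proj₂ (Improve.improvement L valid i short))) le) λ ()
  repair (suc k) L le valid | yes (i , short) =
    let L′ , valid′ , lt = Improve.improvement L valid i short in repair k L′ (s≤s⁻¹ (≤-trans lt le)) valid′

  module _ (f : Vec (Fin m) n) (good : ∀ b → b ∈ˡ bs → ¬ (∃[ c ] Within (prev c) c f b)) where

    colour-class : List (Fin n) → Classes
    colour-class xs c = filter (λ x → lookup f x Fin.≟ c) xs

    flatten-colour-class : ∀ xs → flatten (colour-class xs) ↭ xs
    flatten-colour-class []       = ↭-reflexive (empty m)
      where
      empty : ∀ m → flatten {m = m} (λ _ → [] {A = Fin n}) ≡ []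
      empty zero    = refl
      empty (suc m) = empty m
    flatten-colour-class (x ∷ xs) = ↭-trans
      (flatten-insert (lookup f x)
        (↭-reflexive (List.filter-accept (λ y → lookup f y Fin.≟ lookup f x) refl))
        (λ d d≢ → List.filter-reject (λ y → lookup f y Fin.≟ d) {xs = xs} (d≢ ∘ sym)))
      (prep x (flatten-colour-class xs))

    ∈-colour-class : ∀ {c x} xs → x ∈ˡ colour-class xs c → lookup f x ≡ c
    ∈-colour-class {c} xs x∈ = proj₂ (∈-filter⁻ (λ x → lookup f x Fin.≟ c) {xs = xs} x∈)

    long-classes : ∃[ L ] Valid L × (∀ c → ℓ ≤ length (L c))
    long-classes = repair (deficit L₀) L₀ ≤-refl record
      { partition = flatten-colour-class (allFin n)
      ; inner = λ c b b∈ b⊑ → good b b∈ (c , λ x x∈ → inj₂ (∈-colour-class (allFin n) (b⊑ x x∈)))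
      ; outer = λ c b b∈ b⊑ → good b b∈ (c , λ x x∈ →
          ⊎-map (∈-colour-class (allFin n) ∘ ∈-drop ℓ (length (L₀ (prev c)) ∸ ℓ) (L₀ (prev c)))
                (∈-colour-class (allFin n) ∘ ∈-take ℓ ℓ (L₀ c))
                (∈-++⁻ (last ℓ (L₀ (prev c))) (b⊑ x x∈)))
      }
      where
      L₀ : Classes
      L₀ = colour-class (allFin n)

-- Positions in lists

module _ {A : Set} where

  -- Positions as a relation, so that they can be shifted along `++` without carrying bounds on the
  -- index.
  data At : List A → ℕ → A → Set where
    here  : ∀ {x xs} → At (x ∷ xs) 0 x
    there : ∀ {x y xs k} → At xs k x → At (y ∷ xs) (suc k) x

  at-lookup : ∀ (xs : List A) i → At xs (toℕ i) (List.lookup xs i)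
  at-lookup (x ∷ xs) zero    = here
  at-lookup (x ∷ xs) (suc i) = there (at-lookup xs i)

  at-++ˡ : ∀ {xs ys : List A} {k x} → At xs k x → At (xs ++ ys) k x
  at-++ˡ here       = here
  at-++ˡ (there at) = there (at-++ˡ at)

  at-++ʳ : ∀ (xs : List A) {ys k x} → At ys k x → At (xs ++ ys) (length xs + k) x
  at-++ʳ []       at = at
  at-++ʳ (x ∷ xs) at = there (at-++ʳ xs at)

  at-++ʳ⁻ : ∀ (xs : List A) {ys k x} → At (xs ++ ys) (length xs + k) x → At ys k x
  at-++ʳ⁻ []       at         = at
  at-++ʳ⁻ (x ∷ xs) (there at) = at-++ʳ⁻ xs at

  at-++ˡ⁻ : ∀ (xs : List A) {ys k x} → k < length xs → At (xs ++ ys) k x → At xs k x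
  at-++ˡ⁻ (x ∷ xs) _        here       = here
  at-++ˡ⁻ (x ∷ xs) (s≤s lt) (there at) = there (at-++ˡ⁻ xs lt at)

  at⇒∈ : ∀ {xs : List A} {k x} → At xs k x → x ∈ˡ xs
  at⇒∈ here       = here refl
  at⇒∈ (there at) = there (at⇒∈ at)

  at⇒∈-take : ∀ {xs : List A} {j k x} → k < j → At xs k x → x ∈ˡ take j xs
  at⇒∈-take {j = suc j} _        here       = here refl
  at⇒∈-take {j = suc j} (s≤s lt) (there at) = there (at⇒∈-take lt at)

  at⇒∈-drop : ∀ {xs : List A} {j k x} → j ≤ k → At xs k x → x ∈ˡ drop j xs
  at⇒∈-drop {j = zero}  _        at         = at⇒∈ at
  at⇒∈-drop {j = suc j} (s≤s le) (there at) = at⇒∈-drop le at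

  -- prev zero is the last class; the list which follows it is E.
  successor : ∀ {M} → (Fin (suc M) → List A) → List A → Fin (suc M) → List A
  successor L E zero    = E
  successor L E (suc c) = L (suc c)

  -- The class at position k is named `prev c` so that the following one is c. `E` is arbitrary
  -- because the recursion passes to `L ∘ suc`, whose last class must still be followed by the same
  -- list.
  locate : ∀ {M} (L : Fin (suc M) → List A) E k → k < length (flatten L) →
    ∃[ c ] ∃[ pre ] ∃[ o ] ∃[ post ] k ≡ length pre + o × o < length (L (prev c)) ×
      flatten L ++ E ≡ pre ++ L (prev c) ++ successor L E c ++ post
  locate {zero} L E k k< = zero , [] , k , [] , refl
    , subst (λ xs → k < length xs) (List.++-identityʳ (L zero)) k<
    , trans (List.++-assoc (L zero) [] E) (cong (L zero ++_) (sym (List.++-identityʳ E)))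
  locate {suc M} L E k k< with k <? length (L zero)
  ... | yes k<L₀ = suc zero , [] , k , flatten (λ c → L (suc (suc c))) ++ E , refl , k<L₀
    , trans (List.++-assoc (L zero) _ E) (cong (L zero ++_) (List.++-assoc (L (suc zero)) _ E))
  ... | no k≮L₀ with locate (L ∘ suc) E (k ∸ length (L zero))
        (+-cancelˡ-< (length (L zero)) _ _ (subst₂ _<_ (sym (m+[n∸m]≡n (≮⇒≥ k≮L₀))) (List.length-++ (L zero)) k<))
  ...   | c , pre , o , post , k≡ , o< , eq = shifted c o< eq
    where
    k≡′ : k ≡ length (L zero ++ pre) + o
    k≡′ = trans (sym (m+[n∸m]≡n (≮⇒≥ k≮L₀))) (trans (cong (length (L zero) +_) k≡)
      (trans (sym (+-assoc (length (L zero)) (length pre) o)) (cong (_+ o) (sym (List.length-++ (L zero))))))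
    prefix : ∀ {rest} → flatten (L ∘ suc) ++ E ≡ pre ++ rest → flatten L ++ E ≡ (L zero ++ pre) ++ rest
    prefix {rest} eq = trans (List.++-assoc (L zero) (flatten (L ∘ suc)) E)
      (trans (cong (L zero ++_) eq) (sym (List.++-assoc (L zero) pre rest)))
    shifted : ∀ c → o < length (L (suc (prev c))) →
      flatten (L ∘ suc) ++ E ≡ pre ++ L (suc (prev c)) ++ successor (L ∘ suc) E c ++ post →
      ∃[ c ] ∃[ pre ] ∃[ o ] ∃[ post ] k ≡ length pre + o × o < length (L (prev c)) ×
        flatten L ++ E ≡ pre ++ L (prev c) ++ successor L E c ++ post
    shifted zero    o< eq = zero , L zero ++ pre , o , post , k≡′ , o< , prefix eq
    shifted (suc c) o< eq = suc (suc c) , L zero ++ pre , o , post , k≡′ , o< , prefix eq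

  -- Writing the sequence twice turns cyclic windows into ordinary ones. Here `E` is the first
  -- class, and the rest of the second copy goes into `post`.
  locate-cyclic : ∀ {M} (L : Fin (suc M) → List A) k → k < length (flatten L) →
    ∃[ c ] ∃[ pre ] ∃[ o ] ∃[ post ] k ≡ length pre + o × o < length (L (prev c)) ×
      flatten L ++ flatten L ≡ pre ++ L (prev c) ++ L c ++ post
  locate-cyclic L k k< with locate L (L zero) k k<
  ... | c , pre , o , post , k≡ , o< , eq = c , pre , o , post ++ rest , k≡ , o< , (begin
      flatten L ++ L zero ++ rest                              ≡⟨ List.++-assoc (flatten L) (L zero) rest ⟨
      (flatten L ++ L zero) ++ rest                            ≡⟨ cong (_++ rest) eq ⟩
      (pre ++ L (prev c) ++ successor L (L zero) c ++ post) ++ rest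
        ≡⟨ cong (λ xs → (pre ++ L (prev c) ++ xs ++ post) ++ rest) (same c) ⟩
      (pre ++ L (prev c) ++ L c ++ post) ++ rest               ≡⟨ List.++-assoc pre _ rest ⟩
      pre ++ (L (prev c) ++ L c ++ post) ++ rest               ≡⟨ cong (pre ++_) (List.++-assoc (L (prev c)) _ rest) ⟩
      pre ++ L (prev c) ++ (L c ++ post) ++ rest               ≡⟨ cong (λ xs → pre ++ L (prev c) ++ xs) (List.++-assoc (L c) post rest) ⟩
      pre ++ L (prev c) ++ L c ++ post ++ rest                 ∎)
    where
    open ≡-Reasoning
    rest : List A
    rest = flatten (L ∘ suc)
    same : ∀ c → successor L (L zero) c ≡ L c
    same zero    = refl
    same (suc c) = refl

-- The sequencing that lists the classes one after the other

lookup-allFin : ∀ {n} (k : Fin (length (allFin n))) → List.lookup (allFin n) k ≡ cast (List.length-tabulate {n = n} id) k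
lookup-allFin {n} k = trans
  (cong (List.lookup (allFin n)) (sym (Fin.cast-involutive (sym (List.length-tabulate {n = n} id)) (List.length-tabulate {n = n} id) k)))
  (List.lookup-tabulate id (cast (List.length-tabulate {n = n} id) k))

module FromPermutation {n} {xs : List (Fin n)} (xs↭ : xs ↭ allFin n) where

  length≡n : length xs ≡ n
  length≡n = trans (↭-length xs↭) (List.length-tabulate {n = n} id)

  -- A permutation proof carries a bijection between positions; since `allFin n` has k in position
  -- k, this bijection sends i to the entry of `xs` at i.
  sequencing : Sequencing n
  sequencing = ↔⇒⤖ (cast-id (sym length≡n) ∘ₚ (onIndices (↭⇒↭ₛ xs↭)
    ∘ₚ cast-id (List.length-tabulate {n = n} id)))

  sequencing-at : ∀ i → At xs (toℕ i) (Bijection.to sequencing i)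
  sequencing-at i = subst₂ (At xs) (Fin.toℕ-cast (sym length≡n) i)
    (trans (onIndices-lookup (setoid (Fin n)) (↭⇒↭ₛ xs↭) (cast (sym length≡n) i)) (lookup-allFin _))
    (at-lookup xs (cast (sym length≡n) i))

  sequencing-at-⊕ : ∀ i j → j ≤ n → At (xs ++ xs) (toℕ i + j) (Bijection.to sequencing (i ⊕ j))
  sequencing-at-⊕ i j j≤n with toℕ i + j <? n
  ... | yes lt = subst (λ k → At (xs ++ xs) k (Bijection.to sequencing (i ⊕ j)))
    (trans (Fin.toℕ-fromℕ< (m%n<n (toℕ i + j) n {{Fin.nonZeroIndex i}})) (m<n⇒m%n≡m {{Fin.nonZeroIndex i}} lt))
    (at-++ˡ (sequencing-at (i ⊕ j)))
  ... | no ¬lt = subst (λ k → At (xs ++ xs) k (Bijection.to sequencing (i ⊕ j)))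
    (trans (cong₂ _+_ length≡n (trans (Fin.toℕ-fromℕ< (m%n<n (toℕ i + j) n {{Fin.nonZeroIndex i}}))
        (trans (sym (m≤n⇒[n∸m]%m≡n%m {{Fin.nonZeroIndex i}} (≮⇒≥ ¬lt)))
               (m<n⇒m%n≡m {{Fin.nonZeroIndex i}} small))))
      (m+[n∸m]≡n (≮⇒≥ ¬lt)))
    (at-++ʳ xs (sequencing-at (i ⊕ j)))
    where
    -- As i < n and j ≤ n, subtracting n once reduces i + j modulo n.
    small : toℕ i + j ∸ n < n
    small = m<n+o⇒m∸n<o (toℕ i + j) n {{Fin.nonZeroIndex i}} (+-mono-<-≤ (Fin.toℕ<n i) j≤n)

module Windows {n M ℓ : ℕ} (bs : List (Subset n)) (L : Fin (suc M) → List (Fin n))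
  (partition : flatten L ↭ allFin n)
  (inner : ∀ c b → b ∈ˡ bs → ¬ b ⊑ L c)
  (outer : ∀ c b → b ∈ˡ bs → ¬ b ⊑ (last ℓ (L (prev c)) ++ first ℓ (L c)))
  (long : ∀ c → ℓ ≤ length (L c)) where

  open FromPermutation partition public

  -- A window starting in class `prev c` cannot reach beyond class c, which has at least ℓ vertices.
  -- Either it ends inside `prev c` and `inner` applies, or it starts among the last ℓ vertices
  -- there and `outer` applies.
  windows-free : ∀ Y → ∣ Y ∣ ≡ ℓ → CyclicallyConsecutive sequencing Y → ∀ b → b ∈ˡ bs → ¬ b ⊆ Y
  windows-free Y ∣Y∣≡ℓ (i , window) b b∈ b⊆Y
    with locate-cyclic L (toℕ i) (subst (toℕ i <_) (sym length≡n) (Fin.toℕ<n i))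
  ... | c , pre , o , post , i≡ , o< , eq = by-cases (o + ℓ ≤? length (L (prev c)))
    where
    position : ∀ x → x ∈ b →
      ∃[ j ] j < ℓ × (At (L (prev c)) (o + j) x ⊎ ∃[ k ] k < ℓ × length (L (prev c)) ≤ o + j × At (L c) k x)
    position x x∈ with Equivalence.to (window x) (b⊆Y x∈)
    ... | j , j<∣Y∣ , refl = j , j<ℓ , side (o + j <? length (L (prev c)))
      where
      j<ℓ : j < ℓ
      j<ℓ = subst (j <_) ∣Y∣≡ℓ j<∣Y∣
      at : At (L (prev c) ++ L c ++ post) (o + j) x
      at = at-++ʳ⁻ pre (subst₂ (λ xs k → At xs k x) eq (trans (cong (_+ j) i≡) (+-assoc (length pre) o j))
        (sequencing-at-⊕ i j (≤-trans (<⇒≤ j<∣Y∣) (∣p∣≤n Y))))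
      side : Dec (o + j < length (L (prev c))) →
        At (L (prev c)) (o + j) x ⊎ ∃[ k ] k < ℓ × length (L (prev c)) ≤ o + j × At (L c) k x
      side (yes lt) = inj₁ (at-++ˡ⁻ (L (prev c)) lt at)
      side (no ¬lt) = inj₂ (k , k<ℓ , ≮⇒≥ ¬lt , at-++ˡ⁻ (L c) (<-≤-trans k<ℓ (long c))
        (at-++ʳ⁻ (L (prev c)) (subst (λ k → At (L (prev c) ++ L c ++ post) k x) (sym (m+[n∸m]≡n (≮⇒≥ ¬lt))) at)))
        where
        k : ℕ
        k = o + j ∸ length (L (prev c))
        k<ℓ : k < ℓ
        k<ℓ = m<n+o⇒m∸n<o (o + j) (length (L (prev c))) {{>-nonZero (≤-<-trans z≤n j<ℓ)}} (+-mono-< o< j<ℓ)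
    by-cases : Dec (o + ℓ ≤ length (L (prev c))) → _
    by-cases (yes le) = inner (prev c) b b∈ λ x x∈ → whole x (position x x∈)
      where
      whole : ∀ x → _ → x ∈ˡ L (prev c)
      whole x (j , j<ℓ , inj₁ at) = at⇒∈ at
      whole x (j , j<ℓ , inj₂ (_ , _ , ge , _)) =
        contradiction (≤-trans (<-≤-trans (+-monoʳ-< o j<ℓ) le) ge) (<-irrefl refl)
    by-cases (no ¬le) = outer c b b∈ λ x x∈ → part x (position x x∈)
      where
      part : ∀ x → _ → x ∈ˡ last ℓ (L (prev c)) ++ first ℓ (L c)
      part x (j , j<ℓ , inj₁ at) = ∈-++⁺ˡ (at⇒∈-drop (≤-trans
        (m≤n+o⇒m∸n≤o (length (L (prev c))) ℓ (≤-trans (<⇒≤ (≰⇒> ¬le)) (≤-reflexive (+-comm o ℓ)))) (m≤m+n o j)) at)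
      part x (j , j<ℓ , inj₂ (k , k<ℓ , _ , at)) = ∈-++⁺ʳ (last ℓ (L (prev c))) (at⇒∈-take k<ℓ at)

-- Trimmed blocks, the number of colours and the conclusion

threshold : ∀ (g : ℕ → ℕ) A k → g 0 < A → A ≤ g k → ∃[ M ] g M < A × A ≤ g (suc M)
threshold g A zero    g0<A A≤g0 = contradiction g0<A (≤⇒≯ A≤g0)
threshold g A (suc k) g0<A A≤g with A ≤? g k
... | yes A≤gk = threshold g A k g0<A A≤gk
... | no A≰gk  = k , ≰⇒> A≰gk , A≤g

module _ {n k j μ} (S : PartialSystem n k (suc j) μ) (t<k : suc j < k) where

  private
    t : ℕ
    t = suc j

  -- Smaller blocks only strengthen the conclusion and cannot raise codegrees. Blocks that become
  -- equal stay separate list entries and are counted with multiplicity.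
  trimmed : List (Subset n)
  trimmed = List.map (truncate (suc t)) (blocks S)

  trimmed-size : All (λ b → ∣ b ∣ ≡ suc t) trimmed
  trimmed-size = All.map⁺ (All.map (λ {b} eq → ∣truncate∣ (suc t) b (≤-trans t<k (≤-reflexive (sym eq)))) (block-size S))

  trimmed-covered : ∀ T → ∣ T ∣ ≡ t → codegree trimmed T ≤ μ
  trimmed-covered T eq = begin
    codegree trimmed T                                  ≡⟨ ∑-map (truncate (suc t)) (blocks S) (λ b → 𝟙 (T ⊆? b)) ⟩
    ∑ (blocks S) (λ b → 𝟙 (T ⊆? truncate (suc t) b))
      ≤⟨ ∑-mono (blocks S) (λ b → 𝟙-mono (T ⊆? truncate (suc t) b) (T ⊆? b) (λ T⊆ → ⊆-trans T⊆ (truncate-⊆ (suc t) b))) ⟩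
    ∑ (blocks S) (λ b → 𝟙 (T ⊆? b))                    ≡⟨ length-filter (T ⊆?_) (blocks S) ⟨
    length (filter (T ⊆?_) (blocks S))                  ≤⟨ t-covered S T eq ⟩
    μ                                                   ∎
    where open ≤-Reasoning

  trimmed⇒good : ∀ {ℓ} (φ : Sequencing n) →
    (∀ Y → ∣ Y ∣ ≡ ℓ → CyclicallyConsecutive φ Y → ∀ b → b ∈ˡ trimmed → ¬ b ⊆ Y) → CyclicallyGood S ℓ φ
  trimmed⇒good φ free Y ∣Y∣≡ℓ consecutive {b} b∈ b⊆Y = free Y ∣Y∣≡ℓ consecutive (truncate (suc t) b)
    (∈-map⁺ (truncate (suc t)) b∈) (⊆-trans (truncate-⊆ (suc t) b) b⊆Y)

  trimmed-sparse : ∀ m → suc t ^ suc t * (μ * n ^ j) * (2 ^ suc t ∸ 1) ≤ t ! * (t ^ t * m ^ t) →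
    ∀ v → suc t ^ suc t * ∑ trimmed (λ b → 𝟙 (v ∈? b)) * (2 ^ suc t ∸ 1) ≤ t ^ t * m ^ t
  trimmed-sparse m many v = *-cancelˡ-≤ (t !) {{t !≢0}} (begin
    t ! * (A * d * W)      ≡⟨ lem (t !) A d W ⟩
    A * (d * t !) * W      ≤⟨ *-monoˡ-≤ W (*-monoʳ-≤ A (≤-trans (*-monoˡ-≤ (t !) degree≤)
                                (codegree-bound trimmed trimmed-size trimmed-covered j ⁅ v ⁆ (cong (λ z → z + j) (∣⁅x⁆∣≡1 v))))) ⟩
    A * (μ * n ^ j) * W    ≤⟨ many ⟩
    t ! * (t ^ t * m ^ t)  ∎)
    where
    open ≤-Reasoning
    A W d : ℕ
    A = suc t ^ suc t
    W = 2 ^ suc t ∸ 1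
    d = ∑ trimmed (λ b → 𝟙 (v ∈? b))
    lem : ∀ f a d w → f * (a * d * w) ≡ a * (d * f) * w
    lem = solve-∀
    degree≤ : d ≤ codegree trimmed ⁅ v ⁆
    degree≤ = ∑-mono trimmed (λ b → 𝟙-mono (v ∈? b) (⁅ v ⁆ ⊆? b) (λ v∈ y∈ → subst (_∈ b) (sym (x∈⁅y⁆⇒x≡y v y∈)) v∈))

  good-sequencing : ∀ ℓ M .{{_ : NonZero μ}} → 2 ≤ t → t < ℓ →
    suc t ^ suc t * (μ * n ^ j) * (2 ^ suc t ∸ 1) ≤ t ! * (t ^ t * suc M ^ t) →
    t ! * (2 * ℓ * M) + (2 ^ suc t ∸ 1) * μ * ℓ ^ t ≤ t ! * n →
    ∃[ φ ] CyclicallyGood S ℓ φ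
  good-sequencing ℓ M 2≤t t<ℓ many room =
    let f , good = Colouring.good-colouring {M = M} trimmed trimmed-size (trimmed-sparse (suc M) many)
        L , valid , long = Repair.long-classes {M = M} trimmed trimmed-size trimmed-covered 2≤t t<ℓ room f good
        open Repair.Valid valid
        module W = Windows trimmed L partition inner outer long
    in W.sequencing , trimmed⇒good W.sequencing W.windows-free

short-windows-good : ∀ {n k t μ ℓ} (S : PartialSystem n k t μ) (φ : Sequencing n) → ℓ < k → CyclicallyGood S ℓ φ
short-windows-good S φ ℓ<k Y ∣Y∣≡ℓ _ b∈ b⊆Y =
  <⇒≱ ℓ<k (subst₂ _≤_ (All.lookup (block-size S) b∈) ∣Y∣≡ℓ (p⊆q⇒∣p∣≤∣q∣ b⊆Y))

open import Data.Integer using (+_)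
open import Data.Rational using (_/_)

theorem1 : ∀ (k t μ : ℕ) .{{_ : NonZero k}} .{{_ : NonZero t}} .{{_ : NonZero μ}} →
    t + 1 ≤ k → 2 ≤ t →
    ∀ (α : ℝ) → 0ᴿ <ᴿ α →
    fromℚ ((+ (μ * (2 ^ (t + 1) ∸ 1)) / (t !)) {{t !≢0}}) *ᴿ α ^ᴿ t
    +ᴿ fromℕ 2
    *ᴿ ((e *ᴿ fromℚ ((+ (μ * (t + 1) * (2 ^ (t + 1) ∸ 1)) / (t !)) {{t !≢0}})) ^1/ t)
    *ᴿ α
    ≃ 1ᴿ →
    ∀ (n : ℕ) → k ≤ n → (S : PartialSystem n k t μ) →
    ∀ (ℓ : ℕ) .{{_ : NonZero ℓ}} → fromℕ ℓ ≤ᴿ α *ᴿ (fromℕ n ^1/ t) →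
    ∃[ φ ] CyclicallyGood S ℓ φ
theorem1 k (suc j) μ t+1≤k 2≤t α 0<α equation n k≤n S ℓ ℓ≤αn^ = by-length (suc j <? ℓ)
  where
  t<k : suc j < k
  t<k = ≤-trans (≤-reflexive (+-comm 1 (suc j))) t+1≤k
  b A : ℕ
  b = μ * (suc j + 1) * (2 ^ (suc j + 1) ∸ 1)
  A = suc (suc j) ^ suc j * (b * n ^ j)
  g : ℕ → ℕ
  g m = suc j ! * (suc j ^ suc j * m ^ suc j)
  2^-nonZero : NonZero (2 ^ (suc j + 1) ∸ 1)
  2^-nonZero = >-nonZero (m<n⇒0<n∸m {1} (≤-trans (≤-reflexive (sym (^-identityʳ 2))) (^-monoʳ-≤ 2 {1} {suc j + 1} (s≤s z≤n))))
  0<A : 0 < A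
  0<A = >-nonZero⁻¹ A {{m*n≢0 (suc (suc j) ^ suc j) (b * n ^ j) {{m^n≢0 (suc (suc j)) (suc j)}}
    {{m*n≢0 b (n ^ j) {{m*n≢0 (μ * (suc j + 1)) (2 ^ (suc j + 1) ∸ 1) {{m*n≢0 μ (suc j + 1)}} {{2^-nonZero}}}}
      {{m^n≢0 n j {{>-nonZero (≤-trans (≤-trans (s≤s z≤n) t<k) k≤n)}}}}}}}}
  -- A itself is a sufficient number of colours, because A ≤ A ^ t.
  A≤gA : A ≤ g A
  A≤gA = ≤-trans (m≤m*n A (A ^ j) {{m^n≢0 A j {{>-nonZero 0<A}}}})
    (≤-trans (m≤n*m (A ^ suc j) (suc j ^ suc j) {{m^n≢0 (suc j) (suc j)}})
             (m≤n*m (suc j ^ suc j * A ^ suc j) (suc j !) {{suc j !≢0}}))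
  g0<A : g 0 < A
  g0<A = subst (_< A) (sym (trans (cong (suc j ! *_) (*-zeroʳ (suc j ^ suc j))) (*-zeroʳ (suc j !)))) 0<A
  -- M + 1 colours satisfy the condition of the colouring argument and M do not; the strict failure
  -- for M is the upper bound on M that `estimate` requires.
  found : ∃[ M ] g M < A × A ≤ g (suc M)
  found = threshold g A A g0<A A≤gA
  M : ℕ
  M = proj₁ found
  W*μ≡ : (2 ^ suc (suc j) ∸ 1) * μ ≡ μ * (2 ^ (suc j + 1) ∸ 1)
  W*μ≡ = trans (*-comm (2 ^ suc (suc j) ∸ 1) μ) (cong (λ z → μ * (2 ^ z ∸ 1)) (+-comm 1 (suc j)))
  A≡ : suc (suc j) ^ suc (suc j) * (μ * n ^ j) * (2 ^ suc (suc j) ∸ 1) ≡ A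
  A≡ = trans (lem (suc (suc j)) (suc (suc j) ^ suc j) μ (n ^ j) (2 ^ suc (suc j) ∸ 1))
    (cong (λ z → suc (suc j) ^ suc j * (μ * z * (2 ^ z ∸ 1) * n ^ j)) (+-comm 1 (suc j)))
    where
    lem : ∀ s p μ x w → s * p * (μ * x) * w ≡ p * (μ * s * w * x)
    lem = solve-∀
  by-length : Dec (suc j < ℓ) → ∃[ φ ] CyclicallyGood S ℓ φ
  by-length (no t≮ℓ) = ⤖-id (Fin n) , short-windows-good S (⤖-id (Fin n)) (≤-<-trans (≮⇒≥ t≮ℓ) t<k)
  by-length (yes t<ℓ) = good-sequencing S t<k ℓ M 2≤t t<ℓ
    (≤-trans (≤-reflexive A≡) (proj₂ (proj₂ found)))
    (≤-trans (≤-reflexive (cong (λ z → suc j ! * (2 * ℓ * M) + z * ℓ ^ suc j) W*μ≡))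
      (Reals.estimate {j} {n} {ℓ} {M} {μ * (2 ^ (suc j + 1) ∸ 1)} {b} {suc j !} {{suc j !≢0}} α 0<α equation ℓ≤αn^ (proj₁ (proj₂ found))))
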